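{- Let $\Gamma$ be a distance-regular graph with diameter $D\geq 3$ and valency $k$. If $k_2\leq \frac{3}{2}k$, then one of the following holds: (1) $k=2$ and $\Gamma$ is a polygon; (2) $D=3$ and $\Gamma$ is bipartite; (3) $D=3$ and $\Gamma$ is a Taylor graph; (4) $\Gamma$ is the Johnson graph $J(7,3)$; (5) $\Gamma$ is the $4$-cube.
   Context: A connected graph $\Gamma$ of diameter $D$ is distance-regular if there are integers $b_i,c_i$ ($0\le i\le D$) such that for any vertices $x,y$ at distance $i$, exactly $c_i$ neighbours of $y$ lie at distance $i-1$ from $x$ and exactly $b_i$ at distance $i+1$ from $x$; $k=b_0$ is the valency. $k_2$ denotes the number of vertices at distance exactly $2$ from a fixed vertex. A polygon is a cycle graph. A Taylor graph is a distance-regular graph with intersection array $\{k,\mu,1;1,\mu,k\}$. $J(7,3)$ is the graph on $3$-subsets of a $7$-set, adjacent when they meet in $2$ elements. The $4$-cube is the graph on $\{0,1\}^4$ with vectors adjacent when they differ in exactly one coordinate. -}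

module Defs where

open import Data.Nat using (ℕ; zero; suc; _+_; _*_; _≤_; _<_; _%_; _≡ᵇ_; pred)
open import Data.Bool using (Bool; true; false; _∧_; _∨_; if_then_else_; not)
open import Data.Fin using (Fin; zero; suc; toℕ; _≟_)
open import Data.Fin.Subset using (Subset; _∩_; ∣_∣)
open import Data.Vec using (Vec; []; _∷_)
open import Data.Product using (Σ; ∃; ∃-syntax; _×_; _,_)
open import Data.Sum using (_⊎_)
open import Relation.Nullary using (¬_)
open import Relation.Nullary.Decidable using (⌊_⌋)
open import Relation.Binary.PropositionalEquality using (_≡_; _≢_)
open import Function.Bundles using (_↔_; Inverse)

record Graph (n : ℕ) : Set where
  field
    adj     : Fin n → Fin n → Bool
    adj-sym : ∀ x y → adj x y ≡ adj y x
    adj-irr : ∀ x → adj x x ≡ false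
open Graph public

count : ∀ {n} → (Fin n → Bool) → ℕ
count {zero}  p = 0
count {suc n} p = (if p zero then 1 else 0) + count (λ i → p (suc i))

anyFin : ∀ {n} → (Fin n → Bool) → Bool
anyFin {zero}  p = false
anyFin {suc n} p = p zero ∨ anyFin (λ i → p (suc i))

module _ {n : ℕ} (G : Graph n) where

  within : ℕ → Fin n → Fin n → Bool
  within zero    x y = ⌊ x ≟ y ⌋
  within (suc j) x y = within j x y ∨ anyFin (λ z → within j x z ∧ adj G z y)

  distAux : ℕ → ℕ → Fin n → Fin n → ℕ
  distAux zero     j x y = j
  distAux (suc f)  j x y = if within j x y then j else distAux f (suc j) x y

  -- graph distance (for connected graphs; for unreachable pairs it is n)
  dist : Fin n → Fin n → ℕ
  dist x y = distAux n 0 x y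

  Connected : Set
  Connected = ∀ x y → ∃[ j ] within j x y ≡ true

  nbrsAt : Fin n → Fin n → ℕ → ℕ
  nbrsAt x y i = count (λ z → adj G y z ∧ (dist x z ≡ᵇ i))

  kAt : Fin n → ℕ → ℕ
  kAt x i = count (λ z → dist x z ≡ᵇ i)

  record IsDistanceRegular (D : ℕ) : Set where
    field
      connected : Connected
      diam-le   : ∀ x y → dist x y ≤ D
      diam-att  : ∃[ x ] ∃[ y ] dist x y ≡ D
      b c       : ℕ → ℕ
      c-spec    : ∀ x y → nbrsAt x y (pred (dist x y)) ≡ c (dist x y)
      b-spec    : ∀ x y → nbrsAt x y (suc (dist x y)) ≡ b (dist x y)

    valency : ℕ
    valency = b 0

  Bipartite : Set
  Bipartite = Σ (Fin n → Bool) λ col → (∀ (x y : Fin n) → adj G x y ≡ true → col x ≢ col y)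

Iso : ∀ {n} → Graph n → (V : Set) → (V → V → Bool) → Set
Iso {n} G V adjV =
  Σ (Fin n ↔ V) λ e → ∀ x y → adj G x y ≡ adjV (Inverse.to e x) (Inverse.to e y)

cycleAdj : (m : ℕ) → Fin m → Fin m → Bool
cycleAdj zero    () _
cycleAdj (suc m) x y = (toℕ y ≡ᵇ (suc (toℕ x) % suc m)) ∨ (toℕ x ≡ᵇ (suc (toℕ y) % suc m))

Polygon : ∀ {n} → Graph n → Set
Polygon G = ∃[ m ] (3 ≤ m × Iso G (Fin m) (cycleAdj m))

J73-V : Set
J73-V = Σ (Subset 7) λ s → ∣ s ∣ ≡ 3

J73-adj : J73-V → J73-V → Bool
J73-adj (s , _) (t , _) = ∣ s ∩ t ∣ ≡ᵇ 2

Cube4-V : Set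
Cube4-V = Vec Bool 4

differ : Bool → Bool → Bool
differ true  true  = false
differ false false = false
differ _     _     = true

hamming : ∀ {m} → Vec Bool m → Vec Bool m → ℕ
hamming [] [] = 0
hamming (a ∷ u) (b ∷ v) = (if differ a b then 1 else 0) + hamming u v

Cube4-adj : Cube4-V → Cube4-V → Bool
Cube4-adj u v = hamming u v ≡ᵇ 1

{-# OPTIONS --safe #-}
-- Everything happens in the local graph Δ = Γ(y) of a vertex y, which has valency a = a₁ and b = b₁ non-neighbours at each vertex.
-- With c = c₂ the hypothesis k₂ ≤ 3k/2 says 2b ≤ 3c, and diameter at least 3 gives c ≤ b.
-- For m, m′ ∈ Δ let s be the number of common non-neighbours in Δ and ν the number of common neighbours in Γ₂(y);
-- then s + ν equals b if m ~ m′ and b + c − a − 2 otherwise. Counting pairs w ∈ Δ, x ∈ Γ₂(y) at distance 3 with x ~ m, m′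
-- gives ν ≤ s and s(2c − b) ≤ cν, because each x is at distance 3 from b₂ vertices of Δ, and any two non-neighbours of w
-- have many common neighbours among the b b₂/c vertices x of Γ₂(y) at distance 3 from w.
--
-- If b = c this forces b₂ = 1, hence a Taylor graph (a polygon if c = 1). If b > c and a = 0, two c-subsets of Γ(y) meet
-- as soon as 2c > k, which makes the graph bipartite; the case k = 4 leaves the 4-cube. If b > c and a > 0, the vertices of Δ
-- at distance 3 from some x ∈ Γ₂(y) bound b₂ by 2c/3 or form a clique with 2b = 3c. The first alternative contradicts the
-- count of two-step walks inside Γ₃, the second leaves finitely many intersection arrays, of which only that of J(7,3) passes
-- the same count. There Δ is a 3 × 4 grid, since adjacent pairs with s = 3 and s = 4 form its columns and rows.
module Submission where

open import Defs
open import Data.Bool using (Bool; true; false; _∧_; _∨_; not; if_then_else_; T)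
import Data.Bool as B
open import Data.Empty using (⊥; ⊥-elim)
open import Data.Fin using (Fin; zero; suc; toℕ; fromℕ<)
import Data.Fin as F
import Data.Fin.Properties as FP
open import Data.Fin.Subset using (Subset; _∩_; ∣_∣)
open import Data.List using (_∷_; [])
open import Data.Nat using (ℕ; zero; suc; _+_; _*_; _∸_; _%_; _≤_; _<_; z≤n; s≤s; pred; _≡ᵇ_; _<ᵇ_; _≟_; NonZero; >-nonZero)
open import Data.Nat.DivMod using (m<n⇒m%n≡m; n%n≡0)
open import Data.Nat.Properties hiding (_≟_)
open import Data.Nat.Tactic.RingSolver using (solve)
open import Data.Product using (∃-syntax; _×_; _,_; proj₁; proj₂)
open import Data.Sum using (_⊎_; inj₁; inj₂; [_,_]′)
open import Data.Unit using (⊤; tt)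
open import Data.Vec using (Vec)
open import Function.Bundles using (_↔_; Inverse; mk↔ₛ′)
open import Relation.Binary.Definitions using (tri<; tri≈; tri>)
open import Relation.Binary.PropositionalEquality
open import Relation.Nullary using (Dec; yes; no; does; ¬_; contradiction)
open import Relation.Nullary.Decidable using (_×-dec_; _⊎-dec_; _→-dec_; ¬?; toSum; decidable-stable; toWitness; True)

-- Counting

-- The constant 3/2 enters through 2c - b > 0: the bound s(2c - b) ≤ cν makes ν positive whenever s
-- + ν is. Adjacent pairs in Δ have s + ν = b > 0, but for non-adjacent pairs the sum vanishes if a
-- + 2 = b + c. Then Δ has no three pairwise non-adjacent vertices, two non-adjacent vertices of Δ
-- have no common neighbour in Γ₂(y), and the counting says nothing about them; `NoQuadrangle`
-- excludes this case by a parity argument on non-adjacency inside Γ(y) ∩ Γ(w). For w, w′ in Δ at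
-- distance 3 from the same x, the c common neighbours of x and y are common non-neighbours of w and
-- w′, hence s ≥ c. Adjacent pairs also satisfy 2s + c ≤ 2b ≤ 3c, so two such vertices can be
-- adjacent only if 2b = 3c. This is the source of the alternative between a small b₂ and a clique.
-- Both sporadic graphs are identified through labels: a covering labelling that reproduces the
-- adjacency table is automatically injective, because no two vertices of the target have the same
-- neighbours.

variable
  n : ℕ

+-interchange : ∀ a b c d → (a + b) + (c + d) ≡ (a + c) + (b + d)
+-interchange a b c d = begin
  (a + b) + (c + d) ≡⟨ +-assoc a b (c + d) ⟩
  a + (b + (c + d)) ≡⟨ cong (a +_) (trans (sym (+-assoc b c d)) (trans (cong (_+ d) (+-comm b c)) (+-assoc c b d))) ⟩
  a + (c + (b + d)) ≡⟨ sym (+-assoc a c (b + d)) ⟩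
  (a + c) + (b + d) ∎
  where open ≡-Reasoning

opaque

  ∑ : (Fin n → ℕ) → ℕ
  ∑ {zero}  f = 0
  ∑ {suc n} f = f zero + ∑ (λ i → f (suc i))

  ∑-mono : {f g : Fin n → ℕ} → (∀ i → f i ≤ g i) → ∑ f ≤ ∑ g
  ∑-mono {zero}  h = z≤n
  ∑-mono {suc n} h = +-mono-≤ (h zero) (∑-mono (λ i → h (suc i)))

  ∑-cong : {f g : Fin n → ℕ} → (∀ i → f i ≡ g i) → ∑ f ≡ ∑ g
  ∑-cong {zero}  h = refl
  ∑-cong {suc n} h = cong₂ _+_ (h zero) (∑-cong (λ i → h (suc i)))

  ∑-0 : ∑ {n} (λ _ → 0) ≡ 0
  ∑-0 {zero}  = refl
  ∑-0 {suc n} = ∑-0 {n}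

  ∑-+ : (f g : Fin n → ℕ) → ∑ (λ i → f i + g i) ≡ ∑ f + ∑ g
  ∑-+ {zero}  f g = refl
  ∑-+ {suc n} f g = trans (cong ((f zero + g zero) +_) (∑-+ (λ i → f (suc i)) (λ i → g (suc i))))
                          (+-interchange (f zero) (g zero) _ _)

  ∑-* : (f : Fin n → ℕ) (c : ℕ) → ∑ (λ i → f i * c) ≡ ∑ f * c
  ∑-* {zero}  f c = refl
  ∑-* {suc n} f c = trans (cong (f zero * c +_) (∑-* (λ i → f (suc i)) c)) (sym (*-distribʳ-+ c (f zero) _))

  ∑-swap : ∀ {m n} (f : Fin m → Fin n → ℕ) → ∑ (λ i → ∑ (f i)) ≡ ∑ (λ j → ∑ (λ i → f i j))
  ∑-swap {zero}  {n} f = sym (∑-0 {n})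
  ∑-swap {suc m} {n} f = trans (cong (∑ (f zero) +_) (∑-swap (λ i → f (suc i))))
                               (sym (∑-+ (f zero) (λ j → ∑ (λ i → f (suc i) j))))

Pred? : ∀ {n} → (Fin n → Set) → Set
Pred? P = ∀ z → Dec (P z)

ind : Bool → ℕ
ind b = if b then 1 else 0

opaque

  infix 8 #_
  #_ : {P : Fin n → Set} → Pred? P → ℕ
  #_ P? = ∑ (λ z → ind (does (P? z)))

  #-∑ : {P : Fin n → Set} (P? : Pred? P) → # P? ≡ ∑ (λ z → ind (does (P? z)))
  #-∑ P? = refl

opaque
  unfolding ∑ #_

  #-count : {P : Fin n → Set} (P? : Pred? P) → # P? ≡ count (λ z → does (P? z))
  #-count P? = sym (count-∑ (λ z → does (P? z)))
    where
    count-∑ : ∀ {m} (p : Fin m → Bool) → count p ≡ ∑ (λ z → ind (p z))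
    count-∑ {zero}  p = refl
    count-∑ {suc m} p = cong (ind (p zero) +_) (count-∑ (λ i → p (suc i)))

  #-suc : {P : Fin (suc n) → Set} (P? : Pred? P) → # P? ≡ ind (does (P? zero)) + # (λ i → P? (suc i))
  #-suc P? = refl

  #-zero : {P : Fin 0 → Set} (P? : Pred? P) → # P? ≡ 0
  #-zero P? = refl

ind-yes : ∀ {P : Set} (P? : Dec P) → P → ind (does P?) ≡ 1
ind-yes (yes _) p = refl
ind-yes (no ¬p) p = ⊥-elim (¬p p)

ind-no : ∀ {P : Set} (P? : Dec P) → ¬ P → ind (does P?) ≡ 0
ind-no (yes p) ¬p = ⊥-elim (¬p p)
ind-no (no _)  _  = refl

module _ {P Q : Fin n → Set} (P? : Pred? P) (Q? : Pred? Q) where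

  #-mono : (∀ z → P z → Q z) → # P? ≤ # Q?
  #-mono h = subst₂ _≤_ (sym (#-∑ P?)) (sym (#-∑ Q?)) (∑-mono step)
    where
    step : ∀ z → ind (does (P? z)) ≤ ind (does (Q? z))
    step z with P? z
    ... | no _  = z≤n
    ... | yes p = ≤-reflexive (sym (ind-yes (Q? z) (h z p)))

  #-cong : (∀ z → P z → Q z) → (∀ z → Q z → P z) → # P? ≡ # Q?
  #-cong f g = trans (#-∑ P?) (trans (∑-cong step) (sym (#-∑ Q?)))
    where
    step : ∀ z → ind (does (P? z)) ≡ ind (does (Q? z))
    step z with P? z
    ... | no ¬p = sym (ind-no (Q? z) (λ q → ¬p (g z q)))
    ... | yes p = sym (ind-yes (Q? z) (f z p))

  module _ {R : Fin n → Set} (R? : Pred? R) where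

    #-cover : (∀ z → R z → P z ⊎ Q z) → # R? ≤ # P? + # Q?
    #-cover h = subst₂ _≤_ (sym (#-∑ R?)) (trans (∑-+ _ _) (sym (cong₂ _+_ (#-∑ P?) (#-∑ Q?)))) (∑-mono step)
      where
      step : ∀ z → ind (does (R? z)) ≤ ind (does (P? z)) + ind (does (Q? z))
      step z with R? z
      ... | no _ = z≤n
      ... | yes r with h z r
      ... | inj₁ p = ≤-trans (≤-reflexive (sym (ind-yes (P? z) p))) (m≤m+n _ _)
      ... | inj₂ q = ≤-trans (≤-reflexive (sym (ind-yes (Q? z) q))) (m≤n+m _ _)

    #-pack : (∀ z → P z → R z) → (∀ z → Q z → R z) → (∀ z → P z → Q z → ⊥) → # P? + # Q? ≤ # R?
    #-pack f g x = subst₂ _≤_ (trans (∑-+ _ _) (sym (cong₂ _+_ (#-∑ P?) (#-∑ Q?)))) (sym (#-∑ R?)) (∑-mono step)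
      where
      step : ∀ z → ind (does (P? z)) + ind (does (Q? z)) ≤ ind (does (R? z))
      step z with P? z | Q? z
      ... | yes p | yes q = ⊥-elim (x z p q)
      ... | yes p | no _  = ≤-reflexive (sym (ind-yes (R? z) (f z p)))
      ... | no _  | yes q = ≤-reflexive (sym (ind-yes (R? z) (g z q)))
      ... | no _  | no _  = z≤n

    #-split : (∀ z → R z → P z ⊎ Q z) → (∀ z → P z → R z) → (∀ z → Q z → R z) →
              (∀ z → P z → Q z → ⊥) → # R? ≡ # P? + # Q?
    #-split h f g x = ≤-antisym (#-cover h) (#-pack f g x)

    #-incl-excl : (∀ z → P z → R z) → (∀ z → Q z → R z) → # P? + # Q? ≤ # R? + # (λ z → P? z ×-dec Q? z)
    #-incl-excl f g = subst₂ _≤_ (trans (∑-+ _ _) (sym (cong₂ _+_ (#-∑ P?) (#-∑ Q?))))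
                        (trans (∑-+ _ _) (sym (cong₂ _+_ (#-∑ R?) (#-∑ (λ z → P? z ×-dec Q? z))))) (∑-mono step)
      where
      step : ∀ z → ind (does (P? z)) + ind (does (Q? z)) ≤ ind (does (R? z)) + ind (does (P? z ×-dec Q? z))
      step z with P? z | Q? z
      ... | yes p | yes q = +-monoˡ-≤ 1 (≤-reflexive (sym (ind-yes (R? z) (f z p))))
      ... | yes p | no _  = ≤-trans (≤-reflexive (sym (ind-yes (R? z) (f z p)))) (m≤m+n _ _)
      ... | no _  | yes q = ≤-trans (≤-reflexive (sym (ind-yes (R? z) (g z q)))) (m≤m+n _ _)
      ... | no _  | no _  = z≤n

module _ {P : Fin n → Set} (P? : Pred? P) where

  #-0 : (∀ z → ¬ P z) → # P? ≡ 0
  #-0 h = trans (#-∑ P?) (trans (∑-cong (λ z → ind-no (P? z) (h z))) (∑-0 {n}))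

#-∃ : {P : Fin n → Set} (P? : Pred? P) → 0 < # P? → ∃[ z ] P z
#-∃ {zero}  P? h with subst (0 <_) (#-zero P?) h
... | ()
#-∃ {suc n} P? h with P? zero | #-suc P?
... | yes p | _ = zero , p
... | no _  | e with #-∃ (λ i → P? (suc i)) (subst (0 <_) e h)
... | z , p = suc z , p

#-sing : (x : Fin n) → # (λ z → z F.≟ x) ≡ 1
#-sing {suc n} zero = trans (#-suc (λ z → z F.≟ zero)) (cong suc (#-0 (λ i → suc i F.≟ zero) (λ _ ())))
#-sing {suc n} (suc x) = trans (#-suc (λ z → z F.≟ suc x))
  (trans (#-cong (λ i → suc i F.≟ suc x) (λ i → i F.≟ x) (λ _ → FP.suc-injective) (λ _ → cong suc)) (#-sing x))

module _ {P : Fin n → Set} (P? : Pred? P) where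

  #-pos : ∀ x → P x → 0 < # P?
  #-pos x p = subst (_≤ # P?) (#-sing x) (#-mono (λ z → z F.≟ x) P? (λ { z refl → p }))

  #-remove : ∀ x → P x → # P? ≡ suc (# (λ z → P? z ×-dec ¬? (z F.≟ x)))
  #-remove x p = trans (#-split (λ z → z F.≟ x) (λ z → P? z ×-dec ¬? (z F.≟ x)) P? split (λ { z refl → p }) (λ _ → proj₁) (λ z e q → proj₂ q e))
                       (cong (_+ # (λ z → P? z ×-dec ¬? (z F.≟ x))) (#-sing x))
    where
    split : ∀ z → P z → z ≡ x ⊎ (P z × ¬ z ≡ x)
    split z q with z F.≟ x
    ... | yes e = inj₁ e
    ... | no ne = inj₂ (q , ne)

  #-two : 1 < # P? → ∀ x → P x → ∃[ z ] (P z × ¬ z ≡ x)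
  #-two h x p = #-∃ _ (≤-pred (subst (1 <_) (#-remove x p) h))

  #-unique : # P? ≤ 1 → ∀ {x y} → P x → P y → x ≡ y
  #-unique h {x} {y} p q with y F.≟ x
  ... | yes e = sym e
  ... | no ne = contradiction (≤-trans (s≤s (#-pos′ )) (≤-trans (≤-reflexive (sym (#-remove x p))) h)) λ { (s≤s ()) }
    where
    #-pos′ : 1 ≤ # (λ z → P? z ×-dec ¬? (z F.≟ x))
    #-pos′ = subst (_≤ # (λ z → P? z ×-dec ¬? (z F.≟ x))) (#-sing y)
               (#-mono (λ z → z F.≟ y) _ (λ { z refl → q , ne }))

#-full : {P Q : Fin n → Set} (P? : Pred? P) (Q? : Pred? Q) → (∀ z → P z → Q z) → # Q? ≤ # P? → ∀ z → Q z → P z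
#-full P? Q? f h z q with P? z
... | yes p = p
... | no ¬p = contradiction h (<⇒≱ (≤-trans (≤-reflexive (trans (+-comm 1 _) (cong (# P? +_) (sym (#-sing z)))))
                (#-pack P? (λ y → y F.≟ z) Q? f (λ { y refl → q }) (λ { y p refl → ¬p p }))))

#-all : ∀ n → # (λ (z : Fin n) → yes tt) ≡ n
#-all zero    = #-zero {P = λ _ → ⊤} (λ z → yes tt)
#-all (suc n) = trans (#-suc {P = λ _ → ⊤} (λ z → yes tt)) (cong suc (#-all n))

#-≤n : {P : Fin n → Set} (P? : Pred? P) → # P? ≤ n
#-≤n {n} P? = subst (# P? ≤_) (#-all n) (#-mono P? (λ _ → yes tt) (λ _ _ → tt))

pairs : ∀ {n} {P Q : Fin n → Set} {R : Fin n → Fin n → Set} →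
        Pred? P → Pred? Q → (∀ x z → Dec (R x z)) → ℕ
pairs P? Q? R? = ∑ (λ x → ind (does (P? x)) * # (λ z → Q? z ×-dec R? x z))

module _ {P Q : Fin n → Set} {R : Fin n → Fin n → Set}
         (P? : Pred? P) (Q? : Pred? Q) (R? : ∀ x z → Dec (R x z)) where

  pairs-≥ : ∀ r → (∀ x → P x → r ≤ # (λ z → Q? z ×-dec R? x z)) → # P? * r ≤ pairs P? Q? R?
  pairs-≥ r h = subst (_≤ pairs P? Q? R?) (trans (∑-* _ r) (cong (_* r) (sym (#-∑ P?)))) (∑-mono step)
    where
    step : ∀ x → ind (does (P? x)) * r ≤ ind (does (P? x)) * # (λ z → Q? z ×-dec R? x z)
    step x with P? x
    ... | no _  = z≤n
    ... | yes p = +-monoˡ-≤ 0 (h x p)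

  pairs-≤ : ∀ r → (∀ x → P x → # (λ z → Q? z ×-dec R? x z) ≤ r) → pairs P? Q? R? ≤ # P? * r
  pairs-≤ r h = subst (pairs P? Q? R? ≤_) (trans (∑-* _ r) (cong (_* r) (sym (#-∑ P?)))) (∑-mono step)
    where
    step : ∀ x → ind (does (P? x)) * # (λ z → Q? z ×-dec R? x z) ≤ ind (does (P? x)) * r
    step x with P? x
    ... | no _  = z≤n
    ... | yes p = +-monoˡ-≤ 0 (h x p)

  private
    ind-×# : ∀ x → ind (does (P? x)) * # (λ z → Q? z ×-dec R? x z)
               ≡ ∑ (λ z → ind (does (P? x) ∧ (does (Q? z) ∧ does (R? x z))))
    ind-×# x with does (P? x)
    ... | true  = trans (+-identityʳ _) (#-∑ (λ z → Q? z ×-dec R? x z))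
    ... | false = sym (∑-0 {n})

  pairs-∑ : pairs P? Q? R? ≡ ∑ (λ x → ∑ (λ z → ind (does (P? x) ∧ (does (Q? z) ∧ does (R? x z)))))
  pairs-∑ = ∑-cong ind-×#

pairs-swap : {P Q : Fin n → Set} {R : Fin n → Fin n → Set}
             (P? : Pred? P) (Q? : Pred? Q) (R? : ∀ x z → Dec (R x z)) →
             pairs P? Q? R? ≡ pairs Q? P? (λ z x → R? x z)
pairs-swap P? Q? R? = trans (pairs-∑ P? Q? R?) (trans (∑-swap _)
  (trans (∑-cong λ z → ∑-cong λ x → cong ind (lem (does (P? x)) (does (Q? z)) (does (R? x z))))
         (sym (pairs-∑ Q? P? (λ z x → R? x z)))))
  where
  lem : ∀ p q r → p ∧ (q ∧ r) ≡ q ∧ (p ∧ r)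
  lem false false r = refl
  lem false true  r = refl
  lem true  false r = refl
  lem true  true  r = refl

double-≤ : {P Q : Fin n → Set} {R : Fin n → Fin n → Set}
           (P? : Pred? P) (Q? : Pred? Q) (R? : ∀ x z → Dec (R x z)) (r s : ℕ) →
           (∀ x → P x → r ≤ # (λ z → Q? z ×-dec R? x z)) →
           (∀ z → Q z → # (λ x → P? x ×-dec R? x z) ≤ s) → # P? * r ≤ # Q? * s
double-≤ P? Q? R? r s f g =
  ≤-trans (pairs-≥ P? Q? R? r f)
          (≤-trans (≤-reflexive (pairs-swap P? Q? R?)) (pairs-≤ Q? P? (λ z x → R? x z) s g))

double : {P Q : Fin n → Set} {R : Fin n → Fin n → Set}
         (P? : Pred? P) (Q? : Pred? Q) (R? : ∀ x z → Dec (R x z)) (r s : ℕ) →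
         (∀ x → P x → # (λ z → Q? z ×-dec R? x z) ≡ r) →
         (∀ z → Q z → # (λ x → P? x ×-dec R? x z) ≡ s) → # P? * r ≡ # Q? * s
double P? Q? R? r s f g = ≤-antisym
  (double-≤ P? Q? R? r s (λ x p → ≤-reflexive (sym (f x p))) (λ z q → ≤-reflexive (g z q)))
  (double-≤ Q? P? (λ z x → R? x z) s r (λ z q → ≤-reflexive (sym (g z q))) (λ x p → ≤-reflexive (f x p)))

module _ {P P₁ P₂ Q : Fin n → Set} {R : Fin n → Fin n → Set}
         (P? : Pred? P) (P₁? : Pred? P₁) (P₂? : Pred? P₂) (Q? : Pred? Q) (R? : ∀ x z → Dec (R x z)) where

  private
    rhs : pairs P₁? Q? R? + pairs P₂? Q? R? ≡
          ∑ (λ x → (ind (does (P₁? x)) + ind (does (P₂? x))) * # (λ z → Q? z ×-dec R? x z))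
    rhs = trans (sym (∑-+ _ _)) (∑-cong λ x → sym (*-distribʳ-+ _ (ind (does (P₁? x))) _))

  pairs-cover : (∀ x → P x → P₁ x ⊎ P₂ x) → pairs P? Q? R? ≤ pairs P₁? Q? R? + pairs P₂? Q? R?
  pairs-cover h = subst (pairs P? Q? R? ≤_) (sym rhs) (∑-mono λ x → *-monoˡ-≤ _ (step x))
    where
    step : ∀ z → ind (does (P? z)) ≤ ind (does (P₁? z)) + ind (does (P₂? z))
    step z with P? z
    ... | no _ = z≤n
    ... | yes r with h z r
    ... | inj₁ p = ≤-trans (≤-reflexive (sym (ind-yes (P₁? z) p))) (m≤m+n _ _)
    ... | inj₂ q = ≤-trans (≤-reflexive (sym (ind-yes (P₂? z) q))) (m≤n+m _ _)

  pairs-pack : (∀ x → P₁ x → P x) → (∀ x → P₂ x → P x) → (∀ x → P₁ x → P₂ x → ⊥) →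
               pairs P₁? Q? R? + pairs P₂? Q? R? ≤ pairs P? Q? R?
  pairs-pack f g x = subst (_≤ pairs P? Q? R?) (sym rhs) (∑-mono λ x → *-monoˡ-≤ _ (step x))
    where
    step : ∀ z → ind (does (P₁? z)) + ind (does (P₂? z)) ≤ ind (does (P? z))
    step z with P₁? z | P₂? z
    ... | yes p | yes q = ⊥-elim (x z p q)
    ... | yes p | no _  = ≤-reflexive (sym (ind-yes (P? z) (f z p)))
    ... | no _  | yes q = ≤-reflexive (sym (ind-yes (P? z) (g z q)))
    ... | no _  | no _  = z≤n

-- Graph distance

∨-true : ∀ {a b} → a ∨ b ≡ true → a ≡ true ⊎ b ≡ true
∨-true {true}  h = inj₁ refl
∨-true {false} h = inj₂ h

∨-trueˡ : ∀ {a b} → a ≡ true → a ∨ b ≡ true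
∨-trueˡ refl = refl

∨-trueʳ : ∀ {a b} → b ≡ true → a ∨ b ≡ true
∨-trueʳ {true}  h = refl
∨-trueʳ {false} h = h

∧-true : ∀ {a b} → a ∧ b ≡ true → a ≡ true × b ≡ true
∧-true {true} {true} h = refl , refl

anyFin-∃ : (p : Fin n → Bool) → anyFin p ≡ true → ∃[ z ] p z ≡ true
anyFin-∃ {suc n} p h with p zero in eq
... | true  = zero , eq
... | false with anyFin-∃ (λ i → p (suc i)) h
... | z , e = suc z , e

∃-anyFin : (p : Fin n → Bool) (z : Fin n) → p z ≡ true → anyFin p ≡ true
∃-anyFin p zero    h = ∨-trueˡ h
∃-anyFin p (suc z) h = ∨-trueʳ {p zero} (∃-anyFin (λ i → p (suc i)) z h)

module Distance {n : ℕ} (G : Graph n) (conn : Connected G) where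

  private
    V = Fin n
    W = within G

  within-suc : ∀ {j x y} → W j x y ≡ true → W (suc j) x y ≡ true
  within-suc = ∨-trueˡ

  within-snoc : ∀ {j x y z} → W j x z ≡ true → adj G z y ≡ true → W (suc j) x y ≡ true
  within-snoc {j} {x} {y} {z} h e = ∨-trueʳ {W j x y} (∃-anyFin _ z (cong₂ _∧_ h e))

  within-inv : ∀ {j x y} → W (suc j) x y ≡ true → W j x y ≡ true ⊎ (∃[ z ] (W j x z ≡ true × adj G z y ≡ true))
  within-inv {j} {x} {y} h with ∨-true {W j x y} h
  ... | inj₁ p = inj₁ p
  ... | inj₂ q with anyFin-∃ _ q
  ... | z , e = inj₂ (z , ∧-true e)

  within-mono : ∀ {i j x y} → i ≤ j → W i x y ≡ true → W j x y ≡ true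
  within-mono {j = zero}  z≤n h = h
  within-mono {i} {suc j} p h with m≤n⇒m<n∨m≡n p
  ... | inj₁ (s≤s q) = within-suc {j} (within-mono q h)
  ... | inj₂ refl = h

  within-zero : ∀ {x y} → W 0 x y ≡ true → x ≡ y
  within-zero {x} {y} h with x F.≟ y
  ... | yes e = e
  within-zero {x} {y} () | no _

  within-refl : ∀ x → W 0 x x ≡ true
  within-refl x with x F.≟ x
  ... | yes _ = refl
  ... | no ne = ⊥-elim (ne refl)

  -- `within` prolongs a walk at its last vertex only; prolonging it at the first vertex is what the
  -- induction for symmetry needs.
  within-cons : ∀ j {x y z} → adj G x z ≡ true → W j z y ≡ true → W (suc j) x y ≡ true
  within-cons zero {x} e h with within-zero h
  ... | refl = within-snoc {0} (within-refl x) e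
  within-cons (suc j) e h with within-inv {j} h
  ... | inj₁ p = within-suc {suc j} (within-cons j e p)
  ... | inj₂ (u , p , q) = within-snoc {suc j} (within-cons j e p) q

  within-sym : ∀ j {x y} → W j x y ≡ true → W j y x ≡ true
  within-sym zero h with within-zero h
  ... | refl = h
  within-sym (suc j) h with within-inv {j} h
  ... | inj₁ p = within-suc {j} (within-sym j p)
  ... | inj₂ (u , p , q) = within-cons j (trans (adj-sym G _ _) q) (within-sym j p)

  private
    in? : ∀ j x → Pred? (λ y → W j x y ≡ true)
    in? j x y = W j x y B.≟ true

    -- A ball equal to the next larger one is closed under adjacency, so it already contains
    -- everything reachable from its centre.
    stable : ∀ j x → (∀ y → W (suc j) x y ≡ true → W j x y ≡ true) → ∀ i y → W i x y ≡ true → W j x y ≡ true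
    stable j x h zero    y p = within-mono {0} {j} z≤n p
    stable j x h (suc i) y p with within-inv {i} p
    ... | inj₁ q = stable j x h i y q
    ... | inj₂ (u , q , e) = h y (within-snoc {j} (stable j x h i u q) e)

    -- As long as y is not reached, the balls around x grow strictly, so y is reached after n steps.
    grow : ∀ x y j → W j x y ≡ false → suc j ≤ # (in? j x)
    grow x y zero    h = #-pos (in? 0 x) x (within-refl x)
    grow x y (suc j) h with W j x y in e
    grow x y (suc j) () | true
    ... | false with # (in? (suc j) x) ≤? # (in? j x)
    ...   | yes le = contradiction (trans (sym e) (stable j x (#-full (in? j x) (in? (suc j) x) (λ z → within-suc {j}) le)
                                     (proj₁ (conn x y)) y (proj₂ (conn x y)))) λ ()
    ...   | no gt = ≤-trans (s≤s (grow x y j e)) (≰⇒> gt)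

    reach : ∀ x y → W n x y ≡ true
    reach x y with W n x y in e
    ... | true  = refl
    ... | false = contradiction (≤-trans (grow x y n e) (#-≤n (in? n x))) (<⇒≱ ≤-refl)

    -- When the fuel is used up, `distAux` returns its counter untested; the hypothesis at `f + j`
    -- says that this default is a valid radius.
    aux-within : ∀ f j x y → W (f + j) x y ≡ true → W (distAux G f j x y) x y ≡ true
    aux-within zero    j x y h = h
    aux-within (suc f) j x y h with W j x y in e
    ... | true  = e
    ... | false = aux-within f (suc j) x y (subst (λ i → W i x y ≡ true) (sym (+-suc f j)) h)

    aux-min : ∀ f j x y i → j ≤ i → W i x y ≡ true → distAux G f j x y ≤ i
    aux-min zero    j x y i p h = p
    aux-min (suc f) j x y i p h with W j x y in e
    ... | true  = p
    ... | false with m≤n⇒m<n∨m≡n p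
    ...   | inj₁ q = aux-min f (suc j) x y i q h
    ...   | inj₂ refl = contradiction (trans (sym e) h) λ ()

  dist-within : ∀ x y → W (dist G x y) x y ≡ true
  dist-within x y = aux-within n 0 x y (subst (λ i → W i x y ≡ true) (sym (+-identityʳ n)) (reach x y))

  dist-min : ∀ {x y} i → W i x y ≡ true → dist G x y ≤ i
  dist-min {x} {y} i h = aux-min n 0 x y i z≤n h

  dist-refl : ∀ x → dist G x x ≡ 0
  dist-refl x = n≤0⇒n≡0 (dist-min 0 (within-refl x))

  dist-zero : ∀ {x y} → dist G x y ≡ 0 → x ≡ y
  dist-zero {x} {y} h = within-zero (subst (λ i → W i x y ≡ true) h (dist-within x y))

  dist-sym : ∀ x y → dist G x y ≡ dist G y x
  dist-sym x y = ≤-antisym (dist-min (dist G y x) (within-sym (dist G y x) {y} {x} (dist-within y x)))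
                           (dist-min (dist G x y) (within-sym (dist G x y) {x} {y} (dist-within x y)))

  dist-step : ∀ {x y z} → adj G y z ≡ true → dist G x z ≤ suc (dist G x y)
  dist-step {x} {y} e = dist-min (suc (dist G x y)) (within-snoc {dist G x y} (dist-within x y) e)

  dist-pred : ∀ {x y i} → dist G x y ≡ suc i → ∃[ z ] (adj G z y ≡ true × dist G x z ≡ i)
  dist-pred {x} {y} {i} h with within-inv {i} (subst (λ i → W i x y ≡ true) h (dist-within x y))
  ... | inj₁ p = contradiction (dist-min i p) (<⇒≱ (≤-reflexive (sym h)))
  ... | inj₂ (z , p , e) = z , e , ≤-antisym (dist-min i p) (≤-pred (subst (_≤ suc (dist G x z)) h (dist-step e)))

  dist-adj : ∀ {x y} → adj G x y ≡ true → dist G x y ≡ 1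
  dist-adj {x} {y} e with dist G x y in eq | subst (λ i → dist G x y ≤ suc i) (dist-refl x) (dist-step {x} e)
  ... | zero | _ = contradiction (trans (sym (adj-irr G x)) (subst (λ w → adj G x w ≡ true) (sym (dist-zero eq)) e)) λ ()
  ... | suc zero | _ = refl
  ... | suc (suc _) | s≤s ()

  adj-dist : ∀ {x y} → dist G x y ≡ 1 → adj G x y ≡ true
  adj-dist h with dist-pred h
  ... | z , e , p with dist-zero p
  ... | refl = e

-- Local graphs

infixr 7 _∩?_
_∩?_ : {P Q : Fin n → Set} → Pred? P → Pred? Q → Pred? (λ z → P z × Q z)
(P? ∩? Q?) z = P? z ×-dec Q? z

-- A linear inequality L ≤ R follows from A ≤ B once L + B + e ≡ R + A holds as a semiring identity.
lin : ∀ {A B L R} e → A ≤ B → L + B + e ≡ R + A → L ≤ R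
lin {A} {B} {L} {R} e h eq = +-cancelʳ-≤ B L R
  (≤-trans (m≤m+n (L + B) e) (≤-trans (≤-reflexive eq) (+-monoʳ-≤ R h)))

-- A distance-regular graph given by its distance function d: adjacency is d x y ≡ 1, and B i, C i are the intersection numbers bᵢ, cᵢ.
record Scheme (n : ℕ) : Set where
  field
    d      : Fin n → Fin n → ℕ
    d-refl : ∀ x → d x x ≡ 0
    d-zero : ∀ {x y} → d x y ≡ 0 → x ≡ y
    d-sym  : ∀ x y → d x y ≡ d y x
    d-step : ∀ {x y z} → d y z ≡ 1 → d x z ≤ suc (d x y)
    d-pred : ∀ {x y i} → d x y ≡ suc i → ∃[ z ] (d z y ≡ 1 × d x z ≡ i)
    B C    : ℕ → ℕ

  at : ℕ → Fin n → Fin n → Set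
  at i x z = d x z ≡ i

  at? : ∀ i x → Pred? (at i x)
  at? i x z = d x z ≟ i

  field
    B-spec : ∀ {x y} i → d x y ≡ i → # (at? 1 y ∩? at? (suc i) x) ≡ B i
    C-spec : ∀ {x y} i → d x y ≡ suc i → # (at? 1 y ∩? at? i x) ≡ C (suc i)

  sy : ∀ {x y i} → d x y ≡ i → d y x ≡ i
  sy h = trans (d-sym _ _) h

  tri : ∀ x y z → d x z ≤ d x y + d y z
  tri x y z = go (d y z) z refl
    where
    go : ∀ j z → d y z ≡ j → d x z ≤ d x y + j
    go zero z h with d-zero h
    ... | refl = m≤m+n _ 0
    go (suc j) z h with d-pred h
    ... | u , e , p = ≤-trans (d-step e) (≤-trans (s≤s (go j u p)) (≤-reflexive (sym (+-suc _ j))))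

  tri′ : ∀ {x y z i j l} → d x y ≡ i → d y z ≡ j → d x z ≡ l → l ≤ i + j
  tri′ refl refl refl = tri _ _ _

  -- For numerals the implicit `T (i + j <ᵇ l)` computes to the unit type and is filled in
  -- automatically, so that refuting impossible distances needs no arithmetic at the call.
  no-tri : ∀ {x y z i j l} → d x y ≡ i → d y z ≡ j → d x z ≡ l → {_ : T (i + j <ᵇ l)} → ⊥
  no-tri {i = i} {j} {l} p q r {t} = <⇒≱ (<ᵇ⇒< (i + j) l t) (tri′ p q r)

  clash : ∀ {x y i j} → d x y ≡ i → d x y ≡ j → {_ : T (i <ᵇ j)} → ⊥
  clash {i = i} {j} refl refl {t} = <-irrefl refl (<ᵇ⇒< i j t)

  nb : ∀ {x y z i} → d y z ≡ 1 → d x y ≡ suc i → d x z ≡ i ⊎ d x z ≡ suc i ⊎ d x z ≡ suc (suc i)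
  nb {x} {y} {z} {i} e h = go (d x z) i (≤-trans (tri′ h e refl) (≤-reflexive (+-comm (suc i) 1)))
                             (≤-pred (≤-trans (tri′ refl (sy e) h) (≤-reflexive (+-comm _ 1))))
    where
    go : ∀ m i → m ≤ suc (suc i) → i ≤ m → m ≡ i ⊎ m ≡ suc i ⊎ m ≡ suc (suc i)
    go m i p q with m ≟ i
    ... | yes e = inj₁ e
    ... | no ne with m ≟ suc i
    ... | yes e = inj₂ (inj₁ e)
    ... | no ne′ = inj₂ (inj₂ (≤-antisym p (≤∧≢⇒< (≤∧≢⇒< q (λ e → ne (sym e))) (λ e → ne′ (sym e)))))

  -- When three steps of lengths l, i, j add up to the distance of the ends, they form a geodesic
  -- and the triangle inequality is tight on every part of it.
  geod : ∀ {w y f x l i j} → d w y ≡ l → d y f ≡ i → d f x ≡ j → d w x ≡ l + (i + j) → d y x ≡ i + j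
  geod {l = l} p q r t = ≤-antisym (tri′ q r refl) (+-cancelˡ-≤ l _ _ (tri′ p refl t))

  geodˡ : ∀ {w y f x l i j} → d w y ≡ l → d y f ≡ i → d f x ≡ j → d w x ≡ l + (i + j) → d w f ≡ l + i
  geodˡ {l = l} {i} {j} p q r t = ≤-antisym (tri′ p q refl)
    (+-cancelʳ-≤ j _ _ (≤-trans (≤-reflexive (+-assoc l i j)) (tri′ refl r t)))

  d≢ : ∀ {x y i} → d x y ≡ suc i → ¬ x ≡ y
  d≢ h refl with trans (sym h) (d-refl _)
  ... | ()

-- The parameter `a` is a₁ = k - b₁ - 1, given by the additive equation `hk` to keep truncated
-- subtraction out of the counting.
module Local {n : ℕ} (S : Scheme n) (a : ℕ) (hk : Scheme.B S 0 ≡ suc (a + Scheme.B S 1)) where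

  open Scheme S public

  k = B 0
  b = B 1
  b₂ = B 2
  c = C 2

  val : ∀ y → # (at? 1 y) ≡ k
  val y = trans (#-cong (at? 1 y) (at? 1 y ∩? at? 1 y) (λ _ p → p , p) (λ _ → proj₁)) (B-spec 0 (d-refl y))

  nonnbr : ∀ {y m} → d y m ≡ 1 → # (at? 1 y ∩? at? 2 m) ≡ b
  nonnbr h = B-spec 1 (sy h)

  far : ∀ {y x} → d x y ≡ 2 → # (at? 1 y ∩? at? 3 x) ≡ b₂
  far h = B-spec 2 h

  codeg₂ : ∀ {x y} → d x y ≡ 2 → # (at? 1 y ∩? at? 1 x) ≡ c
  codeg₂ h = C-spec 1 h

  -- Of the k neighbours of y one is x and b lie at distance 2 from x; a are left.
  codeg₁ : ∀ {x y} → d x y ≡ 1 → # (at? 1 y ∩? at? 1 x) ≡ a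
  codeg₁ {x} {y} h = +-cancelʳ-≡ b _ _ (suc-injective (trans (sym e) hk))
    where
    rest : Pred? (λ z → (d y z ≡ 1 × d x z ≡ 1) ⊎ (d y z ≡ 1 × d x z ≡ 2))
    rest z = (at? 1 y ∩? at? 1 x) z ⊎-dec (at? 1 y ∩? at? 2 x) z
    cov : ∀ z → d y z ≡ 1 → z ≡ x ⊎ ((d y z ≡ 1 × d x z ≡ 1) ⊎ (d y z ≡ 1 × d x z ≡ 2))
    cov z p with nb p h
    ... | inj₁ q = inj₁ (sym (d-zero q))
    ... | inj₂ (inj₁ q) = inj₂ (inj₁ (p , q))
    ... | inj₂ (inj₂ q) = inj₂ (inj₂ (p , q))
    e : k ≡ suc (# (at? 1 y ∩? at? 1 x) + b)
    e = trans (sym (val y)) (trans (#-split (λ z → z F.≟ x) rest (at? 1 y) cov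
          (λ { z refl → sy h }) (λ z → [ proj₁ , proj₁ ]′)
          (λ { z refl (inj₁ (_ , q)) → d≢ q refl ; z refl (inj₂ (_ , q)) → d≢ q refl }))
        (cong₂ _+_ (#-sing x) (trans (#-split (at? 1 y ∩? at? 1 x) (at? 1 y ∩? at? 2 x) rest (λ _ q → q) (λ _ → inj₁) (λ _ → inj₂)
            (λ _ p q → clash (proj₂ p) (proj₂ q)))
          (cong (# (at? 1 y ∩? at? 1 x) +_) (nonnbr (sy h))))))

  α ν s : Fin n → Fin n → Fin n → ℕ
  α y m m′ = # (at? 1 y ∩? at? 1 m ∩? at? 1 m′)
  ν y m m′ = # (at? 2 y ∩? at? 1 m ∩? at? 1 m′)
  s y m m′ = # (at? 1 y ∩? at? 2 m ∩? at? 2 m′)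

  -- A common neighbour of m and m′ is y itself or has distance 1 (`α`) or 2 (`ν`) from y.
  codeg-split : ∀ {y m m′} → d y m ≡ 1 → d y m′ ≡ 1 → # (at? 1 m′ ∩? at? 1 m) ≡ suc (α y m m′ + ν y m m′)
  codeg-split {y} {m} {m′} h h′ = trans
    (#-split (λ z → z F.≟ y) rest _ cov (λ { z refl → sy h′ , sy h })
      (λ z → [ (λ (_ , p , q) → q , p) , (λ (_ , p , q) → q , p) ]′)
      (λ { z refl (inj₁ (q , _)) → d≢ q refl ; z refl (inj₂ (q , _)) → d≢ q refl }))
    (cong₂ _+_ (#-sing y) (#-split A? N? rest (λ _ q → q) (λ _ → inj₁) (λ _ → inj₂) (λ _ p q → clash (proj₁ p) (proj₁ q))))
    where
    A? = at? 1 y ∩? at? 1 m ∩? at? 1 m′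
    N? = at? 2 y ∩? at? 1 m ∩? at? 1 m′
    rest : Pred? _
    rest z = A? z ⊎-dec N? z
    cov : ∀ z → d m′ z ≡ 1 × d m z ≡ 1 → z ≡ y ⊎ _
    cov z (p , q) with nb q h
    ... | inj₁ e = inj₁ (sym (d-zero e))
    ... | inj₂ (inj₁ e) = inj₂ (inj₁ (e , q , p))
    ... | inj₂ (inj₂ e) = inj₂ (inj₂ (e , q , p))

  -- Let N be the number of neighbours of m′ in Δ that are not adjacent to m. It completes α + 1 to
  -- a among the neighbours of m′, and s to b among the non-neighbours of m.
  s-adj : ∀ {y m m′} → d y m ≡ 1 → d y m′ ≡ 1 → d m m′ ≡ 1 → s y m m′ + a ≡ suc (b + α y m m′)
  s-adj {y} {m} {m′} h h′ e = arith _ _ _ ea eb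
    where
    arith : ∀ σ al N {a b} → a ≡ suc (al + N) → b ≡ σ + N → σ + a ≡ suc (b + al)
    arith σ al N refl refl = solve (σ ∷ al ∷ N ∷ [])
    σ = s y m m′
    al = α y m m′
    N? = at? 1 y ∩? at? 2 m ∩? at? 1 m′
    N = # N?
    eb : b ≡ σ + N
    eb = trans (sym (nonnbr h)) (#-split (at? 1 y ∩? at? 2 m ∩? at? 2 m′) N? (at? 1 y ∩? at? 2 m) cov
           (λ _ (p , q , _) → p , q) (λ _ (p , q , _) → p , q) (λ _ p q → clash (proj₂ (proj₂ q)) (proj₂ (proj₂ p))))
      where
      cov : ∀ z → d y z ≡ 1 × d m z ≡ 2 → _
      cov z (p , q) with nb p (sy h′)
      ... | inj₁ t = ⊥-elim (clash e (trans (cong (d m) (d-zero t)) q))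
      ... | inj₂ (inj₁ t) = inj₂ (p , q , t)
      ... | inj₂ (inj₂ t) = inj₁ (p , q , t)
    ea : a ≡ suc (al + N)
    ea = trans (sym (codeg₁ (sy h′))) (trans
      (#-split (λ z → z F.≟ m) rest (at? 1 y ∩? at? 1 m′) cov (λ { z refl → h , sy e })
        (λ z → [ (λ (p , _ , q) → p , q) , (λ (p , _ , q) → p , q) ]′)
        (λ { z refl (inj₁ (_ , q , _)) → d≢ q refl ; z refl (inj₂ (_ , q , _)) → d≢ q refl }))
      (cong₂ _+_ (#-sing m) (#-split A? N? rest (λ _ q → q) (λ _ → inj₁) (λ _ → inj₂) (λ _ p q → clash (proj₁ (proj₂ p)) (proj₁ (proj₂ q))))))
      where
      A? = at? 1 y ∩? at? 1 m ∩? at? 1 m′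
      rest : Pred? _
      rest z = A? z ⊎-dec N? z
      cov : ∀ z → d y z ≡ 1 × d m′ z ≡ 1 → z ≡ m ⊎ _
      cov z (p , q) with nb p (sy h)
      ... | inj₁ t = inj₁ (sym (d-zero t))
      ... | inj₂ (inj₁ t) = inj₂ (inj₁ (p , t , q))
      ... | inj₂ (inj₂ t) = inj₂ (inj₂ (p , t , q))

  -- The same count as in `s-adj`; the unit moves because m is no longer a neighbour of m′, while m′
  -- is now a non-neighbour of m.
  s-nonadj : ∀ {y m m′} → d y m ≡ 1 → d y m′ ≡ 1 → d m m′ ≡ 2 → suc (s y m m′ + a) ≡ b + α y m m′
  s-nonadj {y} {m} {m′} h h′ e = arith _ _ _ ea eb
    where
    arith : ∀ σ al N {a b} → a ≡ al + N → b ≡ suc (σ + N) → suc (σ + a) ≡ b + al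
    arith σ al N refl refl = solve (σ ∷ al ∷ N ∷ [])
    σ = s y m m′
    al = α y m m′
    N? = at? 1 y ∩? at? 2 m ∩? at? 1 m′
    N = # N?
    eb : b ≡ suc (σ + N)
    eb = trans (sym (nonnbr h)) (trans (#-split (λ z → z F.≟ m′) rest (at? 1 y ∩? at? 2 m) cov (λ { z refl → h′ , e })
           (λ z → [ (λ (p , q , _) → p , q) , (λ (p , q , _) → p , q) ]′)
           (λ { z refl (inj₁ (_ , _ , q)) → d≢ q refl ; z refl (inj₂ (_ , _ , q)) → d≢ q refl }))
         (cong₂ _+_ (#-sing m′) (#-split S? N? rest (λ _ q → q) (λ _ → inj₁) (λ _ → inj₂)
           (λ _ p q → clash (proj₂ (proj₂ q)) (proj₂ (proj₂ p))))))
      where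
      S? = at? 1 y ∩? at? 2 m ∩? at? 2 m′
      rest : Pred? _
      rest z = S? z ⊎-dec N? z
      cov : ∀ z → d y z ≡ 1 × d m z ≡ 2 → z ≡ m′ ⊎ _
      cov z (p , q) with nb p (sy h′)
      ... | inj₁ t = inj₁ (sym (d-zero t))
      ... | inj₂ (inj₁ t) = inj₂ (inj₂ (p , q , t))
      ... | inj₂ (inj₂ t) = inj₂ (inj₁ (p , q , t))
    ea : a ≡ al + N
    ea = trans (sym (codeg₁ (sy h′))) (#-split (at? 1 y ∩? at? 1 m ∩? at? 1 m′) N? (at? 1 y ∩? at? 1 m′) cov
           (λ _ (p , _ , q) → p , q) (λ _ (p , _ , q) → p , q) (λ _ p q → clash (proj₁ (proj₂ p)) (proj₁ (proj₂ q))))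
      where
      cov : ∀ z → d y z ≡ 1 × d m′ z ≡ 1 → _
      cov z (p , q) with nb p (sy h)
      ... | inj₁ t = ⊥-elim (clash q (trans (d-sym m′ z) (trans (cong (λ u → d u m′) (sym (d-zero t))) e)))
      ... | inj₂ (inj₁ t) = inj₁ (p , t , q)
      ... | inj₂ (inj₂ t) = inj₂ (p , t , q)

  -- Eliminates α: by `codeg-split` the sum α + ν + 1 is the number of all common neighbours, which
  -- is a here and c in `sν-nonadj`.
  sν-adj : ∀ {y m m′} → d y m ≡ 1 → d y m′ ≡ 1 → d m m′ ≡ 1 → s y m m′ + ν y m m′ ≡ b
  sν-adj {y} {m} {m′} h h′ e = arith (s y m m′) (α y m m′) (ν y m m′) a b (s-adj h h′ e)
      (trans (sym (codeg₁ e)) (codeg-split h h′))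
    where
    arith : ∀ σ al v a b → σ + a ≡ suc (b + al) → a ≡ suc (al + v) → σ + v ≡ b
    arith σ al v a b p refl = +-cancelʳ-≡ (suc al) (σ + v) b (trans eq (trans p (sym (+-suc b al))))
      where
      eq : σ + v + suc al ≡ σ + suc (al + v)
      eq = solve (σ ∷ al ∷ v ∷ [])

  sν-nonadj : ∀ {y m m′} → d y m ≡ 1 → d y m′ ≡ 1 → d m m′ ≡ 2 → s y m m′ + ν y m m′ + (a + 2) ≡ b + c
  sν-nonadj {y} {m} {m′} h h′ e = arith (s y m m′) (α y m m′) (ν y m m′) a b c (s-nonadj h h′ e)
      (trans (sym (codeg₂ e)) (codeg-split h h′))
    where
    arith : ∀ σ al v a b c → suc (σ + a) ≡ b + al → c ≡ suc (al + v) → σ + v + (a + 2) ≡ b + c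
    arith σ al v a b c p refl = trans eq (trans (cong (_+ suc v) p) eq′)
      where
      eq : σ + v + (a + 2) ≡ suc (σ + a) + suc v
      eq = solve (σ ∷ a ∷ v ∷ [])
      eq′ : b + al + suc v ≡ b + suc (al + v)
      eq′ = solve (b ∷ al ∷ v ∷ [])

  -- Counts edges between the b non-neighbours of w in Γ(y) and the vertices x of Γ₂(y) at distance
  -- 3 from w. The b₂ neighbours of such an f beyond w fall into Γ₂(y) by themselves, and all c
  -- common neighbours of x and y are non-neighbours of w.
  X-size : ∀ {y w} → d y w ≡ 1 → # (at? 2 y ∩? at? 3 w) * c ≡ b * b₂
  X-size {y} {w} h = sym (trans (cong (_* b₂) (sym (nonnbr h))) (double (at? 1 y ∩? at? 2 w) (at? 2 y ∩? at? 3 w) (λ f x → d f x ≟ 1) b₂ c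
    (λ f (p , q) → trans (#-cong _ (at? 1 f ∩? at? 3 w) (λ _ ((_ , t) , u) → u , t) (λ x (u , t) → (geod (sy h) p u t , t) , u)) (far q))
    (λ x (p , q) → trans (#-cong _ (at? 1 x ∩? at? 1 y) (λ _ ((t , _) , u) → sy u , t)
       (λ z (u , t) → (t , geodˡ (sy h) t (sy u) q) , sy u)) (codeg₂ p))))

  -- `ξ` is the quotient b b₂ / c, kept as a number together with its equation.
  module Pair (ξ : ℕ) (hξ : ξ * c ≡ b * b₂) .{{_ : NonZero c}} .{{_ : NonZero b₂}} where

    X-card : ∀ {y w} → d y w ≡ 1 → # (at? 2 y ∩? at? 3 w) ≡ ξ
    X-card h = *-cancelʳ-≡ _ ξ c (trans (X-size h) (sym hξ))

    κ : Fin n → Fin n → Fin n → Fin n → ℕ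
    κ y f f′ w = # ((at? 2 y ∩? at? 1 f ∩? at? 1 f′) ∩? (λ x → at? 3 w x))

    -- f and f′ have b₂ neighbours each among the ξ vertices of Γ₂(y) at distance 3 from w; κ is the
    -- overlap of these two sets.
    κ-≥ : ∀ {y f f′ w} → d y w ≡ 1 → d y f ≡ 1 → d y f′ ≡ 1 → d f w ≡ 2 → d f′ w ≡ 2 → 2 * b₂ ≤ ξ + κ y f f′ w
    κ-≥ {y} {f} {f′} {w} hw h h′ e e′ = begin
      2 * b₂ ≡⟨ cong₂ _+_ (sym (far (sy e))) (trans (+-identityʳ b₂) (sym (far (sy e′)))) ⟩
      # (at? 1 f ∩? at? 3 w) + # (at? 1 f′ ∩? at? 3 w) ≤⟨ #-incl-excl _ _ (at? 2 y ∩? at? 3 w) (inX h) (inX h′) ⟩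
      # (at? 2 y ∩? at? 3 w) + _ ≡⟨ cong₂ _+_ (X-card hw) (#-cong _ _
          (λ x ((p , q) , (p′ , _)) → (proj₁ (inX h x (p , q)) , p , p′) , q) (λ x ((_ , p , p′) , q) → (p , q) , (p′ , q))) ⟩
      ξ + κ y f f′ w ∎
      where
      open ≤-Reasoning
      inX : ∀ {f} → d y f ≡ 1 → ∀ x → d f x ≡ 1 × d w x ≡ 3 → d y x ≡ 2 × d w x ≡ 3
      inX h x (p , q) = geod (sy hw) h p q , q

    κ-≤ : ∀ {y f f′ w} → d f w ≡ 2 → κ y f f′ w ≤ b₂
    κ-≤ {y} {f} {f′} {w} e = ≤-trans (#-mono _ (at? 1 f ∩? at? 3 w) (λ x ((_ , p , _) , q) → p , q)) (≤-reflexive (far (sy e)))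

    -- The w counted by s are exactly the vertices at distance 3 from the x counted by ν.
    κ-sum-row : ∀ {y f f′} → d y f ≡ 1 → d y f′ ≡ 1 → ∀ x → d y x ≡ 2 × d f x ≡ 1 × d f′ x ≡ 1 →
            # ((at? 1 y ∩? at? 2 f ∩? at? 2 f′) ∩? (λ w → at? 3 w x)) ≡ b₂
    κ-sum-row {y} {f} {f′} h h′ x (p , q , q′) = trans (#-cong _ (at? 1 y ∩? at? 3 x) (λ w ((t , _) , u) → t , sy u)
       (λ w (t , u) → (t , sy (geodˡ (sy t) h q (sy u)) , sy (geodˡ (sy t) h′ q′ (sy u))) , sy u)) (far (sy p))

    -- Count pairs x, w at distance 3: every x has exactly b₂ partners w, every w at most b₂
    -- partners x.
    ν≤s : ∀ {y f f′} → d y f ≡ 1 → d y f′ ≡ 1 → ν y f f′ ≤ s y f f′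
    ν≤s {y} {f} {f′} h h′ = *-cancelʳ-≤ _ _ b₂ (double-≤ (at? 2 y ∩? at? 1 f ∩? at? 1 f′) (at? 1 y ∩? at? 2 f ∩? at? 2 f′)
      (λ x w → d w x ≟ 3) b₂ b₂ (λ x p → ≤-reflexive (sym (κ-sum-row h h′ x p)))
      (λ w (_ , e , _) → κ-≤ e))

    -- The same pairs with the lower bound 2b₂ - ξ for every w; substituting ξc = bb₂ and cancelling
    -- b₂ gives s(2c - b) ≤ cν without subtraction. If 2b₂ < ξ the truncated difference is 0, still
    -- a valid lower bound.
    s-bound : ∀ {y f f′} → d y f ≡ 1 → d y f′ ≡ 1 → s y f f′ * (2 * c) ≤ ν y f f′ * c + s y f f′ * b
    s-bound {y} {f} {f′} h h′ = arith (s y f f′) b c (ν y f f′) ξ (2 * b₂ ∸ ξ) b₂ (m≤n+m∸n (2 * b₂) ξ)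
      (double-≤ (at? 1 y ∩? at? 2 f ∩? at? 2 f′) (at? 2 y ∩? at? 1 f ∩? at? 1 f′) (λ w x → d w x ≟ 3) (2 * b₂ ∸ ξ) b₂
        (λ w (p , e , e′) → m≤n+o⇒m∸n≤o (2 * b₂) ξ (κ-≥ p h h′ e e′))
        (λ x p → ≤-reflexive (κ-sum-row h h′ x p))) hξ
      where
      arith : ∀ s b c ν ξ ρ b2 → .{{NonZero b2}} → 2 * b2 ≤ ξ + ρ → s * ρ ≤ ν * b2 → ξ * c ≡ b * b2 → s * (2 * c) ≤ ν * c + s * b
      arith s b c ν ξ ρ b2 h1 h2 h3 = *-cancelʳ-≤ _ _ b2
        (lin {A = (2 * b2) * (s * c) + s * ρ * c + s * (ξ * c)} {B = (ξ + ρ) * (s * c) + ν * b2 * c + s * (b * b2)} 0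
          (+-mono-≤ (+-mono-≤ (*-monoˡ-≤ (s * c) h1) (*-monoˡ-≤ c h2)) (*-monoʳ-≤ s (≤-reflexive h3)))
          (solve (s ∷ b ∷ c ∷ ν ∷ ξ ∷ ρ ∷ b2 ∷ [])))

    -- A vertex x counted by ν brings b₂ vertices counted by s.
    b₂≤s : ∀ {y f f′} → d y f ≡ 1 → d y f′ ≡ 1 → 0 < ν y f f′ → b₂ ≤ s y f f′
    b₂≤s {y} {f} {f′} h h′ pos with #-∃ _ pos
    ... | x , p = ≤-trans (≤-reflexive (sym (κ-sum-row h h′ x p))) (#-mono _ _ (λ _ → proj₁))

-- The case b = c, and graphs without quadrangles

record Setting (n : ℕ) : Set where
  field
    S         : Scheme n
    a         : ℕ
    hk        : Scheme.B S 0 ≡ suc (a + Scheme.B S 1)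
    D         : ℕ
    diam-≤    : ∀ x y → Scheme.d S x y ≤ D
    diam-att  : ∃[ x ] ∃[ y ] Scheme.d S x y ≡ D
    3≤D       : 3 ≤ D
    k₂-small  : ∀ x → 2 * # (Scheme.at? S 2 x) ≤ 3 * Scheme.B S 0

module Small {n : ℕ} (T : Setting n) where

  open Setting T public
  open Local S a hk public

  down : ∀ {x y} i j → d x y ≡ i + j → ∃[ z ] (d x z ≡ i × d z y ≡ j)
  down {x} {y} i zero h = y , trans h (+-identityʳ i) , d-refl y
  down {x} {y} i (suc j) h with d-pred (trans h (+-suc i j))
  ... | u , e , p with down i j p
  ... | z , q , r = z , q , ≤-antisym (≤-trans (d-step e) (s≤s (≤-reflexive r)))
                       (+-cancelˡ-≤ i _ _ (≤-trans (≤-reflexive (sym h)) (tri′ q refl refl)))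

  at-dist : ∀ i → i ≤ D → ∃[ x ] ∃[ y ] d x y ≡ i
  at-dist i p with down i (D ∸ i) (trans (proj₂ (proj₂ diam-att)) (sym (m+[n∸m]≡n p)))
  ... | z , q , _ = proj₁ diam-att , z , q

  D≡3 : (∀ {x y} → ¬ d x y ≡ 4) → D ≡ 3
  D≡3 h with 4 ≤? D
  ... | no p = ≤-antisym (≤-pred (≰⇒> p)) 3≤D
  ... | yes p with at-dist 4 p
  ... | x , y , e = ⊥-elim (h e)

  -- Edges between Γ(x) and Γ₂(x), counted from both sides; this turns the hypothesis on k₂ into
  -- `2b≤3c`.
  level₂ : ∀ x → k * b ≡ # (at? 2 x) * c
  level₂ x = trans (cong (_* b) (sym (val x))) (double (at? 1 x) (at? 2 x) (λ m z → d m z ≟ 1) b c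
      (λ m p → trans (#-cong _ (at? 1 m ∩? at? 2 x) (λ _ (q , r) → r , q) (λ _ (q , r) → r , q)) (B-spec 1 p))
      (λ z p → trans (#-cong _ (at? 1 z ∩? at? 1 x) (λ _ (q , r) → sy r , q) (λ _ (q , r) → r , sy q)) (codeg₂ p)))

  2b≤3c : 2 * b ≤ 3 * c
  2b≤3c = *-cancelʳ-≤ (2 * b) (3 * c) k {{subst NonZero (sym hk) _}} (begin
      2 * b * k ≡⟨ arith₁ b k ⟩
      2 * (k * b) ≡⟨ cong (2 *_) (level₂ x) ⟩
      2 * (# (at? 2 x) * c) ≡⟨ sym (*-assoc 2 (# (at? 2 x)) c) ⟩
      2 * # (at? 2 x) * c ≤⟨ *-monoˡ-≤ c (k₂-small x) ⟩
      3 * k * c ≡⟨ arith₂ k c ⟩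
      3 * c * k ∎)
    where
    open ≤-Reasoning
    x = proj₁ diam-att
    arith₁ : ∀ b k → 2 * b * k ≡ 2 * (k * b)
    arith₁ b k = solve (b ∷ k ∷ [])
    arith₂ : ∀ k c → 3 * k * c ≡ 3 * c * k
    arith₂ k c = solve (k ∷ c ∷ [])

  level₃ : ∀ x → # (at? 2 x) * b₂ ≡ # (at? 3 x) * C 3
  level₃ x = double (at? 2 x) (at? 3 x) (λ m z → d m z ≟ 1) b₂ (C 3)
      (λ m p → trans (#-cong _ (at? 1 m ∩? at? 3 x) (λ _ (q , r) → r , q) (λ _ (q , r) → r , q)) (B-spec 2 p))
      (λ z p → trans (#-cong _ (at? 1 z ∩? at? 2 x) (λ _ (q , r) → sy r , q) (λ _ (q , r) → r , sy q)) (C-spec 2 p))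

  opaque

    -- One triple is fixed for good: the intersection numbers do not depend on the vertices, so
    -- inequalities between them may be read off anywhere.
    geodesic : ∃[ w ] ∃[ y ] ∃[ x ] (d w y ≡ 1 × d y x ≡ 2 × d w x ≡ 3)
    geodesic with at-dist 3 3≤D
    ... | w , x , h with down 1 2 h
    ... | y , p , q = w , y , x , p , q , h

  w₀ y₀ x₀ : Fin n
  w₀ = proj₁ geodesic
  y₀ = proj₁ (proj₂ geodesic)
  x₀ = proj₁ (proj₂ (proj₂ geodesic))

  w₀y₀ : d w₀ y₀ ≡ 1
  w₀y₀ = proj₁ (proj₂ (proj₂ (proj₂ geodesic)))
  y₀x₀ : d y₀ x₀ ≡ 2
  y₀x₀ = proj₁ (proj₂ (proj₂ (proj₂ (proj₂ geodesic))))
  w₀x₀ : d w₀ x₀ ≡ 3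
  w₀x₀ = proj₂ (proj₂ (proj₂ (proj₂ (proj₂ geodesic))))

  0<b₂ : 0 < b₂
  0<b₂ = subst (0 <_) (far (sy y₀x₀)) (#-pos (at? 1 y₀ ∩? at? 3 x₀) w₀ (sy w₀y₀ , sy w₀x₀))

  0<c : 0 < c
  0<c with down 1 1 y₀x₀
  ... | m , p , q = subst (0 <_) (codeg₂ (sy y₀x₀)) (#-pos (at? 1 y₀ ∩? at? 1 x₀) m (p , sy q))

  -- A common neighbour of y and x lies on a geodesic from w to x through y, hence at distance 2
  -- from w.
  M⊂F : ∀ {y w x} → d w y ≡ 1 → d w x ≡ 3 → ∀ m → d y m ≡ 1 × d x m ≡ 1 → d y m ≡ 1 × d w m ≡ 2
  M⊂F h t m (p , q) = p , geodˡ h p (sy q) t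

  c≤b : c ≤ b
  c≤b = subst₂ _≤_ (codeg₂ (sy y₀x₀)) (nonnbr (sy w₀y₀)) (#-mono (at? 1 y₀ ∩? at? 1 x₀) (at? 1 y₀ ∩? at? 2 w₀) (M⊂F w₀y₀ w₀x₀))

  C3≤k : C 3 ≤ k
  C3≤k = subst₂ _≤_ (C-spec 2 w₀x₀) (val x₀) (#-mono (at? 1 x₀ ∩? at? 2 w₀) (at? 1 x₀) (λ _ → proj₁))

  c≤C3 : c ≤ C 3
  c≤C3 = subst₂ _≤_ (codeg₂ y₀x₀) (C-spec 2 w₀x₀)
    (#-mono (at? 1 x₀ ∩? at? 1 y₀) (at? 1 x₀ ∩? at? 2 w₀) (λ z (p , q) → p , geodˡ w₀y₀ q (sy p) w₀x₀))

  c+b₂≤k : c + b₂ ≤ k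
  c+b₂≤k = subst₂ _≤_ (cong₂ _+_ (codeg₂ (sy y₀x₀)) (far (sy y₀x₀))) (val y₀)
    (#-pack (at? 1 y₀ ∩? at? 1 x₀) (at? 1 y₀ ∩? at? 3 x₀) (at? 1 y₀) (λ _ → proj₁) (λ _ → proj₁) (λ _ p q → clash (proj₂ p) (proj₂ q)))

  -- With y in the middle of a geodesic of length 4, the common neighbours of y and one end are at
  -- distance 3 from the other end. Diameter 3 is later deduced by violating this inequality.
  c≤b₂ : ∀ {x y} → d x y ≡ 4 → c ≤ b₂
  c≤b₂ {x} {w} h with down 2 2 h
  ... | y , p , q = subst₂ _≤_ (codeg₂ (sy q)) (far p)
        (#-mono (at? 1 y ∩? at? 1 w) (at? 1 y ∩? at? 3 x) (λ z (r , t) → r , geodˡ p r (sy t) h))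

  0<b : 0 < b
  0<b = ≤-trans 0<c c≤b

  instance
    c-nz : NonZero c
    c-nz = >-nonZero 0<c
    b₂-nz : NonZero b₂
    b₂-nz = >-nonZero 0<b₂

  ξ : ℕ
  ξ = # (at? 2 y₀ ∩? at? 3 w₀)

  hξ : ξ * c ≡ b * b₂
  hξ = X-size (sy w₀y₀)

  open Pair ξ hξ public

  b<2c : b < 2 * c
  b<2c = *-cancelˡ-< 2 b (2 * c) (≤-trans (s≤s 2b≤3c) (arith c 0<c))
    where
    arith : ∀ c → 0 < c → suc (3 * c) ≤ 2 * (2 * c)
    arith c h = lin {A = 1} {B = c} 0 h (solve (c ∷ []))

  -- If ν were 0, then s = b and `s-bound` would give 2c ≤ b. A vertex counted by ν then brings b₂
  -- vertices counted by s.
  0<s,ν : ∀ {y p w} → d y p ≡ 1 → d y w ≡ 1 → d p w ≡ 1 → 0 < s y p w × 0 < ν y p w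
  0<s,ν {y} {p} {w} h h′ e = 0<s , 0<ν
    where
    arith : ∀ b c s v → b < 2 * c → 0 < b → s + v ≡ b → s * (2 * c) ≤ v * c + s * b → 0 < v
    arith b c s (suc v) _ _ _ _ = s≤s z≤n
    arith (suc b) c s zero lt _ e h with trans (sym (+-identityʳ s)) e
    ... | refl = contradiction (*-cancelˡ-≤ {2 * c} {suc b} (suc b) h) (<⇒≱ lt)
    0<ν : 0 < ν y p w
    0<ν = arith b c (s y p w) (ν y p w) b<2c 0<b (sν-adj h h′ e) (s-bound h h′)
    0<s : 0 < s y p w
    0<s = ≤-trans 0<b₂ (b₂≤s h h′ 0<ν)

  local : ∀ {y m z} → d y m ≡ 1 → d y z ≡ 1 → ¬ m ≡ z → d m z ≡ 1 ⊎ d m z ≡ 2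
  local h h′ ne with nb h′ (sy h)
  ... | inj₁ e = ⊥-elim (ne (d-zero e))
  ... | inj₂ e = e

  -- For b = c the inclusion `M⊂F` is an equality. Suppose that two vertices of Γ(y₀) are at
  -- distance 3 from x₀. If they are not adjacent, one is a non-neighbour of the other, hence
  -- adjacent to x₀; if they are adjacent, they share all b non-neighbours and ν = 0.
  b₂≡1 : b ≡ c → b₂ ≡ 1
  b₂≡1 b≡c with 2 ≤? b₂
  ... | no p = ≤-antisym (≤-pred (≰⇒> p)) 0<b₂
  ... | yes p with #-two (at? 1 y₀ ∩? at? 3 x₀) (subst (1 <_) (sym (far (sy y₀x₀))) p) w₀ (sy w₀y₀ , sy w₀x₀)
  ... | w , (h , t) , ne with local h (sy w₀y₀) ne
  ... | inj₂ e = ⊥-elim (clash (proj₂ (#-full (at? 1 y₀ ∩? at? 1 x₀) (at? 1 y₀ ∩? at? 2 w₀) (M⊂F w₀y₀ w₀x₀)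
                   (≤-reflexive (trans (nonnbr (sy w₀y₀)) (trans b≡c (sym (codeg₂ (sy y₀x₀)))))) w (h , sy e))) t)
  ... | inj₁ e = contradiction (proj₂ (0<s,ν h (sy w₀y₀) e)) (≤⇒≯ (≤-reflexive ν≡0))
    where
    b≤s : b ≤ s y₀ w w₀
    b≤s = subst (_≤ s y₀ w w₀) (trans (codeg₂ (sy y₀x₀)) (sym b≡c))
            (#-mono (at? 1 y₀ ∩? at? 1 x₀) (at? 1 y₀ ∩? at? 2 w ∩? at? 2 w₀)
              (λ m p → proj₁ p , proj₂ (M⊂F (sy h) (sy t) m p) , proj₂ (M⊂F w₀y₀ w₀x₀ m p)))
    ν≡0 : ν y₀ w w₀ ≡ 0
    ν≡0 = arith (s y₀ w w₀) (ν y₀ w w₀) b≤s (sν-adj h (sy w₀y₀) e)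
      where
      arith : ∀ s v {b} → b ≤ s → s + v ≡ b → v ≡ 0
      arith s v p refl = n≤0⇒n≡0 (+-cancelˡ-≤ s v 0 (≤-trans p (≤-reflexive (sym (+-identityʳ s)))))

  C1≡1 : C 1 ≡ 1
  C1≡1 = trans (sym (C-spec 0 w₀y₀)) (trans (#-cong (at? 1 y₀ ∩? at? 0 w₀) (λ z → z F.≟ w₀)
           (λ z (_ , q) → sym (d-zero q)) (λ { z refl → sy w₀y₀ , d-refl _ })) (#-sing w₀))

  -- With b₂ = ξ = 1 one gets a₃ ≤ 1. If a₃ = 1, an edge inside Γ₃(w) bounds 2c₃ by k, and k ≤ c₃ +
  -- 1 then leaves k ≤ 2.
  taylor : b ≡ c → 2 ≤ c → D ≡ 3 × C 3 ≡ k
  taylor b≡c 2≤c = D=3 , ≤-antisym C3≤k k≤C3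
    where
    e₁ = b₂≡1 b≡c
    D=3 : D ≡ 3
    D=3 = D≡3 (λ h → contradiction (≤-trans (c≤b₂ h) (≤-reflexive e₁)) (<⇒≱ 2≤c))
    ξ≡1 : ξ ≡ 1
    ξ≡1 = *-cancelʳ-≡ ξ 1 c (trans hξ (trans (cong (b *_) e₁) (trans (*-identityʳ b) (trans b≡c (sym (*-identityˡ c))))))
    3≤k : 3 ≤ k
    3≤k = ≤-trans (s≤s (≤-trans 2≤c (≤-trans (≤-reflexive (sym b≡c)) (m≤n+m b a)))) (≤-reflexive (sym hk))
    w = w₀
    x = x₀
    v = # (at? 1 x ∩? at? 3 w)
    k≡ : k ≤ C 3 + v
    k≡ = subst₂ _≤_ (val x) (cong (_+ v) (C-spec 2 w₀x₀)) (#-cover (at? 1 x ∩? at? 2 w) (at? 1 x ∩? at? 3 w) (at? 1 x) cov)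
      where
      cov : ∀ z → d x z ≡ 1 → _
      cov z p with nb p w₀x₀
      ... | inj₁ q = inj₁ (p , q)
      ... | inj₂ (inj₁ q) = inj₂ (p , q)
      ... | inj₂ (inj₂ q) = contradiction (diam-≤ w z) (<⇒≱ (≤-reflexive (trans (cong suc D=3) (sym q))))
    -- Since ξ = 1, x is the only vertex of Γ₂(y) at distance 3 from w, which pushes x′ to distance
    -- 3 from y.
    sep : ∀ {y x x′} → d w y ≡ 1 → d y x ≡ 2 → d w x ≡ 3 → d w x′ ≡ 3 → d x x′ ≡ 1 → d y x′ ≡ 3
    sep {y} h p t t′ e with nb e p
    ... | inj₁ q = ⊥-elim (no-tri h q t′)
    ... | inj₂ (inj₂ q) = q
    ... | inj₂ (inj₁ q) = ⊥-elim (d≢ e (#-unique (at? 2 y ∩? at? 3 w) (≤-reflexive (trans (X-card (sy h)) ξ≡1)) (p , t) (q , t′)))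
    v≤1 : v ≤ 1
    v≤1 = subst (v ≤_) (trans (far y₀x₀) e₁)
            (#-mono (at? 1 x ∩? at? 3 w) (at? 1 x ∩? at? 3 y₀) (λ z (p , q) → p , sep w₀y₀ y₀x₀ w₀x₀ q p))
    k≤C3 : k ≤ C 3
    k≤C3 with v ≟ 0
    ... | yes e = ≤-trans k≡ (≤-reflexive (trans (cong (C 3 +_) e) (+-identityʳ _)))
    ... | no ne with #-∃ (at? 1 x ∩? at? 3 w) (n≢0⇒n>0 ne)
    ... | x′ , p , q = contradiction (arith k (C 3) (≤-trans k≡ (+-monoʳ-≤ (C 3) v≤1)) disj) (<⇒≱ 3≤k)
      where
      -- By `sep`, a neighbour of w at distance 2 from x has distance 3 from x′, so the two c₃-sets
      -- are disjoint.
      disj : C 3 + C 3 ≤ k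
      disj = subst₂ _≤_ (cong₂ _+_ (C-spec 2 (sy w₀x₀)) (C-spec 2 (sy q))) (val w)
        (#-pack (at? 1 w ∩? at? 2 x) (at? 1 w ∩? at? 2 x′) (at? 1 w) (λ _ → proj₁) (λ _ → proj₁)
          (λ z (r , t) (_ , t′) → clash (sy t′) (sep r (sy t) w₀x₀ q p)))
      arith : ∀ k C → k ≤ C + 1 → C + C ≤ k → k ≤ 2
      arith k C p q = lin {A = 2 * k + (C + C)} {B = 2 * (C + 1) + k} 0 (+-mono-≤ (*-monoʳ-≤ 2 p) q) (solve (k ∷ C ∷ []))

  -- 2b ≤ 3 gives b = 1, and then s + ν + a + 2 = b + c = 2 for any non-adjacent pair of Γ(y₀)
  -- leaves no room for a; thus k = 2.
  a≡0-if-c≡1 : c ≡ 1 → b ≡ 1 × a ≡ 0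
  a≡0-if-c≡1 c≡1 = b≡1 , a≡0
    where
    arith : ∀ b c → 2 * b ≤ 3 * c → 0 < b → c ≡ 1 → b ≡ 1
    arith (suc zero) _ _ _ _ = refl
    arith (suc (suc m)) _ h _ refl = contradiction (≤-trans (≤-reflexive eq) h) (<⇒≱ (m≤m+n 4 (2 * m)))
      where
      eq : 4 + 2 * m ≡ 2 * suc (suc m)
      eq = solve (m ∷ [])
    b≡1 : b ≡ 1
    b≡1 = arith b c 2b≤3c 0<b c≡1
    a≡0 : a ≡ 0
    a≡0 with #-∃ (at? 1 y₀ ∩? at? 2 w₀) (subst (0 <_) (sym (nonnbr (sy w₀y₀))) 0<b)
    ... | f , p , q = arith₂ (s y₀ w₀ f + ν y₀ w₀ f) a b c (sν-nonadj (sy w₀y₀) p q) b≡1 c≡1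
      where
      arith₂ : ∀ t a b c → t + (a + 2) ≡ b + c → b ≡ 1 → c ≡ 1 → a ≡ 0
      arith₂ t a _ _ h refl refl = m+n≡0⇒n≡0 t (+-cancelʳ-≡ 2 (t + a) 0 (trans (+-assoc t a 2) h))

  -- Exclusion of a + 2 = b + c when c < b

  module NoQuadrangle (σ≡0 : a + 2 ≡ b + c) (c<b : c < b) where

    sν≡0 : ∀ {y m m′} → d y m ≡ 1 → d y m′ ≡ 1 → d m m′ ≡ 2 → s y m m′ + ν y m m′ ≡ 0
    sν≡0 {y} {m} {m′} h h′ e = +-cancelʳ-≡ (a + 2) (s y m m′ + ν y m m′) 0 (trans (sν-nonadj h h′ e) (sym σ≡0))

    no-triangle : ∀ {y m m′ z} → d y m ≡ 1 → d y m′ ≡ 1 → d y z ≡ 1 → d m m′ ≡ 2 → d m z ≡ 2 → d m′ z ≡ 2 → ⊥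
    no-triangle {y} {m} {m′} {z} h h′ h″ e p q =
      <⇒≱ (≤-trans (#-pos (at? 1 y ∩? at? 2 m ∩? at? 2 m′) z (h″ , p , q)) (m≤m+n _ _)) (≤-reflexive (sν≡0 h h′ e))

    no-quad : ∀ {y m m′ x} → d y m ≡ 1 → d y m′ ≡ 1 → d y x ≡ 2 → d m m′ ≡ 2 → d m x ≡ 1 → d m′ x ≡ 1 → ⊥
    no-quad {y} {m} {m′} {x} h h′ h″ e p q =
      <⇒≱ (≤-trans (#-pos (at? 2 y ∩? at? 1 m ∩? at? 1 m′) x (h″ , p , q)) (m≤n+m _ _)) (≤-reflexive (sν≡0 h h′ e))

    y w : Fin n
    y = y₀
    w = w₀
    yw : d y w ≡ 1
    yw = sy w₀y₀

    A F : Fin n → Set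
    A p = d y p ≡ 1 × d w p ≡ 1
    F f = d y f ≡ 1 × d w f ≡ 2

    A≢F : ∀ {p f} → A p → F f → ¬ p ≡ f
    A≢F (_ , q) (_ , r) refl = clash q r

    -- With `alt₂`: of two non-adjacent p, r in A exactly one is adjacent to a given f in F. Neither
    -- would make a non-adjacent triple in Γ(y); both would make f a common neighbour of p and r in
    -- Γ₂(w).
    alt₁ : ∀ {p r f} → A p → A r → d p r ≡ 2 → F f → d p f ≡ 2 → d r f ≡ 1
    alt₁ (h , u) (h′ , u′) e (g , t) q with local h′ g (A≢F (h′ , u′) (g , t))
    ... | inj₁ z = z
    ... | inj₂ z = ⊥-elim (no-triangle h h′ g e q z)

    alt₂ : ∀ {p r f} → A p → A r → d p r ≡ 2 → F f → d p f ≡ 1 → d r f ≡ 2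
    alt₂ (h , u) (h′ , u′) e (g , t) q with local h′ g (A≢F (h′ , u′) (g , t))
    ... | inj₂ z = z
    ... | inj₁ z = ⊥-elim (no-quad u u′ t e q z)

    N? : ∀ p → Pred? (λ z → d p z ≡ 2 × A z)
    N? p = at? 2 p ∩? at? 1 y ∩? at? 1 w

    Ns? : ∀ p → Pred? (λ z → d y z ≡ 1 × d p z ≡ 2 × d w z ≡ 2)
    Ns? p = at? 1 y ∩? at? 2 p ∩? at? 2 w

    N+s : ∀ {p} → A p → # (N? p) + s y p w ≡ b
    N+s {p} (h , u) = trans (sym (#-split (N? p) (Ns? p) (at? 1 y ∩? at? 2 p) cov
       (λ _ (q , r , _) → r , q) (λ _ (q , r , _) → q , r) (λ _ q r → clash (proj₂ (proj₂ q)) (proj₂ (proj₂ r))))) (nonnbr h)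
      where
      cov : ∀ z → d y z ≡ 1 × d p z ≡ 2 → _
      cov z (q , r) with local yw q (λ { refl → clash (sy u) r })
      ... | inj₁ t = inj₁ (r , q , t)
      ... | inj₂ t = inj₂ (q , r , t)

    -- Both ν and the number of non-neighbours of p in A complete s to b, so they are equal, and ν
    -- is positive.
    N-pos : ∀ {p} → A p → ∃[ r ] (d p r ≡ 2 × A r)
    N-pos {p} (h , u) = #-∃ (N? p) (subst (0 <_) (arith (ν y p w) (# (N? p)) (s y p w) (sν-adj h yw (sy u)) (N+s (h , u))) (proj₂ (0<s,ν h yw (sy
        u))))
      where
      arith : ∀ v N s {b} → s + v ≡ b → N + s ≡ b → v ≡ N
      arith v N s p q = +-cancelˡ-≡ s v N (trans p (trans (sym q) (+-comm N s)))

    -- Non-adjacent p, r ∈ Γ(y) ∩ Γ(w): the common non-neighbours with w partition those of w.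
    N+N : ∀ {p r} → A p → A r → d p r ≡ 2 → # (N? p) + # (N? r) ≡ b
    N+N {p} {r} ap ar e = arith b (# (N? p)) (# (N? r)) (s y p w) (s y r w) (N+s ap) (N+s ar)
        (trans (sym (#-split (Ns? p) (Ns? r) (at? 1 y ∩? at? 2 w) cov (λ _ (q , _ , t) → q , t) (λ _ (q , _ , t) → q , t)
          (λ f (q , t , u) (_ , t′ , _) → no-triangle (proj₁ ap) (proj₁ ar) q e t t′))) (nonnbr yw))
      where
      cov : ∀ f → F f → _
      cov f (q , t) with local (proj₁ ap) q (A≢F ap (q , t))
      ... | inj₂ z = inj₁ (q , z , t)
      ... | inj₁ z = inj₂ (q , alt₂ ap ar e (q , t) z , t)
      arith : ∀ b N N′ s s′ → N + s ≡ b → N′ + s′ ≡ b → s + s′ ≡ b → N + N′ ≡ b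
      arith b N N′ s s′ p q r = +-cancelʳ-≡ b (N + N′) b (trans (cong (N + N′ +_) (sym r)) (trans (+-interchange N N′ s s′) (cong₂ _+_ p q)))

    U? : ∀ p r → Pred? (λ z → (d p z ≡ 2 × A z) ⊎ (d r z ≡ 2 × A z))
    U? p r z = N? p z ⊎-dec N? r z

    U-size : ∀ {p r} → A p → A r → d p r ≡ 2 → # (U? p r) ≡ b
    U-size {p} {r} ap ar e = trans (#-split (N? p) (N? r) (U? p r) (λ _ q → q) (λ _ → inj₁) (λ _ → inj₂)
      (λ z (q , t) (q′ , _) → no-triangle (proj₁ ap) (proj₁ ar) (proj₁ t) e q q′)) (N+N ap ar e)

    -- The two unions have b elements each inside the a-set A, and a + 2 = b + c < 2b.
    meet : ∀ {p r p′ r′} → A p → A r → d p r ≡ 2 → A p′ → A r′ → d p′ r′ ≡ 2 →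
           ∃[ t ] (((d p t ≡ 2 × A t) ⊎ (d r t ≡ 2 × A t)) × ((d p′ t ≡ 2 × A t) ⊎ (d r′ t ≡ 2 × A t)))
    meet {p} {r} {p′} {r′} ap ar e ap′ ar′ e′ = #-∃ (U? p r ∩? U? p′ r′)
        (arith a b c (# (U? p r ∩? U? p′ r′)) σ≡0 c<b (subst₂ _≤_ (cong₂ _+_ (U-size ap ar e) (U-size ap′ ar′ e′)) (cong (_+ # (U? p r ∩? U? p′
            r′)) (codeg₁ (sy yw)))
          (#-incl-excl (U? p r) (U? p′ r′) (at? 1 y ∩? at? 1 w) (λ _ → [ proj₂ , proj₂ ]′) (λ _ → [ proj₂ , proj₂ ]′))))
      where
      arith : ∀ a b c i → a + 2 ≡ b + c → c < b → b + b ≤ a + i → 0 < i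
      arith a b c i p q r = lin {A = (b + b) + suc c + (a + 2)} {B = (a + i) + b + (b + c)} 2 (+-mono-≤ (+-mono-≤ r q) (≤-reflexive p))
         (solve (a ∷ b ∷ c ∷ i ∷ []))

    -- Every step to a non-adjacent vertex of A exchanges adjacency and non-adjacency to each vertex
    -- of F. The vertex t from `meet` is one or two such steps away from p and from p′. If the total
    -- is odd, adjacency to f is contradicted; if it is even, p′ behaves towards f′ as p does.
    spread : ∀ {p r f f′ p′} → A p → A r → d p r ≡ 2 → F f → F f′ → d p f ≡ 2 → d p f′ ≡ 1 → A p′ → d p′ f ≡ 2 → d p′ f′ ≡ 1
    spread {p} {r} {f} {f′} {p′} ap ar e F₁ F₂ q q′ ap′ q″ = go (proj₁ nb′) (proj₁ (proj₂ nb′)) (proj₂ (proj₂ nb′))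
      where
      nb′ = N-pos ap′
      go : ∀ r′ → d p′ r′ ≡ 2 → A r′ → d p′ f′ ≡ 1
      go r′ e′ ar′ = at-meet (proj₁ common) (proj₁ (proj₂ common)) (proj₂ (proj₂ common))
        where
        common = meet ap ar e ap′ ar′ e′
        at-meet : ∀ t → (d p t ≡ 2 × A t) ⊎ (d r t ≡ 2 × A t) → (d p′ t ≡ 2 × A t) ⊎ (d r′ t ≡ 2 × A t) → d p′ f′ ≡ 1
        at-meet t (inj₁ (u , a′)) (inj₁ (u′ , _)) = alt₁ a′ ap′ (sy u′) F₂ (alt₂ ap a′ u F₂ q′)
        at-meet t (inj₁ (u , a′)) (inj₂ (u′ , _)) = ⊥-elim (clash (alt₁ ap a′ u F₁ q) (alt₂ ar′ a′ u′ F₁ (alt₁ ap′ ar′ e′ F₁ q″)))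
        at-meet t (inj₂ (u , a′)) (inj₁ (u′ , _)) = ⊥-elim (clash (alt₁ ap′ a′ u′ F₁ q″) (alt₂ ar a′ u F₁ (alt₁ ap ar e F₁ q)))
        at-meet t (inj₂ (u , a′)) (inj₂ (u′ , _)) =
          alt₁ ar′ ap′ (sy e′) F₂ (alt₂ a′ ar′ (sy u′) F₂ (alt₁ ar a′ u F₂ (alt₂ ap ar e F₂ q′)))

    -- F is a clique, so the b non-neighbours of f in Γ(y) are w and elements of A. The latter are
    -- common neighbours of w and f′, of which there are α = a + 1 - b = c - 1, as s = 0.
    b≤c′ : ∀ {f f′} → F f → F f′ → (∀ p → A p → d p f ≡ 2 → d p f′ ≡ 1) → b ≤ c
    b≤c′ {f} {f′} (h , t) (h′ , t′) sub = arith (s y w f′) a b c (α y w f′) (# G?) σ≡0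
        (s-nonadj yw h′ t′) (m+n≡0⇒m≡0 (s y w f′) (sν≡0 yw h′ t′)) size
        (#-mono G? (at? 1 y ∩? at? 1 w ∩? at? 1 f′) (λ z (p , q , r) → p , q , sy (sub z (p , q) (sy r))))
      where
      G? = at? 1 y ∩? at? 1 w ∩? at? 2 f
      size : b ≤ suc (# G?)
      size = subst₂ _≤_ (nonnbr h) (cong (_+ # G?) (#-sing w)) (#-cover (λ z → z F.≟ w) G? (at? 1 y ∩? at? 2 f) cov)
        where
        cov : ∀ z → d y z ≡ 1 × d f z ≡ 2 → _
        cov z (p , q) with z F.≟ w
        ... | yes e = inj₁ e
        ... | no ne with local yw p (λ e → ne (sym e))
        ... | inj₁ r = inj₂ (p , r , q)
        ... | inj₂ r = ⊥-elim (no-triangle yw h p t r q)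
      arith : ∀ s a b c al g → a + 2 ≡ b + c → suc (s + a) ≡ b + al → s ≡ 0 → b ≤ suc g → g ≤ al → b ≤ c
      arith s a b c al g p q refl r t = lin {A = b + g + (b + al) + (a + 2)} {B = suc g + al + suc a + (b + c)} 0
         (+-mono-≤ (+-mono-≤ (+-mono-≤ r t) (≤-reflexive (sym q))) (≤-reflexive p)) (solve (a ∷ b ∷ c ∷ al ∷ g ∷ []))

    -- f is taken non-adjacent to p, and f′ non-adjacent to r and hence adjacent to p; from this one
    -- p `spread` derives the hypothesis of `b≤c′` for all of A.
    absurd : ⊥
    absurd = go (proj₁ inA) (proj₂ inA)
      where
      arith : ∀ a b c → a + 2 ≡ b + c → c < b → 0 < c → 0 < a
      arith a b c p q r = lin {A = suc c + 2 * 1 + (b + c)} {B = b + 2 * c + (a + 2)} 0 (+-mono-≤ (+-mono-≤ q (*-monoʳ-≤ 2 r)) (≤-reflexive (sym p)))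
         (solve (a ∷ b ∷ c ∷ []))
      inA = #-∃ (at? 1 y ∩? at? 1 w) (subst (0 <_) (sym (codeg₁ (sy yw))) (arith a b c σ≡0 c<b 0<c))
      go : ∀ p → A p → ⊥
      go p ap = <⇒≱ c<b (b≤c′ (proj₁ Ff , proj₂ (proj₂ Ff)) (proj₁ Ff′ , proj₂ (proj₂ Ff′))
                  (λ z az → spread ap ar e (proj₁ Ff , proj₂ (proj₂ Ff)) (proj₁ Ff′ , proj₂ (proj₂ Ff′)) (proj₁ (proj₂ Ff))
                              (alt₁ ar ap (sy e) (proj₁ Ff′ , proj₂ (proj₂ Ff′)) (proj₁ (proj₂ Ff′))) az))
        where
        r = proj₁ (N-pos ap)
        e = proj₁ (proj₂ (N-pos ap))
        ar = proj₂ (proj₂ (N-pos ap))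
        Ff = proj₂ (#-∃ (Ns? p) (proj₁ (0<s,ν (proj₁ ap) yw (sy (proj₂ ap)))))
        Ff′ = proj₂ (#-∃ (Ns? r) (proj₁ (0<s,ν (proj₁ ar) yw (sy (proj₂ ar)))))

-- Triangle-free graphs

module TriangleFree {n : ℕ} (T : Setting n) (a≡0 : Setting.a T ≡ 0) (c<b : Local.c (Setting.S T) (Setting.a T) (Setting.hk T) < Local.b (Setting.S
    T) (Setting.a T) (Setting.hk T)) where

  open Small T

  Bip : Set
  Bip = ∀ {o x y} → d o x ≡ d o y → d x y ≡ 1 → ⊥

  Flat : ℕ → Set
  Flat i = ∀ {o x y} → d o x ≡ i → d o y ≡ i → d x y ≡ 1 → ⊥

  k≡ : k ≡ suc b
  k≡ = trans hk (cong (λ t → suc (t + b)) a≡0)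

  flat₁ : Flat 1
  flat₁ {o} {x} {y} p q e = contradiction (subst (0 <_) (trans (codeg₁ e) a≡0) (#-pos (at? 1 y ∩? at? 1 x) o (sy q , sy p))) λ ()

  meet : ∀ {y} {P Q : Fin n → Set} (P? : Pred? P) (Q? : Pred? Q) → (∀ z → P z → d y z ≡ 1) → (∀ z → Q z → d y z ≡ 1) →
         k < # P? + # Q? → ∃[ z ] (P z × Q z)
  meet {y} P? Q? f g h = #-∃ (P? ∩? Q?) (+-cancelˡ-< k 0 (# (P? ∩? Q?)) (≤-trans (subst (_< # P? + # Q?) (sym (+-identityʳ k)) h)
    (subst (λ t → # P? + # Q? ≤ t + # (P? ∩? Q?)) (val y) (#-incl-excl P? Q? (at? 1 y) f g))))

  -- The neighbours of o at distance 2 from x and those at distance 2 from y are c₃-subsets of Γ(o).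
  -- A common element z would see the edge x, y inside Γ₂(z).
  flat₃-from : Flat 2 → k < C 3 + C 3 → Flat 3
  flat₃-from flat₂ lt {o} {x} {y} p q e = go (meet (at? 1 o ∩? at? 2 x) (at? 1 o ∩? at? 2 y) (λ _ → proj₁) (λ _ → proj₁)
      (subst₂ (λ s t → k < s + t) (sym (C-spec 2 (sy p))) (sym (C-spec 2 (sy q))) lt))
    where
    go : ∃[ z ] ((d o z ≡ 1 × d x z ≡ 2) × (d o z ≡ 1 × d y z ≡ 2)) → ⊥
    go (z , (_ , r) , (_ , t)) = flat₂ (sy r) (sy t) e

  bip-from : D ≡ 3 → Flat 2 → Flat 3 → Bip
  bip-from D≡3 flat₂ flat₃ {o} {x} {y} p e with d o x in q
  ... | 0 = d≢ e (trans (sym (d-zero q)) (d-zero (sym p)))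
  ... | 1 = flat₁ q (sym p) e
  ... | 2 = flat₂ q (sym p) e
  ... | 3 = flat₃ q (sym p) e
  ... | suc (suc (suc (suc _))) = contradiction (diam-≤ o x) (<⇒≱ (≤-trans (s≤s (≤-reflexive D≡3)) (≤-trans (s≤s (s≤s (s≤s (s≤s z≤n))))
      (≤-reflexive (sym q)))))

  -- 2c ≥ 4b/3 > b + 1 = k as soon as b > 3. Two c-subsets of Γ(o) then meet, which would close a
  -- triangle over an edge inside Γ₂(o); and distance 4 would give 2c ≤ c + b₂ ≤ k.
  bipartite : 4 ≤ b → D ≡ 3 × Bip
  bipartite 4≤b = D=3 , bip-from D=3 flat₂ (flat₃-from flat₂ (≤-trans k<2c (+-mono-≤ c≤C3 c≤C3)))
    where
    arith : ∀ b c → 4 ≤ b → 2 * b ≤ 3 * c → suc b < c + c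
    arith b c p q = *-cancelˡ-< 3 (suc b) (c + c) (lin {A = 4 + 2 * (2 * b)} {B = b + 2 * (3 * c)} 0 (+-mono-≤ p (*-monoʳ-≤ 2 q)) (solve (b ∷ c ∷
        [])))
    k<2c : k < c + c
    k<2c = subst (_< c + c) (sym k≡) (arith b c 4≤b 2b≤3c)
    flat₂ : Flat 2
    flat₂ {o} {x} {y} p q e = go (meet (at? 1 o ∩? at? 1 x) (at? 1 o ∩? at? 1 y) (λ _ → proj₁) (λ _ → proj₁)
        (subst₂ (λ s t → k < s + t) (sym (codeg₂ (sy p))) (sym (codeg₂ (sy q))) k<2c))
      where
      go : ∃[ z ] ((d o z ≡ 1 × d x z ≡ 1) × (d o z ≡ 1 × d y z ≡ 1)) → ⊥
      go (z , (_ , r) , (_ , t)) = flat₁ (sy r) (sy t) e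
    D=3 : D ≡ 3
    D=3 = D≡3 λ h → <⇒≱ k<2c (≤-trans (+-monoʳ-≤ c (c≤b₂ h)) c+b₂≤k)

  record CubeArray : Set where
    field
      b≡3 : b ≡ 3
      c≡2 : c ≡ 2
      b₂≡2 : b₂ ≡ 2
      C3≡3 : C 3 ≡ 3
      4≤D  : 4 ≤ D
      flat₂ : Flat 2
      flat₃ : Flat 3

  module _ (b≤3 : b ≤ 3) where

    b≡3,c≡2 : b ≡ 3 × c ≡ 2
    b≡3,c≡2 = arith b c b≤3 c<b 0<c 2b≤3c
      where
      arith : ∀ b c → b ≤ 3 → c < b → 0 < c → 2 * b ≤ 3 * c → b ≡ 3 × c ≡ 2
      arith 3 2 _ _ _ _ = refl , refl
      arith 2 1 _ _ _ (s≤s (s≤s (s≤s ())))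
      arith 3 1 _ _ _ (s≤s (s≤s (s≤s ())))
      arith 1 (suc _) _ (s≤s ()) _ _
      arith 2 (suc (suc _)) _ (s≤s (s≤s ())) _ _
      arith 3 (suc (suc (suc _))) _ (s≤s (s≤s (s≤s ()))) _ _
      arith (suc (suc (suc (suc _)))) _ (s≤s (s≤s (s≤s ()))) _ _ _

    b≡3 = proj₁ b≡3,c≡2
    c≡2 = proj₂ b≡3,c≡2

    k≡4 : k ≡ 4
    k≡4 = trans k≡ (cong suc b≡3)

    -- 2ξ = 3b₂ makes b₂ even, and c + b₂ ≤ k bounds it by 2.
    b₂≡2 : b₂ ≡ 2
    b₂≡2 = arith ξ b₂ (subst₂ (λ s t → ξ * s ≡ t * b₂) c≡2 b≡3 hξ) 0<b₂ (subst₂ (λ s t → s + b₂ ≤ t) c≡2 k≡4 c+b₂≤k)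
      where
      arith : ∀ x b₂ → x * 2 ≡ 3 * b₂ → 0 < b₂ → 2 + b₂ ≤ 4 → b₂ ≡ 2
      arith x 2 _ _ _ = refl
      arith 1 1 () _ _
      arith (suc (suc x)) 1 () _ _
      arith x (suc (suc (suc _))) _ _ (s≤s (s≤s (s≤s (s≤s ()))))

    -- A vertex of Γ₂(o) has c = 2 neighbours in Γ(o) and b₂ = 2 in Γ₃(o), which exhausts its
    -- valency 4.
    flat₂ : Flat 2
    flat₂ {o} {x} {y} p q e = contradiction (≤-trans (≤-reflexive (cong₂ _+_ (sym three) (sym (#-sing y)))) five) (<⇒≱ (≤-reflexive (cong suc k≡4)))
      where
      P? = at? 1 x ∩? at? 1 o
      Q? = at? 1 x ∩? at? 3 o
      PQ? : Pred? _
      PQ? z = P? z ⊎-dec Q? z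
      three : # PQ? ≡ 4
      three = trans (#-split P? Q? PQ? (λ _ t → t) (λ _ → inj₁) (λ _ → inj₂) (λ _ r t → clash (proj₂ r) (proj₂ t)))
                (cong₂ _+_ (trans (codeg₂ p) c≡2) (trans (far p) b₂≡2))
      five : # PQ? + # (λ z → z F.≟ y) ≤ k
      five = subst (# PQ? + # (λ z → z F.≟ y) ≤_) (val x) (#-pack PQ? (λ z → z F.≟ y) (at? 1 x) (λ _ → [ proj₁ , proj₁ ]′) (λ { _ refl → e })
               (λ { _ (inj₁ (_ , r)) refl → clash r q ; _ (inj₂ (_ , r)) refl → clash q r }))

    C3≢2 : ¬ C 3 ≡ 2
    C3≢2 h = go (proj₁ x₁) (proj₂ x₁) (proj₁ m₁) (proj₂ m₁)
      where
      w = w₀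
      x = x₀
      X? = at? 1 x ∩? at? 2 w
      M? = at? 1 w ∩? at? 2 x
      X2 : # X? ≡ 2
      X2 = trans (C-spec 2 w₀x₀) h
      M2 : # M? ≡ 2
      M2 = trans (C-spec 2 (sy w₀x₀)) h
      x₁ = #-∃ X? (subst (0 <_) (sym X2) (s≤s z≤n))
      m₁ = #-∃ M? (subst (0 <_) (sym M2) (s≤s z≤n))
      -- Each of the two vertices of X? is adjacent to both vertices of M?, which contradicts ν = 1.
      full : ∀ x′ → d x x′ ≡ 1 × d w x′ ≡ 2 → ∀ m → d w m ≡ 1 × d x m ≡ 2 → d m x′ ≡ 1
      full x′ (p , q) m r = sy (proj₂ (#-full (at? 1 w ∩? at? 1 x′) M? (λ z (t , u) → t , sy (geod t (sy u) (sy p) w₀x₀))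
         (≤-reflexive (trans M2 (sym (trans (codeg₂ (sy q)) c≡2)))) m r))
      arith : ∀ s v al a → suc (s + a) ≡ 3 + al → s + v + (a + 2) ≡ 5 → a ≡ 0 → v ≤ 1
      arith s v al _ p q refl = lin {A = s + v + (0 + 2) + (3 + al)} {B = 5 + suc (s + 0)} al
         (≤-reflexive (cong₂ _+_ q (sym p))) (solve (s ∷ v ∷ al ∷ []))
      go : ∀ x₁ → d x x₁ ≡ 1 × d w x₁ ≡ 2 → ∀ m₁ → d w m₁ ≡ 1 × d x m₁ ≡ 2 → ⊥
      go x₁ p m₁ q = go′ (proj₁ x₂) (proj₁ (proj₂ x₂)) (proj₂ (proj₂ x₂)) (proj₁ m₂) (proj₁ (proj₂ m₂)) (proj₂ (proj₂ m₂))
        where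
        x₂ = #-two X? (subst (1 <_) (sym X2) ≤-refl) x₁ p
        m₂ = #-two M? (subst (1 <_) (sym M2) ≤-refl) m₁ q
        go′ : ∀ x₂ → d x x₂ ≡ 1 × d w x₂ ≡ 2 → ¬ x₂ ≡ x₁ → ∀ m₂ → d w m₂ ≡ 1 × d x m₂ ≡ 2 → ¬ m₂ ≡ m₁ → ⊥
        go′ x₂ p₂ ne m₂ q₂ ne′ = ne (#-unique (at? 2 w ∩? at? 1 m₁ ∩? at? 1 m₂) ν≤1
              (proj₂ p₂ , full x₂ p₂ m₁ q , full x₂ p₂ m₂ q₂) (proj₂ p , full x₁ p m₁ q , full x₁ p m₂ q₂))
          where
          m₁m₂ : d m₁ m₂ ≡ 2
          m₁m₂ = [ (λ e → ⊥-elim (flat₁ (proj₁ q) (proj₁ q₂) e)) , (λ e → e) ]′ (local (proj₁ q) (proj₁ q₂) (λ e → ne′ (sym e)))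
          ν≤1 : ν w m₁ m₂ ≤ 1
          ν≤1 = arith (s w m₁ m₂) (ν w m₁ m₂) (α w m₁ m₂) a
             (trans (s-nonadj (proj₁ q) (proj₁ q₂) m₁m₂) (cong (_+ α w m₁ m₂) b≡3))
             (trans (sν-nonadj (proj₁ q) (proj₁ q₂) m₁m₂) (cong₂ _+_ b≡3 c≡2)) a≡0

    C3∈3,4 : C 3 ≡ 3 ⊎ C 3 ≡ 4
    C3∈3,4 = arith (C 3) (subst (_≤ C 3) c≡2 c≤C3) (subst (C 3 ≤_) k≡4 C3≤k) C3≢2
      where
      arith : ∀ x → 2 ≤ x → x ≤ 4 → ¬ x ≡ 2 → x ≡ 3 ⊎ x ≡ 4
      arith 2 _ _ h = ⊥-elim (h refl)
      arith 3 _ _ _ = inj₁ refl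
      arith 4 _ _ _ = inj₂ refl
      arith 1 (s≤s ()) _ _
      arith (suc (suc (suc (suc (suc _))))) _ (s≤s (s≤s (s≤s (s≤s ())))) _

    -- If c₃ = 4 = k, nothing lies beyond Γ₃ and the graph is bipartite. If c₃ = 3, the fourth
    -- neighbour of a vertex of Γ₃ cannot lie in Γ₃, so the diameter exceeds 3.
    small : (D ≡ 3 × Bip) ⊎ CubeArray
    small = [ cube , bip ]′ C3∈3,4
      where
      bip : C 3 ≡ 4 → (D ≡ 3 × Bip) ⊎ CubeArray
      bip e = inj₁ (D=3 , bip-from D=3 flat₂ (flat₃-from flat₂ (subst₂ (λ s t → s < t + t) (sym k≡4) (sym e) (s≤s (s≤s (s≤s (s≤s (s≤s z≤n))))))))
        where
        D=3 : D ≡ 3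
        D=3 = D≡3 λ {o} {z} h → go o z h (d-pred h)
          where
          go : ∀ o z → d o z ≡ 4 → ∃[ p ] (d p z ≡ 1 × d o p ≡ 3) → ⊥
          go o z h (p , q , r) = clash (proj₂ (#-full (at? 1 p ∩? at? 2 o) (at? 1 p) (λ _ → proj₁)
              (≤-reflexive (trans (val p) (trans k≡4 (sym (trans (C-spec 2 r) e))))) z q)) h
      cube : C 3 ≡ 3 → (D ≡ 3 × Bip) ⊎ CubeArray
      cube e = inj₂ (record { b≡3 = b≡3 ; c≡2 = c≡2 ; b₂≡2 = b₂≡2 ; C3≡3 = e ; 4≤D = 4≤D ; flat₂ = flat₂ ; flat₃ = flat₃ })
        where
        flat₃ : Flat 3
        flat₃ = flat₃-from flat₂ (subst₂ (λ s t → s < t + t) (sym k≡4) (sym e) (s≤s (s≤s (s≤s (s≤s (s≤s z≤n))))))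
        4≤D : 4 ≤ D
        4≤D with 4 ≤? D
        ... | yes p = p
        ... | no p = contradiction (subst₂ _≤_ (trans (val x₀) k≡4) (trans (C-spec 2 w₀x₀) e) (#-mono (at? 1 x₀) (at? 1 x₀ ∩? at? 2 w₀) two))
                        λ { (s≤s (s≤s (s≤s ()))) }
          where
          two : ∀ z → d x₀ z ≡ 1 → d x₀ z ≡ 1 × d w₀ z ≡ 2
          two z q with nb q w₀x₀
          ... | inj₁ r = q , r
          ... | inj₂ (inj₁ r) = ⊥-elim (flat₃ w₀x₀ r q)
          ... | inj₂ (inj₂ r) = contradiction (≤-trans (≤-reflexive (sym r)) (diam-≤ w₀ z)) p

  triangle-free : (D ≡ 3 × Bip) ⊎ CubeArray
  triangle-free with 4 ≤? b
  ... | yes p = inj₁ (bipartite p)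
  ... | no p  = small (≤-pred (≰⇒> p))

-- Graphs with triangles

-- With b = c + e and 3c = 2b + f, that is c = 2e + f, the last hypothesis reads s(3e + 2f) ≤ (3e + f)(2e + f).
half-bound : ∀ {b c} s v → c ≤ b → 2 * b ≤ 3 * c → 0 < c → s + v ≡ b → s * (2 * c) ≤ v * c + s * b → 2 * s + c ≤ 2 * b
half-bound {b} {c} s v c≤b 2b≤3c 0<c sv h with m≤n⇒∃[o]m+o≡n c≤b
... | e , refl with m≤n⇒∃[o]m+o≡n (+-cancelˡ-≤ (2 * c) (2 * e) c (≤-trans (≤-reflexive (eq₀ c e)) (≤-trans 2b≤3c (≤-reflexive (eq₁ c)))))
  where
  eq₀ : ∀ c e → 2 * c + 2 * e ≡ 2 * (c + e)
  eq₀ c e = solve (c ∷ e ∷ [])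
  eq₁ : ∀ c → 3 * c ≡ 2 * c + c
  eq₁ c = solve (c ∷ [])
... | f , refl = ≮⇒≥ λ lt → <⇒≱ 0<c (zero-sum e f (contra e f s v sv h lt))
  where
  contra : ∀ e f s v → s + v ≡ 2 * e + f + e → s * (2 * (2 * e + f)) ≤ v * (2 * e + f) + s * (2 * e + f + e) →
           2 * (2 * e + f + e) < 2 * s + (2 * e + f) → 3 * e + 2 * f ≤ 0
  -- Since 2b - c = 4e + f, the claim amounts to 2(3e + f)(2e + f) ≤ (4e + f)(3e + 2f); the slack
  -- `e * f` is the difference of the two sides.
  contra e f s v p q r = lin {A = (2 * e + f) * 2 * (s + v) + 2 * (s * (2 * (2 * e + f))) + (3 * e + 2 * f) * suc (2 * (2 * e + f + e))}
      {B = (2 * e + f) * 2 * (2 * e + f + e) + 2 * (v * (2 * e + f) + s * (2 * e + f + e)) + (3 * e + 2 * f) * (2 * s + (2 * e + f))} (e * f)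
      (+-mono-≤ (+-mono-≤ (≤-reflexive (cong ((2 * e + f) * 2 *_) p)) (*-monoʳ-≤ 2 q)) (*-monoʳ-≤ (3 * e + 2 * f) r))
      (solve (e ∷ f ∷ s ∷ v ∷ []))
  zero-sum : ∀ e f → 3 * e + 2 * f ≤ 0 → 2 * e + f ≤ 0
  zero-sum e f h = ≤-trans (+-mono-≤ (*-monoˡ-≤ e {2} {3} (s≤s (s≤s z≤n))) (m≤m+n f (f + 0))) h

module Dense {n : ℕ} (T : Setting n) (1≤a : 1 ≤ Setting.a T) (c<b : Local.c (Setting.S T) (Setting.a T) (Setting.hk T) < Local.b (Setting.S T)
    (Setting.a T) (Setting.hk T)) where

  open Small T

  σ-pos : a + 2 < b + c
  σ-pos = ≤∧≢⇒< (proj₂ nonadj-sum) (λ e → NoQuadrangle.absurd e c<b)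
    where
    nonadj-sum : 0 < b × a + 2 ≤ b + c
    nonadj-sum = go (#-∃ (at? 1 y₀ ∩? at? 2 w₀) (subst (0 <_) (sym (nonnbr (sy w₀y₀))) 0<b))
      where
      go : ∃[ f ] (d y₀ f ≡ 1 × d w₀ f ≡ 2) → 0 < b × a + 2 ≤ b + c
      go (f , p , q) = 0<b , subst (a + 2 ≤_) (sν-nonadj (sy w₀y₀) p q) (m≤n+m (a + 2) (s y₀ w₀ f + ν y₀ w₀ f))

  0<ν′ : ∀ {y p w} → d y p ≡ 1 → d y w ≡ 1 → d p w ≡ 2 → 0 < ν y p w
  0<ν′ {y} {p} {w} h h′ e = arith b c (s y p w) (ν y p w) (a + 2) b<2c (sν-nonadj h h′ e) σ-pos (s-bound h h′)
    where
    arith : ∀ b c s v a → b < 2 * c → s + v + a ≡ b + c → a < b + c → s * (2 * c) ≤ v * c + s * b → 0 < v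
    arith b c s (suc v) a _ _ _ _ = s≤s z≤n
    arith b c zero zero a _ e lt _ = contradiction lt (<⇒≱ (s≤s (≤-reflexive (sym e))))
    arith b c (suc s) zero a lt _ _ h = contradiction (*-cancelˡ-≤ {2 * c} {b} (suc s) h) (<⇒≱ lt)

  half-adj : ∀ {y p w} → d y p ≡ 1 → d y w ≡ 1 → d p w ≡ 1 → 2 * s y p w + c ≤ 2 * b
  half-adj {y} {p} {w} h h′ e = half-bound (s y p w) (ν y p w) c≤b 2b≤3c 0<c (sν-adj h h′ e) (s-bound h h′)

  -- For an adjacent pair s = b + 1 + α - a, and 2s + c ≤ 2b turns into c + 2 + 2α ≤ 2a.
  c+2≤2a : c + 2 ≤ 2 * a
  c+2≤2a = go (#-∃ (at? 1 y₀ ∩? at? 1 w₀) (subst (0 <_) (sym (codeg₁ w₀y₀)) 1≤a))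
    where
    arith : ∀ s a b c al → s + a ≡ suc (b + al) → 2 * s + c ≤ 2 * b → c + 2 ≤ 2 * a
    arith s a b c al p q = lin {A = 2 * suc (b + al) + (2 * s + c)} {B = 2 * (s + a) + 2 * b} (2 * al)
      (+-mono-≤ (≤-reflexive (cong (2 *_) (sym p))) q) (solve (s ∷ a ∷ b ∷ c ∷ al ∷ []))
    go : ∃[ p ] (d y₀ p ≡ 1 × d w₀ p ≡ 1) → c + 2 ≤ 2 * a
    go (p , h , e) = arith (s y₀ w₀ p) a b c (α y₀ w₀ p) (s-adj (sy w₀y₀) h e) (half-adj (sy w₀y₀) h e)

  -- With b₂ = 1 the number b would be a multiple of c strictly between c and 2c.
  2≤b₂ : 2 ≤ b₂
  2≤b₂ = arith ξ b c b₂ hξ 0<b₂ c<b b<2c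
    where
    arith : ∀ x b c b₂ → x * c ≡ b * b₂ → 0 < b₂ → c < b → b < 2 * c → 2 ≤ b₂
    arith x b c (suc (suc _)) _ _ _ _ = s≤s (s≤s z≤n)
    arith 0 b c 1 e _ p q = contradiction (≤-trans (s≤s z≤n) p) (<⇒≱ (s≤s (≤-reflexive (trans (sym (*-identityʳ b)) (sym e)))))
    arith 1 b c 1 e _ p q = contradiction p (<⇒≱ (s≤s (≤-reflexive (trans (sym (*-identityʳ b)) (trans (sym e) (+-identityʳ c))))))
    arith (suc (suc x)) b c 1 e _ p q = contradiction q (<⇒≱ (s≤s (≤-trans (*-monoˡ-≤ c {2} {2 + x} (s≤s (s≤s z≤n))) (≤-reflexive (trans e
        (*-identityʳ b))))))

  module _ {y x} (yx : d y x ≡ 2) where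

    W : Fin n → Set
    W w = d y w ≡ 1 × d x w ≡ 3

    M⊂F′ : ∀ {w} → W w → ∀ m → d y m ≡ 1 × d x m ≡ 1 → d w m ≡ 2
    M⊂F′ (p , q) m h = proj₂ (M⊂F (sy p) (sy q) m h)

    c≤s : ∀ {w w′} → W w → W w′ → c ≤ s y w w′
    c≤s {w} {w′} h h′ = subst (_≤ s y w w′) (codeg₂ (sy yx)) (#-mono (at? 1 y ∩? at? 1 x) (at? 1 y ∩? at? 2 w ∩? at? 2 w′)
      (λ m p → proj₁ p , M⊂F′ h m p , M⊂F′ h′ m p))

    -- c ≤ s and 2s + c ≤ 2b ≤ 3c close up to equalities.
    adj⇒half : ∀ {w w′} → W w → W w′ → d w w′ ≡ 1 → 2 * b ≡ 3 * c × s y w w′ ≡ c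
    adj⇒half {w} {w′} h h′ e = ≤-antisym 2b≤3c (arith₁ (s y w w′) b c (c≤s h h′) hb) , ≤-antisym (arith₂ (s y w w′) b c 2b≤3c hb) (c≤s h h′)
      where
      hb = half-adj (proj₁ h) (proj₁ h′) e
      arith₁ : ∀ s b c → c ≤ s → 2 * s + c ≤ 2 * b → 3 * c ≤ 2 * b
      arith₁ s b c p q = lin {A = 2 * c + (2 * s + c)} {B = 2 * s + 2 * b} 0 (+-mono-≤ (*-monoʳ-≤ 2 p) q) (solve (s ∷ b ∷ c ∷ []))
      arith₂ : ∀ s b c → 2 * b ≤ 3 * c → 2 * s + c ≤ 2 * b → s ≤ c
      arith₂ s b c p q = *-cancelˡ-≤ {s} {c} 2 (lin {A = 2 * b + (2 * s + c)} {B = 3 * c + 2 * b} 0 (+-mono-≤ p q) (solve (s ∷ b ∷ c ∷ [])))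

    -- The c common neighbours of x and y are among the s = c common non-neighbours of w and w′,
    -- hence are all of them.
    common⊂M : ∀ {w w′} → W w → W w′ → d w w′ ≡ 1 → ∀ z → d y z ≡ 1 → d w z ≡ 2 → d w′ z ≡ 2 → d x z ≡ 1
    common⊂M {w} {w′} h h′ e z p q r = proj₂ (#-full (at? 1 y ∩? at? 1 x) (at? 1 y ∩? at? 2 w ∩? at? 2 w′)
      (λ m p → proj₁ p , M⊂F′ h m p , M⊂F′ h′ m p)
      (≤-reflexive (trans (proj₂ (adj⇒half h h′ e)) (sym (codeg₂ (sy yx))))) z (p , q , r))

    -- From s ≥ c and `s-bound` follows ν ≥ 2c - b, so b + c - a - 2 = s + ν ≥ 3c - b.
    nonadj⇒a-small : ∀ {w w′} → W w → W w′ → d w w′ ≡ 2 → a + 2 + 2 * c ≤ 2 * b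
    nonadj⇒a-small {w} {w′} h h′ e = arith (s y w w′) (ν y w w′) a b c (c≤s h h′) b<2c 0<c (sν-nonadj (proj₁ h) (proj₁ h′) e) (s-bound (proj₁ h)
        (proj₁ h′))
      where
      arith : ∀ s v a b c → c ≤ s → b < 2 * c → 0 < c → s + v + (a + 2) ≡ b + c → s * (2 * c) ≤ v * c + s * b → a + 2 + 2 * c ≤ 2 * b
      arith s v a b (suc c′) p lt _ e h with m≤n⇒∃[o]m+o≡n p | m≤n⇒∃[o]m+o≡n lt
      ... | t , refl | r , e′ = *-cancelˡ-≤ (suc c′) (core t v a b (suc c′) r e′ e h)
        where
        core : ∀ t v a b c r → suc b + r ≡ 2 * c → c + t + v + (a + 2) ≡ b + c → (c + t) * (2 * c) ≤ v * c + (c + t) * b →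
               c * (a + 2 + 2 * c) ≤ c * (2 * b)
        core t v a b c r p q h = lin {A = c * (c + t + v + (a + 2)) + (c + t) * (2 * c) + t * (suc b + r)} {B = c * (b + c) + (v * c + (c + t) * b)
            + t * (2 * c)}
          (t * c + t * (suc r)) (+-mono-≤ (+-mono-≤ (≤-reflexive (cong (c *_) q)) h) (≤-reflexive (cong (t *_) p)))
          (solve (t ∷ v ∷ a ∷ b ∷ c ∷ r ∷ []))

    W-two : ∀ {w} → W w → ∃[ w′ ] (W w′ × ¬ w′ ≡ w)
    W-two {w} = #-two (at? 1 y ∩? at? 3 x) (subst (2 ≤_) (sym (far (sy yx))) 2≤b₂) w

    Deg? : ∀ w → Pred? (λ z → d w z ≡ 2 × W z)
    Deg? w = at? 2 w ∩? at? 1 y ∩? at? 3 x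

    c+deg≤b : ∀ {w} → W w → c + # (Deg? w) ≤ b
    c+deg≤b {w} h = subst₂ _≤_ (cong (_+ # (Deg? w)) (codeg₂ (sy yx))) (nonnbr (proj₁ h))
      (#-pack (at? 1 y ∩? at? 1 x) (Deg? w) (at? 1 y ∩? at? 2 w) (λ m p → proj₁ p , M⊂F′ h m p) (λ z (p , q , _) → q , p)
         (λ z p q → clash (proj₂ p) (proj₂ (proj₂ q))))

    -- The non-neighbours of w inside W are pairwise non-adjacent.
    deg-bound : 2 * b ≡ 3 * c → a + 2 ≤ c → ∀ {w} → W w → 3 * # (Deg? w) + 2 * a + 1 ≤ 2 * c
    deg-bound hf a+2≤c {w} h with # (Deg? w) ≟ 0
    ... | yes e = subst (λ t → 3 * t + 2 * a + 1 ≤ 2 * c) (sym e) (arith a c a+2≤c)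
      where
      arith : ∀ a c → a + 2 ≤ c → 3 * 0 + 2 * a + 1 ≤ 2 * c
      arith a c p = lin {A = 2 * (a + 2)} {B = 2 * c} 3 (*-monoʳ-≤ 2 p) (solve (a ∷ c ∷ []))
    ... | no ne = go (#-∃ (Deg? w) (n≢0⇒n>0 ne))
      where
      go : ∃[ z ] (d w z ≡ 2 × W z) → 3 * # (Deg? w) + 2 * a + 1 ≤ 2 * c
      go (w″ , e , h″) = arith (s y w w″) (ν y w w″) (# (Deg? w)) a b c hf 0<c size (sν-nonadj (proj₁ h) (proj₁ h″) e) (s-bound (proj₁ h) (proj₁ h″))
        where
        rest? = λ z → Deg? w z ×-dec ¬? (z F.≟ w″)
        others : ∀ z → (d w z ≡ 2 × W z) × ¬ z ≡ w″ → d y z ≡ 1 × d w z ≡ 2 × d w″ z ≡ 2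
        others z ((p , q) , ne) with local (proj₁ h″) (proj₁ q) (λ t → ne (sym t))
        ... | inj₂ r = proj₁ q , p , r
        -- Otherwise w would be a common non-neighbour of the adjacent pair w″, z, hence adjacent to
        -- x.
        ... | inj₁ r = ⊥-elim (clash (common⊂M h″ q r w (proj₁ h) (sy e) (sy p)) (proj₂ h))
        size : c + # (Deg? w) ≤ suc (s y w w″)
        size = subst₂ _≤_ (trans (sym (+-suc c (# rest?))) (cong (c +_) (sym (#-remove (Deg? w) w″ (e , h″))))) refl
                 (s≤s (subst (λ t → t + # rest? ≤ s y w w″) (codeg₂ (sy yx))
                   (#-pack (at? 1 y ∩? at? 1 x) rest? (at? 1 y ∩? at? 2 w ∩? at? 2 w″) (λ m p → proj₁ p , M⊂F′ h m p , M⊂F′ h″ m p)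
                     others (λ z p q → clash (proj₂ p) (proj₂ (proj₂ (proj₁ q)))))))
        arith : ∀ s v g a b c → 2 * b ≡ 3 * c → 0 < c → c + g ≤ suc s → s + v + (a + 2) ≡ b + c → s * (2 * c) ≤ v * c + s * b →
            3 * g + 2 * a + 1 ≤ 2 * c
        arith s v g a b c@(suc _) hf _ p e h = fin s g a c p (*-cancelˡ-≤ c (core s v a b c hf e h))
          where
          fin : ∀ s g a c → c + g ≤ suc s → 3 * s + 2 * a + 4 ≤ 5 * c → 3 * g + 2 * a + 1 ≤ 2 * c
          fin s g a c p q = lin {A = 3 * (c + g) + (3 * s + 2 * a + 4)} {B = 3 * suc s + 5 * c} 0 (+-mono-≤ (*-monoʳ-≤ 3 p) q) (solve (s ∷ g ∷ a ∷
              c ∷ []))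
          core : ∀ s v a b c → 2 * b ≡ 3 * c → s + v + (a + 2) ≡ b + c → s * (2 * c) ≤ v * c + s * b → c * (3 * s + 2 * a + 4) ≤ c * (5 * c)
          core s v a b c hf e h = lin {A = 2 * (s * (2 * c)) + c * 2 * (s + v + (a + 2)) + (s + c) * (2 * b)}
             {B = 2 * (v * c + s * b) + c * 2 * (b + c) + (s + c) * (3 * c)} 0
             (+-mono-≤ (+-mono-≤ (*-monoʳ-≤ 2 h) (≤-reflexive (cong (c * 2 *_) e))) (≤-reflexive (cong ((s + c) *_) hf)))
             (solve (s ∷ v ∷ a ∷ b ∷ c ∷ []))

    module _ {w w′} (Ww : W w) (Ww′ : W w′) (ne : ¬ w′ ≡ w) where

      -- Below equality no two vertices of W are adjacent, so b₂ - 1 vertices of W and the c common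
      -- neighbours of x and y are non-neighbours of w: b₂ ≤ b - c + 1.
      loose-at : 2 * b < 3 * c → a + 2 ≤ c × 3 * b₂ ≤ 2 * c
      loose-at lt = arith₁ a b c lt (nonadj⇒a-small Ww Ww′ (anti Ww′ ne)) , arith₂ b b₂ c (# (Deg? w)) lt c<b W⊂Deg (c+deg≤b Ww)
        where
        anti : ∀ {z} → W z → ¬ z ≡ w → d w z ≡ 2
        anti h ne with local (proj₁ Ww) (proj₁ h) (λ e → ne (sym e))
        ... | inj₂ e = e
        ... | inj₁ e = contradiction (proj₁ (adj⇒half Ww h e)) (<⇒≢ lt)
        W⊂Deg : b₂ ≤ 1 + # (Deg? w)
        W⊂Deg = subst₂ _≤_ (far (sy yx)) (cong (_+ # (Deg? w)) (#-sing w)) (#-cover (λ z → z F.≟ w) (Deg? w) (at? 1 y ∩? at? 3 x) cov)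
          where
          cov : ∀ z → W z → _
          cov z h with z F.≟ w
          ... | yes e = inj₁ e
          ... | no q  = inj₂ (anti h q , h)
        arith₁ : ∀ a b c → 2 * b < 3 * c → a + 2 + 2 * c ≤ 2 * b → a + 2 ≤ c
        arith₁ a b c p q = lin {A = suc (2 * b) + (a + 2 + 2 * c)} {B = 3 * c + 2 * b} 1 (+-mono-≤ p q) (solve (a ∷ b ∷ c ∷ []))
        arith₂ : ∀ b b₂ c g → 2 * b < 3 * c → c < b → b₂ ≤ 1 + g → c + g ≤ b → 3 * b₂ ≤ 2 * c
        arith₂ b b₂ c g p q r t = *-cancelˡ-≤ {3 * b₂} {2 * c} 2 (lin {A = 6 * b₂ + 6 * (c + g) + 4 * suc (2 * b) + 2 * suc c} {B = 6 * (1 + g) + 6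
            * b + 4 * (3 * c) + 2 * b} 0
           (+-mono-≤ (+-mono-≤ (+-mono-≤ (*-monoʳ-≤ 6 r) (*-monoʳ-≤ 6 t)) (*-monoʳ-≤ 4 p)) (*-monoʳ-≤ 2 q)) (solve (b ∷ b₂ ∷ c ∷ g ∷ [])))

      -- If w has no neighbour in W, `deg-bound` alone bounds b₂. Otherwise take a neighbour v in W:
      -- each vertex of W is w, v, one of their α = c + a - 1 - b common neighbours, or a
      -- non-neighbour of w or of v.
      tight-at : 2 * b ≡ 3 * c → a + 2 ≤ c → 3 * b₂ ≤ 2 * c
      tight-at hf a+2≤c with # (at? 1 w ∩? at? 1 y ∩? at? 3 x) ≟ 0
      ... | yes e = arith₁ a c b₂ (# (Deg? w)) 1≤a (subst₂ _≤_ (far (sy yx)) (cong (_+ # (Deg? w)) (#-sing w)) (#-cover (λ z →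
          z F.≟ w) (Deg? w) (at? 1 y ∩? at? 3 x) cov)) (deg-bound hf a+2≤c Ww)
        where
        arith₁ : ∀ a c b₂ g → 1 ≤ a → b₂ ≤ 1 + g → 3 * g + 2 * a + 1 ≤ 2 * c → 3 * b₂ ≤ 2 * c
        arith₁ a c b₂ g p q r = lin {A = 2 * 1 + 3 * b₂ + (3 * g + 2 * a + 1)} {B = 2 * a + 3 * (1 + g) + 2 * c} 0 (+-mono-≤ (+-mono-≤ (*-monoʳ-≤ 2
            p) (*-monoʳ-≤ 3 q)) r)
           (solve (a ∷ c ∷ b₂ ∷ g ∷ []))
        cov : ∀ z → W z → _
        cov z h with z F.≟ w
        ... | yes e′ = inj₁ e′
        ... | no q with local (proj₁ Ww) (proj₁ h) (λ e′ → q (sym e′))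
        ... | inj₂ r = inj₂ (r , h)
        ... | inj₁ r = contradiction (#-pos (at? 1 w ∩? at? 1 y ∩? at? 3 x) z (r , h)) (≤⇒≯ (≤-reflexive e))
      ... | no nz = go (#-∃ (at? 1 w ∩? at? 1 y ∩? at? 3 x) (n≢0⇒n>0 nz))
        where
        go : ∃[ z ] (d w z ≡ 1 × W z) → 3 * b₂ ≤ 2 * c
        go (v , e , Wv) = arith₂ a b c b₂ (α y w v) (# (Deg? w)) (# (Deg? v)) hf c+2≤2a
            (trans (cong (_+ a) (sym (proj₂ (adj⇒half Ww Wv e)))) (s-adj (proj₁ Ww) (proj₁ Wv) e)) size (deg-bound hf a+2≤c Ww) (deg-bound hf a+2≤c
                Wv)
          where
          A? = at? 1 y ∩? at? 1 w ∩? at? 1 v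
          r₁ : Pred? _
          r₁ z = Deg? w z ⊎-dec Deg? v z
          r₂ : Pred? _
          r₂ z = A? z ⊎-dec r₁ z
          r₃ : Pred? _
          r₃ z = (z F.≟ v) ⊎-dec r₂ z
          cov : ∀ z → W z → _
          cov z h with z F.≟ w
          ... | yes e′ = inj₁ e′
          ... | no q with z F.≟ v
          ... | yes e′ = inj₂ (inj₁ e′)
          ... | no q′ with local (proj₁ Ww) (proj₁ h) (λ t → q (sym t)) | local (proj₁ Wv) (proj₁ h) (λ t → q′ (sym t))
          ... | inj₂ t | _ = inj₂ (inj₂ (inj₂ (inj₁ (t , h))))
          ... | inj₁ t | inj₂ u = inj₂ (inj₂ (inj₂ (inj₂ (u , h))))
          ... | inj₁ t | inj₁ u = inj₂ (inj₂ (inj₁ (proj₁ h , t , u)))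
          size : b₂ ≤ 1 + (1 + (α y w v + (# (Deg? w) + # (Deg? v))))
          size = ≤-trans (≤-reflexive (sym (far (sy yx)))) (≤-trans (#-cover (λ z → z F.≟ w) r₃ (at? 1 y ∩? at? 3 x) cov)
            (+-mono-≤ (≤-reflexive (#-sing w)) (≤-trans (#-cover (λ z → z F.≟ v) r₂ r₃ (λ _ t → t))
              (+-mono-≤ (≤-reflexive (#-sing v)) (≤-trans (#-cover A? r₁ r₂ (λ _ t → t))
                (+-monoʳ-≤ (α y w v) (#-cover (Deg? w) (Deg? v) r₁ (λ _ t → t))))))))
          arith₂ : ∀ a b c b₂ al g g′ → 2 * b ≡ 3 * c → c + 2 ≤ 2 * a → c + a ≡ suc (b + al) → b₂ ≤ 1 + (1 + (al + (g + g′))) →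
                   3 * g + 2 * a + 1 ≤ 2 * c → 3 * g′ + 2 * a + 1 ≤ 2 * c → 3 * b₂ ≤ 2 * c
          arith₂ a b c b₂ al g g′ p q r t u u′ = *-cancelˡ-≤ {3 * b₂} {2 * c} 2 (lin
             {A = 6 * b₂ + 2 * (3 * g + 2 * a + 1) + 2 * (3 * g′ + 2 * a + 1) + 6 * suc (b + al) + 3 * (3 * c) + (c + 2)}
             {B = 6 * (1 + (1 + (al + (g + g′)))) + 2 * (2 * c) + 2 * (2 * c) + 6 * (c + a) + 3 * (2 * b) + 2 * a} 0
             (+-mono-≤ (+-mono-≤ (+-mono-≤ (+-mono-≤ (+-mono-≤ (*-monoʳ-≤ 6 t) (*-monoʳ-≤ 2 u)) (*-monoʳ-≤ 2 u′)) (≤-reflexive (cong (6 *_) (sym r))))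
                (≤-reflexive (cong (3 *_) (sym p)))) q)
             (solve (a ∷ b ∷ c ∷ b₂ ∷ al ∷ g ∷ g′ ∷ [])))

    W-pair : ∃[ w ] ∃[ w′ ] (W w × W w′ × ¬ w′ ≡ w)
    W-pair = go (#-∃ (at? 1 y ∩? at? 3 x) (subst (0 <_) (sym (far (sy yx))) 0<b₂))
      where
      go : ∃[ w ] W w → ∃[ w ] ∃[ w′ ] (W w × W w′ × ¬ w′ ≡ w)
      go (w , h) = w , proj₁ (W-two h) , h , proj₁ (proj₂ (W-two h)) , proj₂ (proj₂ (W-two h))

    loose : 2 * b < 3 * c → a + 2 ≤ c × 3 * b₂ ≤ 2 * c
    loose = go W-pair
      where
      go : ∃[ w ] ∃[ w′ ] (W w × W w′ × ¬ w′ ≡ w) → 2 * b < 3 * c → a + 2 ≤ c × 3 * b₂ ≤ 2 * c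
      go (w , w′ , h , h′ , ne) = loose-at h h′ ne

    tight : 2 * b ≡ 3 * c → a + 2 ≤ c → 3 * b₂ ≤ 2 * c
    tight = go W-pair
      where
      go : ∃[ w ] ∃[ w′ ] (W w × W w′ × ¬ w′ ≡ w) → 2 * b ≡ 3 * c → a + 2 ≤ c → 3 * b₂ ≤ 2 * c
      go (w , w′ , h , h′ , ne) = tight-at h h′ ne

    W-clique : 2 * b ≡ 3 * c → c ≤ a + 1 → ∀ {w w′} → W w → W w′ → ¬ w ≡ w′ → d w w′ ≡ 1
    W-clique hf c≤a+1 h h′ ne with local (proj₁ h) (proj₁ h′) ne
    ... | inj₁ e = e
    ... | inj₂ e = contradiction (nonadj⇒a-small h h′ e) (<⇒≱ (arith a b c hf c≤a+1))
      where
      arith : ∀ a b c → 2 * b ≡ 3 * c → c ≤ a + 1 → 2 * b < a + 2 + 2 * c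
      arith a b c p q = lin {A = c + 2 * b} {B = a + 1 + 3 * c} 0 (+-mono-≤ q (≤-reflexive p)) (solve (a ∷ b ∷ c ∷ []))

-- Polynomial inequalities for the sparse case

amgm : ∀ x y → 2 * (x * y) ≤ x * x + y * y
amgm x y with ≤-total x y
... | inj₁ p with m≤n⇒∃[o]m+o≡n p
... | o , refl = lin {A = 0} {B = o * o} 0 z≤n (solve (x ∷ o ∷ []))
amgm x y | inj₂ p with m≤n⇒∃[o]m+o≡n p
... | o , refl = lin {A = 0} {B = o * o} 0 z≤n (solve (y ∷ o ∷ []))

-- (y - x)(q - p) ≥ 0, multiplied out; it moves b₂ to an end of its range.
rearrange : ∀ {x y p q} → x ≤ y → p ≤ q → x * q + y * p ≤ y * q + x * p
rearrange {x} {p = p} h h′ with m≤n⇒∃[o]m+o≡n h | m≤n⇒∃[o]m+o≡n h′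
... | o , refl | o′ , refl = lin {A = 0} {B = o * o′} 0 z≤n (solve (x ∷ p ∷ o ∷ o′ ∷ []))

-- Eliminates p and k₂: after multiplication by u = c₃, the term pcu equals ck₃u - c(1 + v)u, where
-- ck₃u = ck₂b₂ = kbb₂.
walk-inequality : ∀ u v p κ k₂ a b c b₂ → u * b₂ + v * v ≤ (u + v) + v * a + p * c → 1 + v + p ≡ κ → k₂ * b₂ ≡ κ * u → (u + v) * b ≡ k₂ * c →
  u * u * b₂ + u * v * v + c * u + c * u * v ≤ (u + v) * u + u * v * a + (u + v) * b * b₂
walk-inequality u v p _ k₂ a b c b₂ h refl e e′ = lin
  {A = u * (u * b₂ + v * v) + c * ((1 + v + p) * u) + k₂ * c * b₂} {B = u * ((u + v) + v * a + p * c) + c * (k₂ * b₂) + (u + v) * b * b₂} 0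
  (+-mono-≤ (+-mono-≤ (*-monoʳ-≤ u h) (≤-reflexive (cong (c *_) (sym e)))) (≤-reflexive (cong (_* b₂) (sym e′))))
  (solve (u ∷ v ∷ p ∷ k₂ ∷ a ∷ b ∷ c ∷ b₂ ∷ []))

-- Linear in b₂, so it is refuted at both ends of 2 ≤ b₂ ≤ 2c/3, by sums of squares.
sparse-impossible : ∀ {a c b₂ u} b v → a + 2 ≤ c → c + 2 ≤ 2 * a → 2 ≤ b₂ → 3 * b₂ ≤ 2 * c → c ≤ u → 2 * b ≤ 3 * c → u + v ≡ suc (a + b) →
  u * u * b₂ + u * v * v + c * u + c * u * v ≤ (u + v) * u + u * v * a + (u + v) * b * b₂ → ⊥
sparse-impossible {a} b v a+2≤c c+2≤2a 2≤b₂ 3b₂≤2c c≤u 2b≤3c e H with m≤n⇒∃[o]m+o≡n a+2≤c | m≤n⇒∃[o]m+o≡n 2≤b₂ | m≤n⇒∃[o]m+o≡n c≤u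
... | m , refl | r , refl | t , refl with m≤n⇒∃[o]m+o≡n (4+m≤a a m c+2≤2a)
  where
  4+m≤a : ∀ a m → a + 2 + m + 2 ≤ 2 * a → 4 + m ≤ a
  4+m≤a a m p = lin {A = a + 2 + m + 2} {B = 2 * a} 0 p (solve (a ∷ m ∷ []))
-- Here a = 4 + m + g, c = a + 2 + m, u = c + t, b₂ = 2 + r. With b = u + v - 1 - a, the coefficient
-- of b₂ on the left minus that on the right is (a + 1)(u + v) - 2uv - v²; its sign decides which
-- end of the range is the critical one.
... | g , refl with ≤-total (2 * ((4 + m + g + 2 + m + t) * v) + v * v) ((5 + m + g) * (4 + m + g + 2 + m + t + v))
... | inj₁ T = contradiction (core m g t v b r (rearrange (z≤n {r}) T) 2b≤3c e H) λ ()
  where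
  core : ∀ m g t v b r → let c = 4 + m + g + 2 + m ; u = c + t ; a = 4 + m + g in
    0 * ((5 + m + g) * (u + v)) + r * (2 * (u * v) + v * v) ≤ r * ((5 + m + g) * (u + v)) + 0 * (2 * (u * v) + v * v) →
    2 * b ≤ 3 * c → u + v ≡ suc (a + b) →
    u * u * (2 + r) + u * v * v + c * u + c * u * v ≤ (u + v) * u + u * v * a + (u + v) * b * (2 + r) → 6 ≤ 0
  core m g t v b r T q e H = lin
    {A = 2 * ((4 + m + g + 2 + m + t) * (4 + m + g + 2 + m + t) * (2 + r) + (4 + m + g + 2 + m + t) * v * v + (4 + m + g + 2 + m) * (4 + m + g + 2
        + m + t) + (4 + m + g + 2 + m) * (4 + m + g + 2 + m + t) * v)
       + 2 * (0 * ((5 + m + g) * (4 + m + g + 2 + m + t + v)) + r * (2 * ((4 + m + g + 2 + m + t) * v) + v * v))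
       + (4 + m + g + 2 + m + t) * (2 * b) + (2 * m + g + t) * 2 * (2 * (v * 1)) + 2 * (2 * (2 * v * 3))
       + 2 * (4 + m + g + 2 + m + t) * (4 + m + g + 2 + m + t + v) + 2 * (4 + m + g + 2 + m + t + v) * (2 + r) * suc (4 + m + g + b)}
    {B = 2 * ((4 + m + g + 2 + m + t + v) * (4 + m + g + 2 + m + t) + (4 + m + g + 2 + m + t) * v * (4 + m + g) + (4 + m + g + 2 + m + t + v) * b *
        (2 + r))
       + 2 * (r * ((5 + m + g) * (4 + m + g + 2 + m + t + v)) + 0 * (2 * ((4 + m + g + 2 + m + t) * v) + v * v))
       + (4 + m + g + 2 + m + t) * (3 * (4 + m + g + 2 + m)) + (2 * m + g + t) * 2 * (v * v + 1 * 1) + 2 * (2 * v * (2 * v) + 3 * 3)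
       + 2 * (4 + m + g + 2 + m + t) * suc (4 + m + g + b) + 2 * (4 + m + g + 2 + m + t + v) * (2 + r) * (4 + m + g + 2 + m + t + v)}
    ((2 * m + g + t) * 2 + (4 + m + g + 2 + m + t) * (2 * m * v + g) + 4 * v * (5 + m + g))
    (+-mono-≤ (+-mono-≤ (+-mono-≤ (+-mono-≤ (+-mono-≤ (+-mono-≤ (*-monoʳ-≤ 2 H) (*-monoʳ-≤ 2 T)) (*-monoʳ-≤ (4 + m + g + 2 + m + t) q))
       (*-monoʳ-≤ ((2 * m + g + t) * 2) (amgm v 1))) (*-monoʳ-≤ 2 (amgm (2 * v) 3)))
       (≤-reflexive (cong (2 * (4 + m + g + 2 + m + t) *_) e))) (≤-reflexive (cong (2 * (4 + m + g + 2 + m + t + v) * (2 + r) *_) (sym e))))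
    (solve (m ∷ g ∷ t ∷ v ∷ b ∷ r ∷ []))
... | inj₂ T = contradiction (core m g t v b r (rearrange 3b₂≤2c T) 2b≤3c e H) λ ()
  where
  -- Like `sq₂`, a quadratic in v of negative discriminant; completing the square yields the `amgm`
  -- term and the slack.
  sq₁ : ∀ m g v → (36 + 10 * m + 8 * g) * v ≤ 6 * (v * v) + (72 + 52 * m + 35 * g + 8 * (m * m) + 12 * (m * g) + 4 * (g * g))
  sq₁ m g v = *-cancelˡ-≤ {(36 + 10 * m + 8 * g) * v} 6 (lin {A = 2 * (6 * v * (18 + 5 * m + 4 * g))} {B = 6 * v * (6 * v) + (18 + 5 * m + 4 * g) *
      (18 + 5 * m + 4 * g)}
    (108 + 132 * m + 66 * g + 23 * (m * m) + 8 * (g * g) + 32 * (m * g)) (amgm (6 * v) (18 + 5 * m + 4 * g)) (solve (m ∷ g ∷ v ∷ [])))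
  sq₂ : ∀ m g v → (16 + 6 * m + 4 * g) * v + 1 ≤ 2 * (v * v) + (72 + 52 * m + 35 * g + 8 * (m * m) + 12 * (m * g) + 4 * (g * g))
  sq₂ m g v = *-cancelˡ-≤ {(16 + 6 * m + 4 * g) * v + 1} 2 (lin {A = 2 * (2 * v * (8 + 3 * m + 2 * g))} {B = 2 * v * (2 * v) + (8 + 3 * m + 2 * g)
      * (8 + 3 * m + 2 * g)}
    (78 + 56 * m + 38 * g + 7 * (m * m) + 4 * (g * g) + 12 * (m * g)) (amgm (2 * v) (8 + 3 * m + 2 * g)) (solve (m ∷ g ∷ v ∷ [])))
  core : ∀ m g t v b r → let c = 4 + m + g + 2 + m ; u = c + t ; a = 4 + m + g in
    3 * (2 + r) * (2 * (u * v) + v * v) + 2 * c * ((5 + m + g) * (u + v)) ≤ 2 * c * (2 * (u * v) + v * v) + 3 * (2 + r) * ((5 + m + g) * (u + v)) →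
    2 * b ≤ 3 * c → u + v ≡ suc (a + b) →
    u * u * (2 + r) + u * v * v + c * u + c * u * v ≤ (u + v) * u + u * v * a + (u + v) * b * (2 + r) → 6 + 2 * m + g ≤ 0
  core m g t v b r T q e H = lin
    {A = 6 * ((4 + m + g + 2 + m + t) * (4 + m + g + 2 + m + t) * (2 + r) + (4 + m + g + 2 + m + t) * v * v + (4 + m + g + 2 + m) * (4 + m + g + 2
        + m + t) + (4 + m + g + 2 + m) * (4 + m + g + 2 + m + t) * v)
       + 2 * (3 * (2 + r) * (2 * ((4 + m + g + 2 + m + t) * v) + v * v) + 2 * (4 + m + g + 2 + m) * ((5 + m + g) * (4 + m + g + 2 + m + t + v)))
       + 3 * (4 + m + g + 2 + m + t) * (2 * b) + t * ((36 + 10 * m + 8 * g) * v) + (6 + 2 * m + g) * ((16 + 6 * m + 4 * g) * v + 1)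
       + 6 * (4 + m + g + 2 + m + t) * (4 + m + g + 2 + m + t + v) + 6 * (4 + m + g + 2 + m + t + v) * (2 + r) * suc (4 + m + g + b)}
    {B = 6 * ((4 + m + g + 2 + m + t + v) * (4 + m + g + 2 + m + t) + (4 + m + g + 2 + m + t) * v * (4 + m + g) + (4 + m + g + 2 + m + t + v) * b *
        (2 + r))
       + 2 * (2 * (4 + m + g + 2 + m) * (2 * ((4 + m + g + 2 + m + t) * v) + v * v) + 3 * (2 + r) * ((5 + m + g) * (4 + m + g + 2 + m + t + v)))
       + 3 * (4 + m + g + 2 + m + t) * (3 * (4 + m + g + 2 + m)) + t * (6 * (v * v) + (72 + 52 * m + 35 * g + 8 * (m * m) + 12 * (m * g) + 4 * (g *
           g)))
       + (6 + 2 * m + g) * (2 * (v * v) + (72 + 52 * m + 35 * g + 8 * (m * m) + 12 * (m * g) + 4 * (g * g)))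
       + 6 * (4 + m + g + 2 + m + t) * suc (4 + m + g + b) + 6 * (4 + m + g + 2 + m + t + v) * (2 + r) * (4 + m + g + 2 + m + t + v)}
    0
    (+-mono-≤ (+-mono-≤ (+-mono-≤ (+-mono-≤ (+-mono-≤ (+-mono-≤ (*-monoʳ-≤ 6 H) (*-monoʳ-≤ 2 T)) (*-monoʳ-≤ (3 * (4 + m + g + 2 + m + t)) q))
       (*-monoʳ-≤ t (sq₁ m g v))) (*-monoʳ-≤ (6 + 2 * m + g) (sq₂ m g v)))
       (≤-reflexive (cong (6 * (4 + m + g + 2 + m + t) *_) e))) (≤-reflexive (cong (6 * (4 + m + g + 2 + m + t + v) * (2 + r) *_) (sym e))))
    (solve (m ∷ g ∷ t ∷ v ∷ b ∷ r ∷ []))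

#-≤1 : ∀ {n} {P : Fin n → Set} (P? : Pred? P) → (∀ x y → P x → P y → x ≡ y) → # P? ≤ 1
#-≤1 P? u with # P? ≟ 0
... | yes e = ≤-trans (≤-reflexive e) z≤n
... | no ne = go (#-∃ P? (n≢0⇒n>0 ne))
  where
  go : ∃[ x ] _ → # P? ≤ 1
  go (x , p) = ≤-trans (#-mono P? (λ z → z F.≟ x) (λ z q → u z x q p)) (≤-reflexive (#-sing x))

-- The intersection arrays left by 2b = 3c

all-below : ∀ {P : ℕ → Set} (P? : ∀ i → Dec (P i)) N {_ : True (allUpTo? P? N)} {i} → i < N → P i
all-below P? N {t} = toWitness t

-- For k = u + v, k₃ = κ + 1 and k₃c₃ = hk, the bound a₃ ≤ k₃ - 1 says k(k₃ - h) ≤ k₃(k₃ - 1), which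
-- bounds k once k₃ > h.
walk-bound : ∀ h {u v} κ → suc κ * u ≡ h * (u + v) → v ≤ κ → (u + v) * suc κ ≤ h * (u + v) + suc κ * κ
walk-bound h {u} {v} κ e p = lin {A = suc κ * u + suc κ * v} {B = h * (u + v) + suc κ * κ} 0
  (+-mono-≤ (≤-reflexive e) (*-monoʳ-≤ (suc κ) p)) (solve (h ∷ u ∷ v ∷ κ ∷ []))

excess : ∀ k₀ q h j κ′ → (k₀ + q) * (h + j) ≤ h * (k₀ + q) + κ′ → k₀ * j ≤ κ′
excess k₀ q h j κ′ p = lin {A = (k₀ + q) * (h + j)} {B = h * (k₀ + q) + κ′} (q * j) p (solve (k₀ ∷ q ∷ h ∷ j ∷ κ′ ∷ []))

few : ∀ h {u v κ} → 0 < u → κ * u ≡ h * (u + v) → h ≤ κ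
few h {u} {v} {κ} 0<u e = *-cancelʳ-≤ h κ u {{>-nonZero 0<u}} (≤-trans (*-monoʳ-≤ h (m≤m+n u v)) (≤-reflexive (sym e)))

exact : ∀ h {u v} → 0 < h → h * u ≡ h * (u + v) → v ≡ 0
exact h {u} {v} 0<h e = sym (+-cancelˡ-≡ u 0 v (trans (+-identityʳ u) (*-cancelˡ-≡ u (u + v) h {{>-nonZero 0<h}} e)))

-- k = a + 1 + 3d < 8d and c₃ ≥ 2d, so k₃c₃ = 3hk gives 2dk₃ < 24hd.
too-many : ∀ h d {a u v p} → 0 < h → u + v ≡ suc (a + 3 * d) → 2 * d ≤ u → (1 + v + p) * u ≡ 3 * h * (u + v) → a + 2 + 3 * h ≤ 5 * d →
    1 + v + p < 12 * h
too-many h d {a} {u} {v} {p} 0<h e p₁ κu I6 = *-cancelʳ-< (2 * d) (1 + v + p) (12 * h) (≤-trans (s≤s (≤-trans (*-monoʳ-≤ (1 + v + p) p₁)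
    (≤-reflexive κu)))
    (core a d h 0<h (u + v) e I6))
  where
  core : ∀ a d h → 0 < h → ∀ k → k ≡ suc (a + 3 * d) → a + 2 + 3 * h ≤ 5 * d → 3 * h * k < 12 * h * (2 * d)
  core a d (suc h) _ _ refl p = lin {A = 3 * suc h * (a + 2 + 3 * suc h)} {B = 3 * suc h * (5 * d)} (11 + 21 * h + 9 * (h * h))
    (*-monoʳ-≤ (3 * suc h) p) (solve (a ∷ d ∷ h ∷ []))

-- The case b₂ = 2. If k₃ = 3, then v = 0 and the walk count gives k ≤ 4d against k ≥ 5d. If k₃ > 3,
-- then k < 14, so d ≤ 2 and a finite search remains.
array₁ : ∀ d a u v p → 1 ≤ a → u + v ≡ suc (a + 3 * d) → u * 2 + v * v ≤ (u + v) + v * a + p * (2 * d) →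
  (1 + v + p) * u ≡ 3 * (u + v) → 2 * d ≤ u → a + 5 ≤ 5 * d → 2 * d ≤ a + 1 → d ≡ 2 × a ≡ 5 × u ≡ 9 × p ≡ 0
array₁ d a u v p 1≤a e I1 κu I4 I6 I7 = by-j (m≤n⇒∃[o]m+o≡n (few 3 0<u κu))
  where
  0<d : 0 < d
  0<d = *-cancelˡ-< 5 0 d (≤-trans (s≤s z≤n) (≤-trans (m≤n+m 5 a) I6))
  0<u : 0 < u
  0<u = ≤-trans 0<d (≤-trans (m≤m+n d (d + 0)) I4)
  5d≤k : 5 * d ≤ u + v
  5d≤k = lin {A = 2 * d + suc (a + 3 * d)} {B = a + 1 + (u + v)} 0 (+-mono-≤ I7 (≤-reflexive (sym e))) (solve (d ∷ a ∷ u ∷ v ∷ []))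
  I6′ : a + 2 + 3 ≤ 5 * d
  I6′ = ≤-trans (≤-reflexive (+-assoc a 2 3)) I6
  -- d = 2 is built in: k = 7 + a and v = k - u. The ranges of the search are a < 6, u ≤ k < 14 and
  -- p < k₃ < 12.
  Check : ℕ → Set
  Check a = ∀ {u} → u < 14 → ∀ {p} → p < 12 → u ≤ 7 + a → (1 + (7 + a ∸ u) + p) * u ≡ 3 * (7 + a) → 4 ≤ u → 3 ≤ a →
    u * 2 + (7 + a ∸ u) * (7 + a ∸ u) ≤ 7 + a + (7 + a ∸ u) * a + p * 4 → a ≡ 5 × u ≡ 9 × p ≡ 0
  check? : ∀ a → Dec (Check a)
  check? a = allUpTo? (λ u → allUpTo? (λ p → (u ≤? 7 + a) →-dec ((1 + (7 + a ∸ u) + p) * u ≟ 3 * (7 + a)) →-dec (4 ≤? u) →-dec (3 ≤? a) →-dec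
    (u * 2 + (7 + a ∸ u) * (7 + a ∸ u) ≤? 7 + a + (7 + a ∸ u) * a + p * 4) →-dec ((a ≟ 5) ×-dec (u ≟ 9) ×-dec (p ≟ 0))) 12) 14
  p<12 : p < 12
  p<12 = ≤-trans (s≤s (m≤n+m p (1 + v))) (too-many 1 d {a} {u} {v} {p} (s≤s z≤n) e I4 κu I6′)
  by-d : ∀ d → 0 < d → d < 3 → u + v ≡ suc (a + 3 * d) → u + v < 14 → 2 * d ≤ u → a + 5 ≤ 5 * d → 2 * d ≤ a + 1 →
         u * 2 + v * v ≤ (u + v) + v * a + p * (2 * d) → d ≡ 2 × a ≡ 5 × u ≡ 9 × p ≡ 0
  by-d 1 _ _ _ _ _ I6 _ _ = contradiction (≤-trans (+-monoˡ-≤ 5 1≤a) I6) λ { (s≤s (s≤s (s≤s (s≤s (s≤s ()))))) }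
  by-d 2 _ _ e lt I4 I6 I7 I1 = refl , all-below check? 6 {i = a} (≤-trans (s≤s (+-cancelʳ-≤ 5 a 5 I6)) ≤-refl) (≤-trans (s≤s (m≤m+n u v)) lt) p<12
      (≤-trans (m≤m+n u v) (≤-reflexive e′)) (subst₂ (λ s t → (1 + s + p) * u ≡ 3 * t) v≡ e′ κu) I4 (+-cancelʳ-≤ 1 3 a I7)
      (subst₂ (λ s t → u * 2 + s * s ≤ t + s * a + p * 4) v≡ e′ I1)
    where
    e′ : u + v ≡ 7 + a
    e′ = trans e (cong suc (+-comm a 6))
    v≡ : v ≡ 7 + a ∸ u
    v≡ = trans (sym (m+n∸m≡n u v)) (cong (_∸ u) e′)
  by-d (suc (suc (suc _))) _ (s≤s (s≤s (s≤s ())))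
  by-j : ∃[ j ] 3 + j ≡ 1 + v + p → d ≡ 2 × a ≡ 5 × u ≡ 9 × p ≡ 0
  by-j (zero , eq) = contradiction (core a d u v p v≡0 (trans (cong (_+ p) (sym v≡0)) (suc-injective (sym eq))) e I1 I6 I7) λ ()
    where
    v≡0 : v ≡ 0
    v≡0 = exact 3 {u} {v} (s≤s z≤n) (trans (cong (_* u) eq) κu)
    core : ∀ a d u v p → v ≡ 0 → p ≡ 2 → u + v ≡ suc (a + 3 * d) → u * 2 + v * v ≤ (u + v) + v * a + p * (2 * d) → a + 5 ≤ 5 * d →
        2 * d ≤ a + 1 → 5 ≤ 0
    core a d u _ _ refl refl q r s t = lin {A = 5 * (u * 2 + 0 * 0) + 5 * suc (a + 3 * d) + 5 * (2 * d) + (a + 5)} {B = 5 * ((u + 0) + 0 * a + 2 *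
        (2 * d)) + 5 * (u + 0) + 5 * (a + 1) + 5 * d} a
      (+-mono-≤ (+-mono-≤ (+-mono-≤ (*-monoʳ-≤ 5 r) (≤-reflexive (cong (5 *_) (sym q)))) (*-monoʳ-≤ 5 t)) s) (solve (a ∷ d ∷ u ∷ []))
  by-j (suc j , eq) = by-d d 0<d (*-cancelˡ-< 5 d 3 (≤-trans (s≤s 5d≤k) (≤-trans k<14 (n≤1+n 14)))) e k<14 I4 I6 I7 I1
    where
    -- 14 is the least bound that works: 13(j + 1) > (4 + j)(3 + j) fails at j = 7, the largest
    -- value allowed by k₃ = 4 + j < 12.
    k<14 : u + v < 14
    k<14 = ≰⇒> λ le → go (m≤n⇒∃[o]m+o≡n le)
      where
      go : ∃[ q ] 14 + q ≡ u + v → ⊥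
      go (q , eq′) = all-below (λ j → ¬? (14 * suc j ≤? (4 + j) * (3 + j))) 8 {i = j}
        (≤-pred (≤-pred (≤-pred (≤-pred (subst (_< 12) (sym eq) (too-many 1 d {a} {u} {v} {p} (s≤s z≤n) e I4 κu I6′))))))
        (excess 14 q 3 (suc j) ((4 + j) * (3 + j)) (subst₂ (λ s t → s * t ≤ 3 * s + t * (3 + j)) (sym eq′) (sym eq)
          (subst (λ t → (u + v) * (1 + v + p) ≤ 3 * (u + v) + (1 + v + p) * t) (sym (suc-injective eq)) (walk-bound 3 {u} {v} (v + p) κu (m≤m+n v
              p)))))

-- The case b₂ = 4. The bounds 6d + 4 ≤ k and a + 8 ≤ 5d give d ≥ 6 and k ≥ 40. k₃ = 6 contradicts
-- the walk count; k₃ > 6 forces k < 43, hence d = 6 and k ≤ 41, where the search finds no c₃.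
array₂ : ∀ d a u v p → u + v ≡ suc (a + 3 * d) → u * 4 + v * v ≤ (u + v) + v * a + p * (2 * d) →
  (1 + v + p) * u ≡ 6 * (u + v) → 2 * d ≤ u → 6 * d + 4 ≤ u + v → a + 8 ≤ 5 * d → ⊥
array₂ d a u v p e I1 κu I4 I5 I6 = by-j (m≤n⇒∃[o]m+o≡n (few 6 0<u κu))
  where
  0<d : 0 < d
  0<d = *-cancelˡ-< 5 0 d (≤-trans (s≤s z≤n) (≤-trans (m≤n+m 8 a) I6))
  0<u : 0 < u
  0<u = ≤-trans 0<d (≤-trans (m≤m+n d (d + 0)) I4)
  I6′ : a + 2 + 6 ≤ 5 * d
  I6′ = ≤-trans (≤-reflexive (+-assoc a 2 6)) I6
  6≤d : 6 ≤ d
  6≤d = *-cancelˡ-< 2 5 d (lin {A = 6 * d + 4 + (a + 8) + (u + v)} {B = u + v + 5 * d + suc (a + 3 * d)} 0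
    (+-mono-≤ (+-mono-≤ I5 I6) (≤-reflexive e)) (solve (d ∷ a ∷ u ∷ v ∷ [])))
  k₀ : 40 ≤ u + v
  k₀ = ≤-trans (+-monoˡ-≤ 4 (*-monoʳ-≤ 6 6≤d)) I5
  by-j : ∃[ j ] 6 + j ≡ 1 + v + p → ⊥
  by-j (zero , eq) = contradiction (core a d u v p v≡0 (trans (cong (_+ p) (sym v≡0)) (suc-injective (sym eq))) I1 I5) λ ()
    where
    v≡0 : v ≡ 0
    v≡0 = exact 6 {u} {v} (s≤s z≤n) (trans (cong (_* u) eq) κu)
    core : ∀ a d u v p → v ≡ 0 → p ≡ 5 → u * 4 + v * v ≤ (u + v) + v * a + p * (2 * d) → 6 * d + 4 ≤ u + v → 12 ≤ 0
    core a d u _ _ refl refl r s = lin {A = (u * 4 + 0 * 0) + 3 * (6 * d + 4)} {B = ((u + 0) + 0 * a + 5 * (2 * d)) + 3 * (u + 0)} (8 * d)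
      (+-mono-≤ r (*-monoʳ-≤ 3 s)) (solve (a ∷ d ∷ u ∷ []))
  by-j (suc j , eq) = finish (u + v) k₀ k<43 k<42 refl
    where
    wb : (u + v) * (7 + j) ≤ 6 * (u + v) + (7 + j) * (6 + j)
    wb = subst (λ t → (u + v) * suc t ≤ 6 * (u + v) + suc t * t) (sym (suc-injective eq)) (walk-bound 6 {u} {v} (v + p) κu (m≤m+n v p))
    j<17 : j < 17
    j<17 = ≤-pred (≤-pred (≤-pred (≤-pred (≤-pred (≤-pred (≤-pred (subst (_< 24) (sym eq) (too-many 2 d {a} {u} {v} {p} (s≤s z≤n) e I4 κu I6′))))))))
    k<43 : u + v < 43
    k<43 = ≰⇒> λ le → go (m≤n⇒∃[o]m+o≡n le)
      where
      go : ∃[ q ] 43 + q ≡ u + v → ⊥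
      go (q , eq′) = all-below (λ j → ¬? (43 * suc j ≤? (7 + j) * (6 + j))) 17 {i = j} j<17
        (excess 43 q 6 (suc j) ((7 + j) * (6 + j)) (subst (λ s → s * (6 + suc j) ≤ 6 * s + (7 + j) * (6 + j)) {u + v} {43 + q} (sym eq′) wb))
    d≡6 : d ≡ 6
    d≡6 = ≤-antisym (≤-pred (*-cancelˡ-< 6 d 7 (lin {A = 6 * d + 4 + suc (u + v)} {B = u + v + 43} 3 (+-mono-≤ I5 k<43) (solve (d ∷ u ∷ v ∷ [])))))
        6≤d
    k<42 : u + v < 42
    k<42 = core a d d≡6 (u + v) e I6
      where
      core : ∀ a d → d ≡ 6 → ∀ k → k ≡ suc (a + 3 * d) → a + 8 ≤ 5 * d → k < 42
      core a _ refl _ refl p = lin {A = a + 8} {B = 30} 0 p (solve (a ∷ []))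
    Check : ℕ → Set
    Check k = ∀ {j} → j < 17 → ∀ {u} → u < 43 → 40 ≤ k → (7 + j) * u ≡ 6 * k → k * (7 + j) ≤ 6 * k + (7 + j) * (6 + j) → ⊥
    check? : ∀ k → Dec (Check k)
    check? k = allUpTo? (λ j → allUpTo? (λ u → (40 ≤? k) →-dec ((7 + j) * u ≟ 6 * k) →-dec ((k * (7 + j)) ≤? (6 * k + (7 + j) * (6 + j))) →-dec no
        (λ ())) 43) 17
    finish : ∀ k → 40 ≤ k → k < 43 → k < 42 → k ≡ u + v → ⊥
    finish k q _ lt refl = all-below check? 42 {i = k} lt j<17 (≤-trans (s≤s (m≤m+n u v)) k<43) q (trans (cong (_* u) eq) κu) wb

-- The parameters are c = 2d, b = 3d, b₂ = 2h, and u = c₃, v = k − c₃, κ = 1 + v + p = k₃.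
johnson-array : ∀ d h a u v p k₂ → 1 ≤ a → 0 < h → u + v ≡ suc (a + 3 * d) → u * (2 * h) + v * v ≤ (u + v) + v * a + p * (2 * d) →
  k₂ * (2 * h) ≡ (1 + v + p) * u → (u + v) * (3 * d) ≡ k₂ * (2 * d) → 2 * d ≤ u →
  2 * h * d + 2 * d + 2 * h ≤ u + v → a + 2 + 3 * h ≤ 5 * d → 2 * d ≤ a + 1 →
  d ≡ 2 × h ≡ 1 × a ≡ 5 × u ≡ 9 × p ≡ 0
johnson-array zero h a u v p k₂ _ _ _ _ _ _ _ _ I6 _ = contradiction (≤-trans (≤-trans (m≤n+m 2 a) (m≤m+n (a + 2) (3 * h))) I6) λ ()
johnson-array d@(suc _) h a u v p k₂ 1≤a 0<h I0 I1 I2 I3 I4 I5 I6 I7 = go h 0<h I1 I6 κu I5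
  where
  κu : (1 + v + p) * u ≡ 3 * h * (u + v)
  κu = trans (sym I2) (core h k₂ (u + v) d I3)
    where
    core : ∀ h k w d → .{{NonZero d}} → w * (3 * d) ≡ k * (2 * d) → k * (2 * h) ≡ 3 * h * w
    core h k w d e = *-cancelʳ-≡ (k * (2 * h)) (3 * h * w) d (trans (eq₁ h k d) (trans (cong (h *_) (sym e)) (eq₂ h w d)))
      where
      eq₁ : ∀ h k d → k * (2 * h) * d ≡ h * (k * (2 * d))
      eq₁ h k d = solve (h ∷ k ∷ d ∷ [])
      eq₂ : ∀ h w d → h * (w * (3 * d)) ≡ 3 * h * w * d
      eq₂ h w d = solve (h ∷ w ∷ d ∷ [])
  go : ∀ h → 0 < h → u * (2 * h) + v * v ≤ (u + v) + v * a + p * (2 * d) → a + 2 + 3 * h ≤ 5 * d → (1 + v + p) * u ≡ 3 * h * (u + v) →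
       2 * h * d + 2 * d + 2 * h ≤ u + v → d ≡ 2 × h ≡ 1 × a ≡ 5 × u ≡ 9 × p ≡ 0
  -- For b₂ ≥ 6 the two bounds on k = a + 1 + 3d collide: at least 8d + 6 and at most 8d - 10.
  go (suc (suc (suc h))) _ _ I6 _ I5 = contradiction (core h a d (u + v) I0 I5 I6) λ ()
    where
    core : ∀ h a d k → k ≡ suc (a + 3 * d) → 2 * (3 + h) * d + 2 * d + 2 * (3 + h) ≤ k → a + 2 + 3 * (3 + h) ≤ 5 * d → 16 + 5 * h ≤ 0
    core h a d _ refl p q = lin {A = 2 * (3 + h) * d + 2 * d + 2 * (3 + h) + (a + 2 + 3 * (3 + h))} {B = suc (a + 3 * d) + 5 * d} (2 * (h * d))
        (+-mono-≤ p q)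
      (solve (h ∷ a ∷ d ∷ []))
  go (suc (suc zero)) _ I1 I6 e I5 = ⊥-elim (array₂ d a u v p I0 I1 e I4 (core d (u + v) I5) (≤-trans (≤-reflexive (sym (+-assoc a 2 6))) I6))
    where
    core : ∀ d k → 2 * 2 * d + 2 * d + 2 * 2 ≤ k → 6 * d + 4 ≤ k
    core d k p = lin {A = 2 * 2 * d + 2 * d + 2 * 2} {B = k} 0 p (solve (d ∷ k ∷ []))
  go (suc zero) _ I1 I6 e I5 = proj₁ r , refl , proj₂ r
    where
    r = array₁ d a u v p 1≤a I0 I1 e I4 (≤-trans (≤-reflexive (sym (+-assoc a 2 3))) I6) I7

-- Walks inside Γ₃ and the array of J(7,3)

module DenseArray {n : ℕ} (T : Setting n) (1≤a : 1 ≤ Setting.a T) (c<b : Local.c (Setting.S T) (Setting.a T) (Setting.hk T) < Local.b (Setting.S T)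
    (Setting.a T) (Setting.hk T)) where

  open Small T
  open Dense T 1≤a c<b

  record Walks : Set where
    field
      v p  : ℕ
      u+v  : C 3 + v ≡ k
      k₃   : 1 + v + p ≡ # (at? 3 w₀)
      walk : C 3 * b₂ + v * v ≤ k + v * a + p * c

  -- Two-step walks from x₀ that end at distance 3 from w₀, counted by midpoint and by end point; v = a₃.
  walks : D ≡ 3 → Walks
  walks D≡3 = record { v = v ; p = p ; u+v = sym (degree w₀x₀) ; k₃ = sym k₃≡ ; walk = bound }
    where
    w = w₀
    x = x₀
    v = # (at? 1 x ∩? at? 3 w)
    far? = λ z → at? 3 w z ×-dec (¬? (z F.≟ x) ×-dec ¬? (at? 1 x z))
    p = # far?
    degree : ∀ {z} → d w z ≡ 3 → k ≡ C 3 + # (at? 1 z ∩? at? 3 w)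
    degree {z} h = trans (sym (val z)) (trans (#-split (at? 1 z ∩? at? 2 w) (at? 1 z ∩? at? 3 w) (at? 1 z) cov (λ _ → proj₁) (λ _ → proj₁)
        (λ _ q r → clash (proj₂ q) (proj₂ r))) (cong (_+ # (at? 1 z ∩? at? 3 w)) (C-spec 2 h)))
      where
      cov : ∀ y → d z y ≡ 1 → _
      cov y q with nb q h
      ... | inj₁ r = inj₁ (q , r)
      ... | inj₂ (inj₁ r) = inj₂ (q , r)
      ... | inj₂ (inj₂ r) = contradiction (diam-≤ w y) (<⇒≱ (≤-reflexive (trans (cong suc D≡3) (sym r))))
    a₃ : ∀ {z} → d w z ≡ 3 → # (at? 1 z ∩? at? 3 w) ≡ v
    a₃ {z} h = +-cancelˡ-≡ (C 3) (# (at? 1 z ∩? at? 3 w)) v (trans (sym (degree h)) (degree w₀x₀))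
    near? = at? 3 w ∩? at? 1 x
    near-v : # near? ≡ v
    near-v = #-cong near? (at? 1 x ∩? at? 3 w) (λ _ (q , r) → r , q) (λ _ (q , r) → r , q)
    rest? : Pred? _
    rest? z = near? z ⊎-dec far? z
    cov₃ : ∀ z → d w z ≡ 3 → _
    cov₃ z h with z F.≟ x | at? 1 x z
    ... | yes e | _ = inj₁ e
    ... | no ne | yes q = inj₂ (inj₁ (h , q))
    ... | no ne | no q = inj₂ (inj₂ (h , ne , q))
    k₃≡ : # (at? 3 w) ≡ 1 + v + p
    k₃≡ = trans (#-split (λ z → z F.≟ x) rest? (at? 3 w) cov₃ (λ { _ refl → w₀x₀ }) (λ _ → [ proj₁ , proj₁ ]′)
             (λ { _ refl (inj₁ (_ , q)) → d≢ q refl ; _ refl (inj₂ (_ , ne , _)) → ne refl }))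
           (cong₂ _+_ (#-sing x) (trans (#-split near? far? rest? (λ _ q → q) (λ _ → inj₁) (λ _ → inj₂) (λ _ (_ , q) (_ , _ , r) → r q))
             (cong (_+ p) near-v)))
    adj? : ∀ x z → Dec (d x z ≡ 1)
    adj? x z = at? 1 x z
    codj? : ∀ x z → Dec (d z x ≡ 1)
    codj? x z = at? 1 z x
    -- A midpoint in Γ₂(w) has b₂ continuations into Γ₃(w), a midpoint in Γ₃(w) has a₃ = v.
    lower : C 3 * b₂ + v * v ≤ pairs (at? 1 x) (at? 3 w) adj?
    lower = ≤-trans (+-mono-≤
      (subst (λ t → t * b₂ ≤ pairs (at? 1 x ∩? at? 2 w) (at? 3 w) adj?) (C-spec 2 w₀x₀)
        (pairs-≥ (at? 1 x ∩? at? 2 w) (at? 3 w) adj? b₂ (λ z (_ , q) → ≤-reflexive (trans (sym (B-spec 2 q))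
           (#-cong (at? 1 z ∩? at? 3 w) (λ y → at? 3 w y ×-dec at? 1 z y) (λ _ (r , t) → t , r) (λ _ (r , t) → t , r))))))
      (pairs-≥ (at? 1 x ∩? at? 3 w) (at? 3 w) adj? v (λ z (_ , q) → ≤-reflexive (trans (sym (a₃ q))
           (#-cong (at? 1 z ∩? at? 3 w) (λ y → at? 3 w y ×-dec at? 1 z y) (λ _ (r , t) → t , r) (λ _ (r , t) → t , r))))))
      (pairs-pack (at? 1 x) (at? 1 x ∩? at? 2 w) (at? 1 x ∩? at? 3 w) (at? 3 w) adj? (λ _ → proj₁) (λ _ → proj₁) (λ _ q r →
          clash (proj₂ q) (proj₂ r)))
    codeg-at : ∀ y → # (λ z → at? 1 x z ×-dec at? 1 z y) ≡ # (at? 1 y ∩? at? 1 x)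
    codeg-at y = #-cong (λ z → at? 1 x z ×-dec at? 1 z y) (at? 1 y ∩? at? 1 x) (λ _ (r , t) → sy t , r) (λ _ (r , t) → t , sy r)
    codeg-far : ∀ y → d w y ≡ 3 × (¬ y ≡ x × ¬ d x y ≡ 1) → # (λ z → at? 1 x z ×-dec at? 1 z y) ≤ c
    codeg-far y (h , ne , na) with at? 2 x y
    ... | yes e = ≤-reflexive (trans (codeg-at y) (codeg₂ e))
    ... | no e  = ≤-trans (≤-reflexive (#-0 (λ z → at? 1 x z ×-dec at? 1 z y) none)) z≤n
      where
      none : ∀ z → ¬ (d x z ≡ 1 × d z y ≡ 1)
      none z (q , r) with nb r q
      ... | inj₁ t = ne (sym (d-zero t))
      ... | inj₂ (inj₁ t) = na t
      ... | inj₂ (inj₂ t) = e t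
    -- By end point: k walks return to x, a end at each of the v neighbours of x in Γ₃(w), and at
    -- most c at each of the p others.
    upper : pairs (at? 3 w) (at? 1 x) codj? ≤ k + (v * a + p * c)
    upper = ≤-trans (pairs-cover (at? 3 w) (λ z → z F.≟ x) rest? (at? 1 x) codj? cov₃) (+-mono-≤
       (≤-trans (pairs-≤ (λ z → z F.≟ x) (at? 1 x) codj? k (λ { y refl → ≤-trans (#-mono (λ z → at? 1 x z ×-dec at? 1 z y) (at? 1 x) (λ _ →
           proj₁)) (≤-reflexive (val x)) }))
         (≤-reflexive (trans (cong (_* k) (#-sing x)) (*-identityˡ k))))
       (≤-trans (pairs-cover rest? near? far? (at? 1 x) codj? (λ _ q → q)) (+-mono-≤
         (≤-trans (pairs-≤ near? (at? 1 x) codj? a (λ y (_ , q) → ≤-reflexive (trans (codeg-at y) (codeg₁ q)))) (≤-reflexive (cong (_* a) near-v)))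
         (pairs-≤ far? (at? 1 x) codj? c codeg-far))))
    bound : C 3 * b₂ + v * v ≤ k + v * a + p * c
    bound = ≤-trans lower (≤-trans (≤-reflexive (pairs-swap (at? 1 x) (at? 3 w) adj?)) (≤-trans upper (≤-reflexive (sym (+-assoc k (v * a) (p *
        c))))))

  sparse : a + 2 ≤ c → 3 * b₂ ≤ 2 * c → ⊥
  sparse a+2≤c 3b₂≤2c = sparse-impossible {a} {c} {b₂} {C 3} b (Walks.v ws) a+2≤c c+2≤2a 2≤b₂ 3b₂≤2c c≤C3 2b≤3c (trans (Walks.u+v ws) hk)
      (walk-inequality (C 3) (Walks.v ws) (Walks.p ws) (# (at? 3 w₀)) (# (at? 2 w₀)) a b c b₂
        (subst (λ t → C 3 * b₂ + Walks.v ws * Walks.v ws ≤ t + Walks.v ws * a + Walks.p ws * c) (sym (Walks.u+v ws)) (Walks.walk ws))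
        (Walks.k₃ ws) (level₃ w₀) (trans (cong (_* b) (Walks.u+v ws)) (level₂ w₀)))
    where
    arith : ∀ c → 3 * c ≤ 2 * c → c ≤ 0
    arith c p = lin {A = 3 * c} {B = 2 * c} 0 p (solve (c ∷ []))
    D=3 : D ≡ 3
    D=3 = D≡3 λ h → <⇒≱ 0<c (arith c (≤-trans (*-monoʳ-≤ 3 (c≤b₂ h)) 3b₂≤2c))
    ws = walks D=3

  record JohnsonArray : Set where
    field
      diam  : D ≡ 3
      a≡5   : a ≡ 5
      b≡6   : b ≡ 6
      c≡4   : c ≡ 4
      b₂≡2  : b₂ ≡ 2
      C3≡9  : C 3 ≡ 9

  module Clique (2b≡3c : 2 * b ≡ 3 * c) (c≤a+1 : c ≤ a + 1) where

    y = y₀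
    x = x₀
    yx = y₀x₀

    -- Each w in the clique W has b - c non-neighbours in Γ(y) outside W and not adjacent to x.
    -- These sets are disjoint, since a common non-neighbour of two vertices of W is adjacent to x.
    outside : b₂ * (b ∸ c) + (c + b₂) ≤ k
    outside = ≤-trans (+-monoˡ-≤ (c + b₂) disjoint) total
      where
      W? = at? 1 y ∩? at? 3 x
      Q? = λ z → at? 1 y z ×-dec (¬? (at? 1 x z) ×-dec ¬? (at? 3 x z))
      row : ∀ w → d y w ≡ 1 × d x w ≡ 3 → b ∸ c ≤ # (λ z → Q? z ×-dec at? 2 w z)
      row w h = m≤n+o⇒m∸n≤o b c (subst₂ _≤_ (nonnbr (proj₁ h)) (cong (_+ # (λ z → Q? z ×-dec at? 2 w z)) (codeg₂ (sy yx)))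
           (#-cover (at? 1 y ∩? at? 1 x) (λ z → Q? z ×-dec at? 2 w z) (at? 1 y ∩? at? 2 w) cov))
        where
        cov : ∀ z → d y z ≡ 1 × d w z ≡ 2 → _
        cov z (p , q) with at? 1 x z | at? 3 x z
        ... | yes e | _ = inj₁ (p , e)
        ... | no e | no f = inj₂ ((p , e , f) , q)
        ... | no e | yes f = ⊥-elim (clash (W-clique yx 2b≡3c c≤a+1 h (p , f) (d≢ q)) q)
      col : ∀ z → d y z ≡ 1 × (¬ d x z ≡ 1 × ¬ d x z ≡ 3) → # (λ w → W? w ×-dec at? 2 w z) ≤ 1
      col z (p , ne , _) = #-≤1 (λ w → W? w ×-dec at? 2 w z) uniq
        where
        uniq : ∀ w w′ → (d y w ≡ 1 × d x w ≡ 3) × d w z ≡ 2 → (d y w′ ≡ 1 × d x w′ ≡ 3) × d w′ z ≡ 2 → w ≡ w′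
        uniq w w′ (h , q) (h′ , q′) with w F.≟ w′
        ... | yes e = e
        ... | no t = ⊥-elim (ne (common⊂M yx h h′ (W-clique yx 2b≡3c c≤a+1 h h′ t) z p q q′))
      disjoint : b₂ * (b ∸ c) ≤ # Q?
      disjoint = subst₂ (λ s t → s * (b ∸ c) ≤ t) (far (sy yx)) (*-identityʳ (# Q?))
         (double-≤ W? Q? (λ w z → at? 2 w z) (b ∸ c) 1 row col)
      total : # Q? + (c + b₂) ≤ k
      total = subst₂ (λ s t → # Q? + s ≤ t) both (val y) (#-pack Q? MW? (at? 1 y) (λ _ → proj₁) (λ _ → [ proj₁ , proj₁ ]′)
                (λ { z (_ , q , _) (inj₁ (_ , r)) → q r ; z (_ , _ , q) (inj₂ (_ , r)) → q r }))
        where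
        MW? : Pred? _
        MW? z = (at? 1 y ∩? at? 1 x) z ⊎-dec W? z
        both : # MW? ≡ c + b₂
        both = trans (#-split (at? 1 y ∩? at? 1 x) W? MW? (λ _ q → q) (λ _ → inj₁) (λ _ → inj₂) (λ _ q r → clash (proj₂ q) (proj₂ r)))
                 (cong₂ _+_ (codeg₂ (sy yx)) (far (sy yx)))

    -- d = b - c, because 2b = 3c means c = 2(b - c). Then ξc = bb₂ becomes 2ξ = 3b₂, and h = ξ -
    -- b₂.
    halves : ∃[ d ] ∃[ h ] (c ≡ 2 * d × b ≡ 3 * d × b₂ ≡ 2 * h)
    halves = arith b c ξ b₂ c<b 2b≡3c hξ
      where
      arith : ∀ b c ξ b₂ → c < b → 2 * b ≡ 3 * c → ξ * c ≡ b * b₂ → ∃[ d ] ∃[ h ] (c ≡ 2 * d × b ≡ 3 * d × b₂ ≡ 2 * h)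
      arith b c ξ b₂ lt hf e with m≤n⇒∃[o]m+o≡n (<⇒≤ lt)
      ... | o , refl with eqc c o hf
        where
        eqc : ∀ c o → 2 * (c + o) ≡ 3 * c → c ≡ 2 * o
        eqc c o h = sym (+-cancelˡ-≡ (2 * c) (2 * o) c (trans (sym (*-distribˡ-+ 2 c o)) (trans h (eq c))))
          where
          eq : ∀ c → 3 * c ≡ 2 * c + c
          eq c = solve (c ∷ [])
      arith b c ξ b₂ lt hf e | zero , refl | refl = contradiction lt λ ()
      arith b c ξ b₂ lt hf e | o@(suc _) , refl | refl = o , ξ ∸ b₂ , refl , eq₃ o , b₂≡
        where
        eq₃ : ∀ o → 2 * o + o ≡ 3 * o
        eq₃ o = solve (o ∷ [])
        2ξ≡3b₂ : 2 * ξ ≡ 3 * b₂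
        2ξ≡3b₂ = core ξ b₂ o e
          where
          core : ∀ ξ b₂ o → .{{NonZero o}} → ξ * (2 * o) ≡ (2 * o + o) * b₂ → 2 * ξ ≡ 3 * b₂
          core ξ b₂ o e = *-cancelʳ-≡ (2 * ξ) (3 * b₂) o (trans (eq₁ ξ o) (trans e (eq₂ o b₂)))
            where
            eq₁ : ∀ ξ o → 2 * ξ * o ≡ ξ * (2 * o)
            eq₁ ξ o = solve (ξ ∷ o ∷ [])
            eq₂ : ∀ o b₂ → (2 * o + o) * b₂ ≡ 3 * b₂ * o
            eq₂ o b₂ = solve (o ∷ b₂ ∷ [])
        b₂≡ : b₂ ≡ 2 * (ξ ∸ b₂)
        b₂≡ = core ξ b₂ 2ξ≡3b₂
          where
          core : ∀ ξ b₂ → 2 * ξ ≡ 3 * b₂ → b₂ ≡ 2 * (ξ ∸ b₂)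
          core ξ b₂ e = sym (trans (*-distribˡ-∸ 2 ξ b₂) (trans (cong (_∸ 2 * b₂) (trans e (eq b₂))) (m+n∸m≡n (2 * b₂) b₂)))
            where
            eq : ∀ b₂ → 3 * b₂ ≡ 2 * b₂ + b₂
            eq b₂ = solve (b₂ ∷ [])

    -- For a non-adjacent pair ν > 0, so s ≥ b₂ = 2h, and `s-bound` reads s ≤ 2ν. Hence 5d - a - 2 =
    -- s + ν ≥ 3s/2 ≥ 3h.
    a-bound : ∀ d h → c ≡ 2 * d → b ≡ 3 * d → b₂ ≡ 2 * h → a + 2 + 3 * h ≤ 5 * d
    a-bound e h c≡ b≡ b₂≡ = go (#-∃ (at? 1 y₀ ∩? at? 2 w₀) (subst (0 <_) (sym (nonnbr (sy w₀y₀))) 0<b))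
      where
      arith : ∀ s v a b c b₂ e h → 0 < c → c ≡ 2 * e → b ≡ 3 * e → b₂ ≡ 2 * h → b₂ ≤ s → s + v + (a + 2) ≡ b + c → s * (2 * c) ≤ v * c + s * b →
          a + 2 + 3 * h ≤ 5 * e
      arith s v a _ _ _ (suc e) h _ refl refl refl p q r = *-cancelˡ-≤ {a + 2 + 3 * h} 2 (fin s v a (suc e) h p q (*-cancelʳ-≤ s (2 * v) (suc e)
          (core s v (suc e) r)))
        where
        core : ∀ s v e → s * (2 * (2 * e)) ≤ v * (2 * e) + s * (3 * e) → s * e ≤ 2 * v * e
        core s v e r = lin {A = s * (2 * (2 * e))} {B = v * (2 * e) + s * (3 * e)} 0 r (solve (s ∷ v ∷ e ∷ []))
        fin : ∀ s v a e h → 2 * h ≤ s → s + v + (a + 2) ≡ 3 * e + 2 * e → s ≤ 2 * v → 2 * (a + 2 + 3 * h) ≤ 2 * (5 * e)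
        fin s v a e h p q r = lin {A = 3 * (2 * h) + 2 * (s + v + (a + 2)) + s} {B = 3 * s + 2 * (3 * e + 2 * e) + 2 * v} 0
          (+-mono-≤ (+-mono-≤ (*-monoʳ-≤ 3 p) (≤-reflexive (cong (2 *_) q))) r) (solve (s ∷ v ∷ a ∷ e ∷ h ∷ []))
      go : ∃[ f ] (d y₀ f ≡ 1 × d w₀ f ≡ 2) → a + 2 + 3 * h ≤ 5 * e
      go (f , p , q) = arith (s y₀ w₀ f) (ν y₀ w₀ f) a b c b₂ e h 0<c c≡ b≡ b₂≡ (b₂≤s (sy w₀y₀) p (0<ν′ (sy w₀y₀) p q))
        (sν-nonadj (sy w₀y₀) p q) (s-bound (sy w₀y₀) p)

    johnson : JohnsonArray
    johnson = from halves
      where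
      from : ∃[ d ] ∃[ h ] (c ≡ 2 * d × b ≡ 3 * d × b₂ ≡ 2 * h) → JohnsonArray
      from (e , h , c≡ , b≡ , b₂≡) = record { diam = D=3 ; a≡5 = a5 ; b≡6 = trans b≡ (cong (3 *_) e2) ; c≡4 = trans c≡ (cong (2 *_) e2)
                                            ; b₂≡2 = trans b₂≡ (cong (2 *_) h1) ; C3≡9 = proj₁ (proj₂ (proj₂ (proj₂ arr))) }
        where
        I6 : a + 2 + 3 * h ≤ 5 * e
        I6 = a-bound e h c≡ b≡ b₂≡
        I5 : 2 * h * e + 2 * e + 2 * h ≤ k
        I5 = arith b c b₂ e h c≡ b≡ b₂≡ outside
          where
          arith : ∀ b c b₂ e h {k} → c ≡ 2 * e → b ≡ 3 * e → b₂ ≡ 2 * h → b₂ * (b ∸ c) + (c + b₂) ≤ k → 2 * h * e + 2 * e + 2 * h ≤ k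
          arith _ _ _ e h refl refl refl p = ≤-trans (≤-reflexive (trans (+-assoc (2 * h * e) (2 * e) (2 * h)) (cong (λ t →
              2 * h * t + (2 * e + 2 * h)) (sym (diff e))))) p
            where
            eq : ∀ e → 3 * e ≡ 2 * e + e
            eq e = solve (e ∷ [])
            diff : ∀ e → 3 * e ∸ 2 * e ≡ e
            diff e = trans (cong (_∸ 2 * e) (eq e)) (m+n∸m≡n (2 * e) e)
        0<h : 0 < h
        0<h = *-cancelˡ-< 2 0 h (subst (0 <_) b₂≡ 0<b₂)
        hk′ : k ≡ suc (a + 3 * e)
        hk′ = trans hk (cong (λ t → suc (a + t)) b≡)
        D=3 : D ≡ 3
        D=3 = D≡3 λ q → contradiction (arith a e h k hk′ (*-cancelˡ-≤ {e} {h} 2 (subst₂ _≤_ c≡ b₂≡ (c≤b₂ q))) I5 I6) λ ()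
          where
          arith : ∀ a e h k → k ≡ suc (a + 3 * e) → e ≤ h → 2 * h * e + 2 * e + 2 * h ≤ k → a + 2 + 3 * h ≤ 5 * e → 1 ≤ 0
          arith a e h _ refl le p q with m≤n⇒∃[o]m+o≡n le
          ... | o , refl = core a e o p q
            where
            core : ∀ a e o → 2 * (e + o) * e + 2 * e + 2 * (e + o) ≤ suc (a + 3 * e) → a + 2 + 3 * (e + o) ≤ 5 * e → 1 ≤ 0
            core a zero o p q = lin {A = 2 * (0 + o) * 0 + 2 * 0 + 2 * (0 + o) + (a + 2 + 3 * (0 + o))} {B = suc (a + 3 * 0) + 5 * 0} (5 * o)
                (+-mono-≤ p q) (solve (a ∷ o ∷ []))
            core a (suc e) o p q = lin {A = 2 * (suc e + o) * suc e + 2 * suc e + 2 * (suc e + o) + (a + 2 + 3 * (suc e + o))} {B = suc (a + 3 *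
                suc e) + 5 * suc e}
              (1 + 3 * e + 2 * (e * e) + 2 * (o * suc e) + 5 * o) (+-mono-≤ p q) (solve (a ∷ e ∷ o ∷ []))
        ws = walks D=3
        open Walks ws
        arr = johnson-array e h a (C 3) v p (# (at? 2 w₀)) 1≤a 0<h (trans u+v hk′)
           (subst₂ (λ s t → C 3 * s + v * v ≤ C 3 + v + v * a + p * t) b₂≡ c≡ (subst (λ t → C 3 * b₂ + v * v ≤ t + v * a + p * c) (sym u+v) walk))
           (subst₂ (λ s t → # (at? 2 w₀) * s ≡ t * C 3) b₂≡ (sym k₃) (level₃ w₀))
           (subst₂ (λ s t → (C 3 + v) * s ≡ # (at? 2 w₀) * t) b≡ c≡ (trans (cong (_* b) u+v) (level₂ w₀)))
           (subst (_≤ C 3) c≡ c≤C3) (≤-trans I5 (≤-reflexive (sym u+v))) I6 (subst (_≤ a + 1) c≡ c≤a+1)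
        e2 = proj₁ arr
        h1 = proj₁ (proj₂ arr)
        a5 = proj₁ (proj₂ (proj₂ arr))

  dense : JohnsonArray
  dense with 2 * b ≟ 3 * c
  ... | no ne = ⊥-elim (sparse (proj₁ lo) (proj₂ lo))
    where
    lo = loose y₀x₀ (≤∧≢⇒< 2b≤3c ne)
  ... | yes hf with a + 2 ≤? c
  ... | yes le = ⊥-elim (sparse le (tight y₀x₀ hf le))
  ... | no gt  = Clique.johnson hf (≤-pred (≤-trans (≰⇒> gt) (≤-reflexive (+-suc a 1))))

-- Polygons

injective⇒surjective : ∀ {m} (f : Fin m → Fin m) → (∀ {i j} → f i ≡ f j → i ≡ j) → ∀ y → ∃[ x ] f x ≡ y
injective⇒surjective {suc m} f inj y with FP.any? (λ x → f x F.≟ y)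
... | yes h = h
... | no ne with FP.pigeonhole ≤-refl (λ x → F.punchOut {i = y} {f x} (λ e → ne (x , sym e)))
... | i , j , lt , e = contradiction (cong toℕ (inj (FP.punchOut-injective (λ e → ne (i , sym e)) (λ e → ne (j , sym e)) e))) (<⇒≢ lt)

record Enumeration {n} (P : Fin n → Set) (m : ℕ) : Set where
  field
    el   : Fin m → Fin n
    prop : ∀ i → P (el i)
    inj  : ∀ {i j} → el i ≡ el j → i ≡ j
    sur  : ∀ z → P z → ∃[ i ] el i ≡ z

enumerate : ∀ {n} {P : Fin n → Set} (P? : Pred? P) m → # P? ≡ m → Enumeration P m
enumerate P? zero e = record { el = λ () ; prop = λ () ; inj = λ { {()} } ; sur = λ z p → contradiction (#-pos P? z p) (≤⇒≯ (≤-reflexive e)) }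
enumerate {n} {P} P? (suc m) e = go (#-∃ P? (subst (0 <_) (sym e) (s≤s z≤n)))
  where
  go : ∃[ x ] P x → Enumeration P (suc m)
  go (x , p) = record { el = el ; prop = prop ; inj = λ {i} {j} → inj i j ; sur = sur }
    where
    E = enumerate (λ z → P? z ×-dec ¬? (z F.≟ x)) m (suc-injective (trans (sym (#-remove P? x p)) e))
    module E = Enumeration E
    el : Fin (suc m) → Fin n
    el zero = x
    el (suc i) = E.el i
    prop : ∀ i → P (el i)
    prop zero = p
    prop (suc i) = proj₁ (E.prop i)
    inj : ∀ i j → el i ≡ el j → i ≡ j
    inj zero zero _ = refl
    inj zero (suc j) h = ⊥-elim (proj₂ (E.prop j) (sym h))
    inj (suc i) zero h = ⊥-elim (proj₂ (E.prop i) h)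
    inj (suc i) (suc j) h = cong suc (E.inj h)
    sur : ∀ z → P z → ∃[ i ] el i ≡ z
    sur z q with z F.≟ x
    ... | yes e = zero , sym e
    ... | no ne = suc (proj₁ (E.sur z (q , ne))) , proj₂ (E.sur z (q , ne))

record IsoD {n} (S : Scheme n) (V : Set) (adjV : V → V → Bool) : Set where
  constructor isoD
  field
    bij  : Fin n ↔ V
    pres : ∀ x y → (Scheme.d S x y ≡ᵇ 1) ≡ adjV (Inverse.to bij x) (Inverse.to bij y)

≡ᵇ-true : ∀ {m n} → (m ≡ᵇ n) ≡ true → m ≡ n
≡ᵇ-true {m} {n} h = ≡ᵇ⇒≡ m n (subst T (sym h) _)

true-≡ᵇ : ∀ {m n} → m ≡ n → (m ≡ᵇ n) ≡ true
true-≡ᵇ {m} refl = go m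
  where
  go : ∀ m → (m ≡ᵇ m) ≡ true
  go zero = refl
  go (suc m) = go m

bool-ext : ∀ {a b} → (a ≡ true → b ≡ true) → (b ≡ true → a ≡ true) → a ≡ b
bool-ext {true}  {b}     f g = sym (f refl)
bool-ext {false} {false} f g = refl
bool-ext {false} {true}  f g = g refl

module _ {n} (S : Scheme n) {V : Set} (adjV : V → V → Bool) where

  open Scheme S

  mkIso : (to : Fin n → V) (from : V → Fin n) → (∀ v → to (from v) ≡ v) → (∀ {x y} → to x ≡ to y → x ≡ y) →
          (∀ x y → d x y ≡ 1 → adjV (to x) (to y) ≡ true) → (∀ x y → adjV (to x) (to y) ≡ true → d x y ≡ 1) → IsoD S V adjV
  mkIso to from h inj f g = isoD (mk↔ₛ′ to from h (λ x → inj (h (to x))))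
    (λ x y → bool-ext (λ e → f x y (≡ᵇ-true e)) (λ e → true-≡ᵇ (g x y e)))

least : ∀ {P : ℕ → Set} (P? : ∀ i → Dec (P i)) N → P N → ∃[ m ] (P m × ∀ j → j < m → ¬ P j)
least P? zero h = 0 , h , λ _ ()
least {P} P? (suc N) h with P? 0
... | yes p = 0 , p , λ _ ()
... | no ¬p with least (λ i → P? (suc i)) N h
... | m , q , r = suc m , q , λ { zero _ → ¬p ; (suc j) (s≤s lt) → r j lt }

module Cycle {n : ℕ} (S : Scheme n) (k≡2 : Scheme.B S 0 ≡ 2) (o o′ : Fin n) (oo′ : Scheme.d S o o′ ≡ 1) where

  open Scheme S

  degree : ∀ y → # (at? 1 y) ≡ 2
  degree y = trans (#-cong (at? 1 y) (at? 1 y ∩? at? 1 y) (λ _ p → p , p) (λ _ → proj₁)) (trans (B-spec 0 (d-refl y)) k≡2)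

  -- A directed edge: with valency 2 it determines the walk that never turns back.
  State : Set
  State = ∃[ x ] ∃[ y ] d x y ≡ 1

  next : State → State
  next (x , y , e) = y , z , proj₁ (proj₂ other)
    where
    other = #-two (at? 1 y) (subst (1 <_) (sym (degree y)) ≤-refl) x (sy e)
    z = proj₁ other

  next≢ : ∀ s → ¬ proj₁ (proj₂ (next s)) ≡ proj₁ s
  next≢ (x , y , e) = proj₂ (proj₂ (#-two (at? 1 y) (subst (1 <_) (sym (degree y)) ≤-refl) x (sy e)))

  two-neighbours : ∀ {y p q z} → d y p ≡ 1 → d y q ≡ 1 → ¬ q ≡ p → d y z ≡ 1 → z ≡ p ⊎ z ≡ q
  two-neighbours {y} {p} {q} {z} h h′ ne e with z F.≟ p
  ... | yes t = inj₁ t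
  ... | no t  = inj₂ (#-unique (λ z → at? 1 y z ×-dec ¬? (z F.≟ p)) (≤-reflexive (suc-injective (trans (sym (#-remove (at? 1 y) p h)) (degree y))))
      (e , t) (h′ , ne))

  state : ℕ → State
  state zero    = o , o′ , oo′
  state (suc i) = next (state i)

  v : ℕ → Fin n
  v i = proj₁ (state i)

  v-adj : ∀ i → d (v i) (v (suc i)) ≡ 1
  v-adj i = proj₂ (proj₂ (state i))

  v-turn : ∀ i → ¬ v (suc (suc i)) ≡ v i
  v-turn i = next≢ (state i)

  v-nbr : ∀ i {z} → d (v (suc i)) z ≡ 1 → z ≡ v i ⊎ z ≡ v (suc (suc i))
  v-nbr i = two-neighbours (sy (v-adj i)) (v-adj (suc i)) (v-turn i)

  Repeat : ℕ → Set
  Repeat j = ∃[ i ] (i < j × v i ≡ v j)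

  repeat? : ∀ j → Dec (Repeat j)
  repeat? j = anyUpTo? (λ i → v i F.≟ v j) j

  some-repeat : ∃[ j ] Repeat j
  some-repeat with FP.pigeonhole {m = n} ≤-refl (λ i → v (toℕ i))
  ... | i , j , lt , e = toℕ j , toℕ i , lt , e

  first = least repeat? (proj₁ some-repeat) (proj₂ some-repeat)

  m : ℕ
  m = proj₁ first

  distinct : ∀ {i j} → i < j → j < m → ¬ v i ≡ v j
  distinct lt lt′ e = proj₂ (proj₂ first) _ lt′ (_ , lt , e)

  -- If the first repetition hit an inner vertex, the preceding vertex of the walk would be one of
  -- the two known neighbours of that vertex, and the repetition would come earlier.
  returns : ∀ j → (∀ i → i < j → ¬ Repeat i) → Repeat j → v 0 ≡ v j
  returns j h (zero , lt , e) = e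
  returns (suc j) h (suc i , s≤s lt , e) with v-nbr i {v j} (trans (cong (λ t → d t (v j)) e) (sy (v-adj j)))
  ... | inj₁ q = ⊥-elim (h j ≤-refl (i , lt , sym q))
  ... | inj₂ q with suc (suc i) ≟ j
  ...   | yes refl = ⊥-elim (v-turn (suc i) (sym e))
  ...   | no ne with m≤n⇒m<n∨m≡n lt
  ...     | inj₁ lt′ = ⊥-elim (h j ≤-refl (suc (suc i) , ≤∧≢⇒< lt′ ne , sym q))
  ...     | inj₂ refl = ⊥-elim (d≢ (v-adj (suc i)) e)

  v0≡vm : v 0 ≡ v m
  v0≡vm = returns m (proj₂ (proj₂ first)) (proj₁ (proj₂ first))

  3≤m : 3 ≤ m
  3≤m = go m (proj₁ (proj₂ first)) v0≡vm
    where
    go : ∀ m → Repeat m → v 0 ≡ v m → 3 ≤ m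
    go 0 (_ , () , _) _
    go 1 _ e = ⊥-elim (d≢ (v-adj 0) e)
    go 2 _ e = ⊥-elim (v-turn 0 (sym e))
    go (suc (suc (suc _))) _ _ = s≤s (s≤s (s≤s z≤n))

  m′ : ℕ
  m′ = pred m

  m≡ : m ≡ suc m′
  m≡ = sym (suc-pred m {{>-nonZero (≤-trans (s≤s z≤n) 3≤m)}})

  succ : ℕ → ℕ
  succ i = suc i % suc m′

  v-succ : ∀ {i} → i < suc m′ → succ i < suc m′ × v (succ i) ≡ v (suc i)
  v-succ {i} (s≤s lt) with m≤n⇒m<n∨m≡n lt
  ... | inj₁ lt′ = subst (_< suc m′) (sym e) (s≤s lt′) , cong v e
    where
    e : succ i ≡ suc i
    e = m<n⇒m%n≡m (s≤s lt′)
  ... | inj₂ refl = subst (_< suc m′) (sym e) (s≤s z≤n) , trans (cong v e) (trans v0≡vm (cong v m≡))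
    where
    e : succ m′ ≡ 0
    e = n%n≡0 (suc m′)

  distinct′ : ∀ {i j} → i < suc m′ → j < suc m′ → v i ≡ v j → i ≡ j
  distinct′ {i} {j} p q e with <-cmp i j
  ... | tri≈ _ t _ = t
  ... | tri< t _ _ = ⊥-elim (distinct t (subst (j <_) (sym m≡) q) e)
  ... | tri> _ _ t = ⊥-elim (distinct t (subst (i <_) (sym m≡) p) (sym e))

  nbr-index : ∀ {i z} → i < suc m′ → d (v i) z ≡ 1 → ∃[ j ] (j < suc m′ × z ≡ v j × (j ≡ succ i ⊎ i ≡ succ j))
  nbr-index {suc i} {z} p e with v-nbr i e
  ... | inj₁ q = i , ≤-trans (n≤1+n (suc i)) p , q , inj₂ (sym (m<n⇒m%n≡m p))
  ... | inj₂ q = succ (suc i) , proj₁ (v-succ p) , trans q (sym (proj₂ (v-succ p))) , inj₁ refl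
  nbr-index {zero} {z} p e with two-neighbours (v-adj 0) (subst (λ t → d t (v m′) ≡ 1) (sym (trans v0≡vm (cong v m≡))) (sy (v-adj m′))) ne e
    where
    ne : ¬ v m′ ≡ v 1
    ne q = <⇒≢ (≤-pred (subst (3 ≤_) m≡ 3≤m)) (sym (distinct′ ≤-refl (s≤s (≤-trans (s≤s z≤n) (≤-pred (subst (3 ≤_) m≡ 3≤m)))) q))
  ... | inj₁ q = succ 0 , proj₁ (v-succ {0} (s≤s z≤n)) , trans q (sym (proj₂ (v-succ {0} (s≤s z≤n)))) , inj₁ refl
  ... | inj₂ q = m′ , ≤-refl , q , inj₂ (sym (n%n≡0 (suc m′)))

  -- The closed walk contains both neighbours of each of its vertices, so induction on the distance
  -- from `o` reaches everything.
  reached : ∀ i z → d o z ≡ i → ∃[ j ] (j < suc m′ × z ≡ v j)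
  reached zero z h = 0 , s≤s z≤n , sym (d-zero h)
  reached (suc i) z h with d-pred h
  ... | u , e , p with reached i u p
  ... | j , lt , refl with nbr-index lt e
  ... | j′ , lt′ , q , _ = j′ , lt′ , q

  position : ∀ z → ∃[ j ] (j < suc m′ × z ≡ v j)
  position z = reached (d o z) z refl

  pos : Fin n → Fin (suc m′)
  pos z = fromℕ< (proj₁ (proj₂ (position z)))

  v-pos : ∀ z → v (toℕ (pos z)) ≡ z
  v-pos z = trans (cong v (FP.toℕ-fromℕ< (proj₁ (proj₂ (position z))))) (sym (proj₂ (proj₂ (position z))))

  pos-v : ∀ (i : Fin (suc m′)) → pos (v (toℕ i)) ≡ i
  pos-v i = FP.toℕ-injective (distinct′ (FP.toℕ<n (pos (v (toℕ i)))) (FP.toℕ<n i) (v-pos (v (toℕ i))))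

  adj⇒cycle : ∀ x y → d x y ≡ 1 → cycleAdj (suc m′) (pos x) (pos y) ≡ true
  adj⇒cycle x y e with nbr-index (FP.toℕ<n (pos x)) (subst₂ (λ s t → d s t ≡ 1) (sym (v-pos x)) (sym (v-pos y)) e)
  ... | j , lt , q , r with distinct′ (FP.toℕ<n (pos y)) lt q
  ... | refl with r
  ... | inj₁ t = ∨-trueˡ (true-≡ᵇ t)
  ... | inj₂ t = ∨-trueʳ {toℕ (pos y) ≡ᵇ succ (toℕ (pos x))} (true-≡ᵇ t)

  cycle⇒adj : ∀ x y → cycleAdj (suc m′) (pos x) (pos y) ≡ true → d x y ≡ 1
  cycle⇒adj x y h with toℕ (pos y) ≡ᵇ succ (toℕ (pos x)) in eq
  ... | true  = step x y (≡ᵇ-true eq)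
    where
    step : ∀ x y → toℕ (pos y) ≡ succ (toℕ (pos x)) → d x y ≡ 1
    step x y e = subst₂ (λ s t → d s t ≡ 1) (v-pos x) (trans (sym (proj₂ (v-succ (FP.toℕ<n (pos x))))) (trans (cong v (sym e)) (v-pos y))) (v-adj
        (toℕ (pos x)))
  ... | false = sy (step y x (≡ᵇ-true h))
    where
    step : ∀ x y → toℕ (pos y) ≡ succ (toℕ (pos x)) → d x y ≡ 1
    step x y e = subst₂ (λ s t → d s t ≡ 1) (v-pos x) (trans (sym (proj₂ (v-succ (FP.toℕ<n (pos x))))) (trans (cong v (sym e)) (v-pos y))) (v-adj
        (toℕ (pos x)))

  polygon : ∃[ m ] (3 ≤ m × IsoD S (Fin m) (cycleAdj m))
  polygon = suc m′ , subst (3 ≤_) m≡ 3≤m , mkIso S (cycleAdj (suc m′)) pos (λ i → v (toℕ i)) pos-v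
    (λ {x} {y} e → trans (sym (v-pos x)) (trans (cong (λ t → v (toℕ t)) e) (v-pos y))) adj⇒cycle cycle⇒adj

-- The 4-cube

allF : ∀ {m} → (Fin m → Bool) → Bool
allF {zero}  p = true
allF {suc m} p = p zero ∧ allF (λ i → p (suc i))

allF-sound : ∀ {m} (p : Fin m → Bool) → allF p ≡ true → ∀ i → p i ≡ true
allF-sound p h zero    = proj₁ (∧-true h)
allF-sound p h (suc i) = allF-sound (λ i → p (suc i)) (proj₂ (∧-true {p zero} h)) i

eqB : Bool → Bool → Bool
eqB true  b = b
eqB false b = not b

eqB-sound : ∀ {a b} → eqB a b ≡ true → a ≡ b
eqB-sound {true}  {true}  _ = refl
eqB-sound {false} {false} _ = refl

finEq : ∀ {m} → Fin m → Fin m → Bool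
finEq i j = toℕ i ≡ᵇ toℕ j

finEq-sound : ∀ {m} {i j : Fin m} → finEq i j ≡ true → i ≡ j
finEq-sound h = FP.toℕ-injective (≡ᵇ-true h)

finEq-refl : ∀ {m} (i : Fin m) → finEq i i ≡ true
finEq-refl i = true-≡ᵇ {toℕ i} refl

allF-complete : ∀ {m} (p : Fin m → Bool) → (∀ i → p i ≡ true) → allF p ≡ true
allF-complete {zero} p h = refl
allF-complete {suc m} p h = cong₂ _∧_ (h zero) (allF-complete (λ i → p (suc i)) (λ i → h (suc i)))

eqB-complete : ∀ {a b} → a ≡ b → eqB a b ≡ true
eqB-complete {true}  refl = refl
eqB-complete {false} refl = refl

-- Boolean quantifiers over a finite set of labels: statements about adjacency tables become
-- equations that hold by computation.
record Finite (A : Set) : Set where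
  field
    all       : (A → Bool) → Bool
    sound     : ∀ p → all p ≡ true → ∀ x → p x ≡ true
    complete  : ∀ p → (∀ x → p x ≡ true) → all p ≡ true
    eq        : A → A → Bool
    eq-sound  : ∀ {x y} → eq x y ≡ true → x ≡ y

  all₂ : (A → A → Bool) → Bool
  all₂ p = all (λ x → all (p x))

  sound₂ : ∀ p → all₂ p ≡ true → ∀ x y → p x y ≡ true
  sound₂ p h x = sound (p x) (sound (λ x → all (p x)) h x)

  separated : (A → A → Bool) → A → A → Bool
  separated r x y = eq x y ∨ not (all (λ z → eqB (r x z) (r y z)))

  no-twins : ∀ r → all₂ (separated r) ≡ true → ∀ x y → (∀ z → r x z ≡ r y z) → x ≡ y
  no-twins r h x y same with eq x y in e
  ... | true  = eq-sound e
  ... | false = contradiction (trans (sym (sound₂ (separated r) h x y)) (cong₂ (λ s t → s ∨ not t) e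
                  (complete (λ z → eqB (r x z) (r y z)) (λ z → eqB-complete (same z))))) λ ()

dist≡ᵇ1-true : ∀ {m} → m ≡ 1 → true ≡ (m ≡ᵇ 1)
dist≡ᵇ1-true refl = refl

dist≡ᵇ1-false : ∀ {m} → ¬ m ≡ 1 → (m ≡ᵇ 1) ≡ false
dist≡ᵇ1-false {m} h with m ≡ᵇ 1 in eq
... | true  = ⊥-elim (h (≡ᵇ-true eq))
... | false = refl

#-three : ∀ {n} {P : Fin n → Set} (P? : Pred? P) {x y z} → P x → P y → P z → ¬ x ≡ y → ¬ x ≡ z → ¬ y ≡ z → 3 ≤ # P?
#-three P? {x} {y} {z} p q r ne₁ ne₂ ne₃ = subst (3 ≤_) (sym (trans (#-remove P? x p) (cong suc (#-remove _ y (q , λ e → ne₁ (sym e))))))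
  (s≤s (s≤s (#-pos _ z ((r , λ e → ne₂ (sym e)) , λ e → ne₃ (sym e)))))

module _ {n} (S : Scheme n) {V : Set} (adjV : V → V → Bool) {Code : Set} (φ : Code → V) (φ⁻ : V → Code) where

  open Scheme S

  -- A labelling that covers all vertices and preserves adjacency is an isomorphism if the target graph has no twins.
  iso-from-codes : (∀ v → φ (φ⁻ v) ≡ v) → (∀ c → φ⁻ (φ c) ≡ c) → (ψ : Code → Fin n) → (∀ v → ∃[ c ] ψ c ≡ v) →
    (∀ c c′ → (d (ψ c) (ψ c′) ≡ᵇ 1) ≡ adjV (φ c) (φ c′)) →
    (∀ c c′ → (∀ c″ → adjV (φ c) (φ c″) ≡ adjV (φ c′) (φ c″)) → c ≡ c′) → IsoD S V adjV
  iso-from-codes φφ⁻ φ⁻φ ψ cover adj twin-free = mkIso S adjV to from to-from inj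
      (λ x y e → trans (sym (adj (code x) (code y))) (trans (cong₂ (λ s t → d s t ≡ᵇ 1) (ψ-code x) (ψ-code y)) (true-≡ᵇ e)))
      (λ x y h → ≡ᵇ-true (trans (sym (cong₂ (λ s t → d s t ≡ᵇ 1) (ψ-code x) (ψ-code y))) (trans (adj (code x) (code y)) h)))
    where
    code : Fin n → Code
    code v = proj₁ (cover v)
    ψ-code : ∀ v → ψ (code v) ≡ v
    ψ-code v = proj₂ (cover v)
    to : Fin n → V
    to v = φ (code v)
    from : V → Fin n
    from w = ψ (φ⁻ w)
    ψ-inj : ∀ {c c′} → ψ c ≡ ψ c′ → c ≡ c′
    ψ-inj {c} {c′} e = twin-free c c′ (λ c″ → trans (sym (adj c c″)) (trans (cong (λ t → d t (ψ c″) ≡ᵇ 1) e) (adj c′ c″)))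
    to-from : ∀ w → to (from w) ≡ w
    to-from w = trans (cong φ (ψ-inj (ψ-code (from w)))) (φφ⁻ w)
    inj : ∀ {x y} → to x ≡ to y → x ≡ y
    inj {x} {y} e = trans (sym (ψ-code x)) (trans (cong ψ (trans (sym (φ⁻φ (code x))) (trans (cong φ⁻ e) (φ⁻φ (code y))))) (ψ-code y))

-- The six 2-subsets of a 4-set in lexicographic order, used for Γ₂ in the cube and in J(7,3).
fst₄ snd₄ : Fin 6 → Fin 4
fst₄ zero = zero
fst₄ (suc zero) = zero
fst₄ (suc (suc zero)) = zero
fst₄ (suc (suc (suc zero))) = suc zero
fst₄ (suc (suc (suc (suc zero)))) = suc zero
fst₄ (suc (suc (suc (suc (suc zero))))) = suc (suc zero)
snd₄ zero = suc zero
snd₄ (suc zero) = suc (suc zero)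
snd₄ (suc (suc zero)) = suc (suc (suc zero))
snd₄ (suc (suc (suc zero))) = suc (suc zero)
snd₄ (suc (suc (suc (suc zero)))) = suc (suc (suc zero))
snd₄ (suc (suc (suc (suc (suc zero))))) = suc (suc (suc zero))

mem : Fin 4 → Fin 6 → Bool
mem i p = finEq i (fst₄ p) ∨ finEq i (snd₄ p)

find-pair : (i j : Fin 4) → ¬ i ≡ j → ∃[ p ] ((fst₄ p ≡ i × snd₄ p ≡ j) ⊎ (fst₄ p ≡ j × snd₄ p ≡ i))
find-pair i j ne = [ (λ e → ⊥-elim (ne e)) , (λ h → h) ]′ (table i j)
  where
  table? = FP.all? (λ i → FP.all? (λ j → (i F.≟ j) ⊎-dec FP.any? (λ p → ((fst₄ p F.≟ i) ×-dec (snd₄ p F.≟ j)) ⊎-dec ((fst₄ p F.≟ j) ×-dec (snd₄ p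
      F.≟ i)))))
  table : ∀ i j → i ≡ j ⊎ (∃[ p ] ((fst₄ p ≡ i × snd₄ p ≡ j) ⊎ (fst₄ p ≡ j × snd₄ p ≡ i)))
  table = toWitness {a? = table?} tt

fst≢snd : ∀ p → ¬ fst₄ p ≡ snd₄ p
fst≢snd p e = contradiction (trans (sym (allF-sound (λ p → not (finEq (fst₄ p) (snd₄ p))) refl p)) (cong not (trans (cong (finEq (fst₄ p)) (sym e))
    (finEq-refl (fst₄ p))))) λ ()

mem-true : ∀ {i p} → mem i p ≡ true → i ≡ fst₄ p ⊎ i ≡ snd₄ p
mem-true {i} {p} h with finEq i (fst₄ p) in e
... | true  = inj₁ (finEq-sound e)
... | false = inj₂ (finEq-sound h)

mem-false : ∀ {i p} → mem i p ≡ false → ¬ i ≡ fst₄ p × ¬ i ≡ snd₄ p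
mem-false {i} {p} h = (λ { refl → contradiction (trans (sym h) (cong (_∨ finEq (fst₄ p) (snd₄ p)) (finEq-refl (fst₄ p)))) λ () })
  , (λ { refl → contradiction (trans (sym h) (∨-r (finEq (snd₄ p) (fst₄ p)) (finEq-refl (snd₄ p)))) λ () })
  where
  ∨-r : ∀ a {b} → b ≡ true → a ∨ b ≡ true
  ∨-r true  _ = refl
  ∨-r false h = h

-- The vectors sorted by weight, which is their distance from the zero vector; `c₃ i` is the vector
-- whose only zero is at i.
data Code₄ : Set where
  c₀ : Code₄
  c₁ : Fin 4 → Code₄
  c₂ : Fin 6 → Code₄
  c₃ : Fin 4 → Code₄
  c₄ : Code₄

module _ where

  open import Data.Vec using ([]; _∷_)

  bits : (Fin 4 → Bool) → Vec Bool 4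
  bits p = p zero ∷ p (suc zero) ∷ p (suc (suc zero)) ∷ p (suc (suc (suc zero))) ∷ []

  φ₄ : Code₄ → Vec Bool 4
  φ₄ c₀ = bits (λ _ → false)
  φ₄ (c₁ i) = bits (finEq i)
  φ₄ (c₂ p) = bits (λ i → mem i p)
  φ₄ (c₃ i) = bits (λ j → not (finEq i j))
  φ₄ c₄ = bits (λ _ → true)

  φ₄⁻ : Vec Bool 4 → Code₄
  φ₄⁻ (false ∷ false ∷ false ∷ false ∷ []) = c₀
  φ₄⁻ (true ∷ false ∷ false ∷ false ∷ []) = c₁ zero
  φ₄⁻ (false ∷ true ∷ false ∷ false ∷ []) = c₁ (suc zero)
  φ₄⁻ (false ∷ false ∷ true ∷ false ∷ []) = c₁ (suc (suc zero))
  φ₄⁻ (false ∷ false ∷ false ∷ true ∷ []) = c₁ (suc (suc (suc zero)))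
  φ₄⁻ (true ∷ true ∷ false ∷ false ∷ []) = c₂ zero
  φ₄⁻ (true ∷ false ∷ true ∷ false ∷ []) = c₂ (suc zero)
  φ₄⁻ (true ∷ false ∷ false ∷ true ∷ []) = c₂ (suc (suc zero))
  φ₄⁻ (false ∷ true ∷ true ∷ false ∷ []) = c₂ (suc (suc (suc zero)))
  φ₄⁻ (false ∷ true ∷ false ∷ true ∷ []) = c₂ (suc (suc (suc (suc zero))))
  φ₄⁻ (false ∷ false ∷ true ∷ true ∷ []) = c₂ (suc (suc (suc (suc (suc zero)))))
  φ₄⁻ (false ∷ true ∷ true ∷ true ∷ []) = c₃ zero
  φ₄⁻ (true ∷ false ∷ true ∷ true ∷ []) = c₃ (suc zero)
  φ₄⁻ (true ∷ true ∷ false ∷ true ∷ []) = c₃ (suc (suc zero))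
  φ₄⁻ (true ∷ true ∷ true ∷ false ∷ []) = c₃ (suc (suc (suc zero)))
  φ₄⁻ (true ∷ true ∷ true ∷ true ∷ []) = c₄

  allV : ∀ {m} → (Vec Bool m → Bool) → Bool
  allV {zero}  p = p []
  allV {suc m} p = allV (λ v → p (true ∷ v)) ∧ allV (λ v → p (false ∷ v))

  allV-sound : ∀ {m} (p : Vec Bool m → Bool) → allV p ≡ true → ∀ v → p v ≡ true
  allV-sound p h [] = h
  allV-sound p h (true ∷ v)  = allV-sound (λ v → p (true ∷ v)) (proj₁ (∧-true {allV (λ v → p (true ∷ v))} h)) v
  allV-sound p h (false ∷ v) = allV-sound (λ v → p (false ∷ v)) (proj₂ (∧-true {allV (λ v → p (true ∷ v))} h)) v

  eqV : ∀ {m} → Vec Bool m → Vec Bool m → Bool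
  eqV [] [] = true
  eqV (a ∷ u) (b ∷ v) = eqB a b ∧ eqV u v

  eqV-sound : ∀ {m} {u v : Vec Bool m} → eqV u v ≡ true → u ≡ v
  eqV-sound {u = []} {[]} _ = refl
  eqV-sound {u = a ∷ u} {b ∷ v} h = cong₂ _∷_ (eqB-sound (proj₁ (∧-true {eqB a b} h))) (eqV-sound (proj₂ (∧-true {eqB a b} h)))

  φ₄φ₄⁻ : ∀ v → φ₄ (φ₄⁻ v) ≡ v
  φ₄φ₄⁻ v = eqV-sound (allV-sound (λ v → eqV (φ₄ (φ₄⁻ v)) v) refl v)

eqC₄ : Code₄ → Code₄ → Bool
eqC₄ c₀ c₀ = true
eqC₄ (c₁ i) (c₁ j) = finEq i j
eqC₄ (c₂ i) (c₂ j) = finEq i j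
eqC₄ (c₃ i) (c₃ j) = finEq i j
eqC₄ c₄ c₄ = true
eqC₄ _ _ = false

eqC₄-sound : ∀ {c c′} → eqC₄ c c′ ≡ true → c ≡ c′
eqC₄-sound {c₀} {c₀} _ = refl
eqC₄-sound {c₁ i} {c₁ j} h = cong c₁ (finEq-sound h)
eqC₄-sound {c₂ i} {c₂ j} h = cong c₂ (finEq-sound h)
eqC₄-sound {c₃ i} {c₃ j} h = cong c₃ (finEq-sound h)
eqC₄-sound {c₄} {c₄} _ = refl

allC₄ : (Code₄ → Bool) → Bool
allC₄ p = p c₀ ∧ (allF (λ i → p (c₁ i)) ∧ (allF (λ i → p (c₂ i)) ∧ (allF (λ i → p (c₃ i)) ∧ p c₄)))

finite₄ : Finite Code₄
finite₄ = record { all = allC₄ ; sound = snd ; complete = complete ; eq = eqC₄ ; eq-sound = eqC₄-sound }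
  where
  snd : ∀ p → allC₄ p ≡ true → ∀ c → p c ≡ true
  snd p h c with ∧-true {p c₀} h
  ... | h₀ , t₁ with ∧-true {allF (λ i → p (c₁ i))} t₁
  ... | h₁ , t₂ with ∧-true {allF (λ i → p (c₂ i))} t₂
  ... | h₂ , t₃ with ∧-true {allF (λ i → p (c₃ i))} t₃
  ... | h₃ , h₄ with c
  ... | c₀ = h₀
  ... | c₁ i = allF-sound (λ i → p (c₁ i)) h₁ i
  ... | c₂ i = allF-sound (λ i → p (c₂ i)) h₂ i
  ... | c₃ i = allF-sound (λ i → p (c₃ i)) h₃ i
  ... | c₄ = h₄
  complete : ∀ p → (∀ c → p c ≡ true) → allC₄ p ≡ true
  complete p h = cong₂ _∧_ (h c₀) (cong₂ _∧_ (allF-complete (λ i → p (c₁ i)) (λ i → h (c₁ i))) (cong₂ _∧_ (allF-complete (λ i → p (c₂ i)) (λ i →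
      h (c₂ i)))
    (cong₂ _∧_ (allF-complete (λ i → p (c₃ i)) (λ i → h (c₃ i))) (h c₄))))

adj₄ : Code₄ → Code₄ → Bool
adj₄ c c′ = Cube4-adj (φ₄ c) (φ₄ c′)

φ₄⁻φ₄ : ∀ c → φ₄⁻ (φ₄ c) ≡ c
φ₄⁻φ₄ c = eqC₄-sound (Finite.sound finite₄ (λ c → eqC₄ (φ₄⁻ (φ₄ c)) c) refl c)

rule₄ : Code₄ → Code₄ → Bool
rule₄ c₀ (c₁ _) = true
rule₄ (c₁ _) c₀ = true
rule₄ (c₁ i) (c₂ p) = mem i p
rule₄ (c₂ p) (c₁ i) = mem i p
rule₄ (c₂ p) (c₃ i) = not (mem i p)
rule₄ (c₃ i) (c₂ p) = not (mem i p)
rule₄ (c₃ _) c₄ = true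
rule₄ c₄ (c₃ _) = true
rule₄ _ _ = false

rule₄-adj : ∀ c c′ → rule₄ c c′ ≡ adj₄ c c′
rule₄-adj c c′ = eqB-sound (Finite.sound₂ finite₄ (λ c c′ → eqB (rule₄ c c′) (adj₄ c c′)) refl c c′)

twins₄ : ∀ c c′ → (∀ c″ → adj₄ c c″ ≡ adj₄ c′ c″) → c ≡ c′
twins₄ = Finite.no-twins finite₄ adj₄ refl

module Cube {n : ℕ} (T : Setting n) (a≡0 : Setting.a T ≡ 0) (c<b : Local.c (Setting.S T) (Setting.a T) (Setting.hk T) < Local.b (Setting.S T)
    (Setting.a T) (Setting.hk T))
  (A : TriangleFree.CubeArray T a≡0 c<b) where

  open Small T
  open TriangleFree T a≡0 c<b using (k≡; flat₁; module CubeArray)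
  open CubeArray A

  k-is-4 : k ≡ 4
  k-is-4 = trans k≡ (cong suc b≡3)

  module At (o t : Fin n) (ot : d o t ≡ 4) (E : Enumeration (at 1 o) 4) where

    open Enumeration E renaming (el to e; prop to oe; inj to e-inj; sur to e-sur)

    e-apart : ∀ {i j} → ¬ i ≡ j → d (e i) (e j) ≡ 2
    e-apart {i} {j} ne with local (oe i) (oe j) (λ q → ne (e-inj q))
    ... | inj₁ q = ⊥-elim (flat₁ (oe i) (oe j) q)
    ... | inj₂ q = q

    -- Without triangles α = 0, so s = 2, and s + ν = 3 leaves ν = 1. This is what lets a pair of
    -- neighbours of o name a vertex of Γ₂(o).
    ν≡1 : ∀ {i j} → ¬ i ≡ j → ν o (e i) (e j) ≡ 1
    ν≡1 {i} {j} ne = arith (s o (e i) (e j)) (ν o (e i) (e j)) (α o (e i) (e j)) a b c b≡3 c≡2 a≡0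
        (s-nonadj (oe i) (oe j) (e-apart ne)) (sν-nonadj (oe i) (oe j) (e-apart ne)) α≡0
      where
      α≡0 : α o (e i) (e j) ≡ 0
      α≡0 = #-0 (at? 1 o ∩? at? 1 (e i) ∩? at? 1 (e j)) (λ z (p , q , _) → flat₁ (oe i) p q)
      arith : ∀ s v al a b c → b ≡ 3 → c ≡ 2 → a ≡ 0 → suc (s + a) ≡ b + al → s + v + (a + 2) ≡ b + c → al ≡ 0 → v ≡ 1
      arith s v _ _ _ _ refl refl refl p q refl with trans (sym (+-identityʳ s)) (suc-injective p)
      ... | refl = +-cancelʳ-≡ 2 v 1 (suc-injective (suc-injective q))

    opaque

      pair-vertex : ∀ i j → ¬ i ≡ j → ∃[ x ] (d o x ≡ 2 × d (e i) x ≡ 1 × d (e j) x ≡ 1)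
      pair-vertex i j ne = #-∃ (at? 2 o ∩? at? 1 (e i) ∩? at? 1 (e j)) (subst (0 <_) (sym (ν≡1 ne)) (s≤s z≤n))

    pair-unique : ∀ {i j x x′} → ¬ i ≡ j → d o x ≡ 2 → d (e i) x ≡ 1 → d (e j) x ≡ 1 → d o x′ ≡ 2 → d (e i) x′ ≡ 1 → d (e j) x′ ≡ 1 → x ≡ x′
    pair-unique {i} {j} ne p q r p′ q′ r′ = #-unique (at? 2 o ∩? at? 1 (e i) ∩? at? 1 (e j)) (≤-reflexive (ν≡1 ne)) (p , q , r) (p′ , q′ , r′)

    X : Fin 6 → Fin n
    X p = proj₁ (pair-vertex (fst₄ p) (snd₄ p) (fst≢snd p))
    oX : ∀ p → d o (X p) ≡ 2
    oX p = proj₁ (proj₂ (pair-vertex (fst₄ p) (snd₄ p) (fst≢snd p)))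
    eX : ∀ {i p} → mem i p ≡ true → d (e i) (X p) ≡ 1
    eX {i} {p} h with mem-true {i} {p} h
    ... | inj₁ refl = proj₁ (proj₂ (proj₂ (pair-vertex (fst₄ p) (snd₄ p) (fst≢snd p))))
    ... | inj₂ refl = proj₂ (proj₂ (proj₂ (pair-vertex (fst₄ p) (snd₄ p) (fst≢snd p))))

    fst-mem : ∀ p → mem (fst₄ p) p ≡ true
    fst-mem p = cong (_∨ finEq (fst₄ p) (snd₄ p)) (finEq-refl (fst₄ p))
    snd-mem : ∀ p → mem (snd₄ p) p ≡ true
    snd-mem p with mem (snd₄ p) p in q
    ... | true = refl
    ... | false = ⊥-elim (proj₂ (mem-false {snd₄ p} {p} q) refl)

    e≁X : ∀ {i p} → mem i p ≡ false → ¬ d (e i) (X p) ≡ 1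
    e≁X {i} {p} h q = contradiction (≤-trans (#-three (at? 1 (X p) ∩? at? 1 o) {e i} {e (fst₄ p)} {e (snd₄ p)} (sy q , oe i)
        (sy (eX {fst₄ p} {p} (fst-mem p)) , oe (fst₄ p)) (sy (eX {snd₄ p} {p} (snd-mem p)) , oe (snd₄ p))
        (λ t → proj₁ (mem-false {i} {p} h) (e-inj t)) (λ t → proj₂ (mem-false {i} {p} h) (e-inj t)) (λ t → fst≢snd p (e-inj t)))
      (≤-reflexive (trans (codeg₂ (oX p)) c≡2))) λ { (s≤s (s≤s ())) }

    X-cover : ∀ x → d o x ≡ 2 → ∃[ p ] X p ≡ x
    X-cover x h = go (#-∃ (at? 1 x ∩? at? 1 o) (subst (0 <_) (sym two) (s≤s z≤n)))
      where
      two : # (at? 1 x ∩? at? 1 o) ≡ 2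
      two = trans (codeg₂ h) c≡2
      go : ∃[ z ] (d x z ≡ 1 × d o z ≡ 1) → ∃[ p ] X p ≡ x
      go (z , q , r) = go′ (#-two (at? 1 x ∩? at? 1 o) (subst (1 <_) (sym two) ≤-refl) z (q , r))
        where
        from-pair : ∀ i j → ¬ i ≡ j → d x (e i) ≡ 1 → d x (e j) ≡ 1 → ∃[ p ] ((fst₄ p ≡ i × snd₄ p ≡ j) ⊎ (fst₄ p ≡ j × snd₄ p ≡ i)) → ∃[ p ] X p ≡ x
        from-pair _ _ ne u v (p , inj₁ (refl , refl)) = p , pair-unique (fst≢snd p) (oX p) (eX {fst₄ p} {p} (fst-mem p)) (eX {snd₄ p} {p} (snd-mem
            p)) h (sy u) (sy v)
        from-pair _ _ ne u v (p , inj₂ (refl , refl)) = p , pair-unique (fst≢snd p) (oX p) (eX {fst₄ p} {p} (fst-mem p)) (eX {snd₄ p} {p} (snd-mem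
            p)) h (sy v) (sy u)
        named : ∃[ i ] e i ≡ z → ∀ z′ → d x z′ ≡ 1 → ¬ z′ ≡ z → ∃[ j ] e j ≡ z′ → ∃[ p ] X p ≡ x
        named (i , refl) _ q′ ne (j , refl) = from-pair i j (λ { refl → ne refl }) q q′ (find-pair i j (λ { refl → ne refl }))
        go′ : ∃[ z′ ] ((d x z′ ≡ 1 × d o z′ ≡ 1) × ¬ z′ ≡ z) → ∃[ p ] X p ≡ x
        go′ (z′ , (q′ , r′) , ne) = named (e-sur z r) z′ q′ ne (e-sur z′ r′)

    opaque

      -- Only c₃ = 3 of the four neighbours of o are at distance 2 from z; the remaining index
      -- becomes the label of z.
      missing : ∀ z → d o z ≡ 3 → ∃[ i ] ¬ d (e i) z ≡ 2
      missing z h = [ (λ r → r) , (λ none → ⊥-elim (full none)) ]′ (toSum (FP.any? (λ i → ¬? (at? 2 (e i) z))))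
        where
        all : ¬ (∃[ i ] ¬ d (e i) z ≡ 2) → ∀ u → d o u ≡ 1 → ∃[ i ] e i ≡ u → d o u ≡ 1 × d z u ≡ 2
        all none u p (i , refl) = p , sy (decidable-stable (at? 2 (e i) z) (λ q → none (i , q)))
        full : ¬ (∃[ i ] ¬ d (e i) z ≡ 2) → ⊥
        full none = contradiction (subst₂ _≤_ (trans (val o) k-is-4) (trans (C-spec 2 (sy h)) C3≡3)
            (#-mono (at? 1 o) (at? 1 o ∩? at? 2 z) (λ u p → all none u p (e-sur u p)))) λ { (s≤s (s≤s (s≤s ()))) }

    only-missing : ∀ {z i j} → d o z ≡ 3 → ¬ d (e i) z ≡ 2 → ¬ i ≡ j → d (e j) z ≡ 2
    only-missing {z} {i} {j} h m ne = decidable-stable (at? 2 (e j) z) λ q → contradiction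
        (subst₂ _≤_ (cong₂ _+_ (trans (C-spec 2 (sy h)) C3≡3) two) (trans (val o) k-is-4)
          (#-pack (at? 1 o ∩? at? 2 z) ij? (at? 1 o) (λ _ → proj₁) (λ _ → proj₁) (apart q))) λ { (s≤s (s≤s (s≤s (s≤s ())))) }
      where
      ij? = λ u → at? 1 o u ×-dec ((u F.≟ e i) ⊎-dec (u F.≟ e j))
      apart : ¬ d (e j) z ≡ 2 → ∀ u → d o u ≡ 1 × d z u ≡ 2 → d o u ≡ 1 × (u ≡ e i ⊎ u ≡ e j) → ⊥
      apart q u (_ , r) (_ , inj₁ refl) = m (sy r)
      apart q u (_ , r) (_ , inj₂ refl) = q (sy r)
      two : # ij? ≡ 2
      two = trans (#-split (λ u → u F.≟ e i) (λ u → u F.≟ e j) ij? (λ _ → proj₂) (λ { _ refl → oe i , inj₁ refl }) (λ { _ refl → oe j , inj₂ refl })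
              (λ { _ refl r → ne (e-inj r) })) (cong₂ _+_ (#-sing (e i)) (#-sing (e j)))

    -- Two distance-2 neighbourhoods inside the three neighbours of z below it overlap.
    below : ∀ {z i p} → d o z ≡ 3 → ¬ d (e i) z ≡ 2 → mem i p ≡ false → d (X p) z ≡ 1
    below {z} {i} {p} h m nm = go (#-∃ (P₁ ∩? P₂) pos)
      where
      f = fst₄ p
      g = snd₄ p
      fz : d (e f) z ≡ 2
      fz = only-missing h m (proj₁ (mem-false {i} {p} nm))
      gz : d (e g) z ≡ 2
      gz = only-missing h m (proj₂ (mem-false {i} {p} nm))
      P₁ = at? 1 z ∩? at? 1 (e f)
      P₂ = at? 1 z ∩? at? 1 (e g)
      mid : ∀ {j} → ∀ x → d z x ≡ 1 × d (e j) x ≡ 1 → d z x ≡ 1 × d o x ≡ 2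
      mid {j} x (q , r) = q , geodˡ (oe j) r (sy q) h
      pos : 0 < # (P₁ ∩? P₂)
      pos = +-cancelˡ-< 3 0 (# (P₁ ∩? P₂)) (subst₂ _≤_ (cong₂ _+_ (trans (codeg₂ fz) c≡2) (trans (codeg₂ gz) c≡2))
              (cong (_+ # (P₁ ∩? P₂)) (trans (C-spec 2 h) C3≡3)) (#-incl-excl P₁ P₂ (at? 1 z ∩? at? 2 o) mid mid))
      go : ∃[ x ] ((d z x ≡ 1 × d (e f) x ≡ 1) × (d z x ≡ 1 × d (e g) x ≡ 1)) → d (X p) z ≡ 1
      go (x , (q , r) , (_ , r′)) = subst (λ t → d t z ≡ 1)
        (pair-unique (fst≢snd p) (proj₂ (mid {f} x (q , r))) r r′ (oX p) (eX {f} {p} (fst-mem p)) (eX {g} {p} (snd-mem p))) (sy q)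

    not-below : ∀ {z i p} → d o z ≡ 3 → ¬ d (e i) z ≡ 2 → mem i p ≡ true → ¬ d (X p) z ≡ 1
    not-below {z} {i} {p} h m mm q = m (geod (oe i) (eX {i} {p} mm) q h)

    k₂≡6 : # (at? 2 o) ≡ 6
    k₂≡6 = *-cancelʳ-≡ (# (at? 2 o)) 6 2 (trans (cong (# (at? 2 o) *_) (sym c≡2)) (trans (sym (level₂ o)) (cong₂ _*_ k-is-4 b≡3)))

    k₃≡4 : # (at? 3 o) ≡ 4
    k₃≡4 = *-cancelʳ-≡ (# (at? 3 o)) 4 3 (trans (cong (# (at? 3 o) *_) (sym C3≡3)) (trans (sym (level₃ o)) (cong₂ _*_ k₂≡6 b₂≡2)))

    X-apart : ∀ {p q} → ¬ p ≡ q → ¬ X p ≡ X q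
    X-apart {p} {q} ne eq = ne (finEq-sound (check p q (λ i → trans (sym (mem-X p i)) (trans (cong (λ t → d (e i) t ≡ᵇ 1) eq) (mem-X q i)))))
      where
      mem-X : ∀ p i → (d (e i) (X p) ≡ᵇ 1) ≡ mem i p
      mem-X p i with mem i p in m
      ... | true  = sym (dist≡ᵇ1-true (eX {i} {p} m))
      ... | false = dist≡ᵇ1-false (e≁X {i} {p} m)
      check : ∀ p q → (∀ i → mem i p ≡ mem i q) → finEq p q ≡ true
      check p q h with finEq p q in t
      ... | true = refl
      ... | false = contradiction (trans (sym (allF-sound (λ q → finEq p q ∨ not (allF (λ i → eqB (mem i p) (mem i q))))
                       (allF-sound (λ p → allF (λ q → finEq p q ∨ not (allF (λ i → eqB (mem i p) (mem i q))))) refl p) q))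
                       (cong₂ (λ x y → x ∨ not y) t (allF-complete (λ i → eqB (mem i p) (mem i q)) (λ i → eqB-complete (h i))))) λ ()

    -- Two vertices missing the same eᵢ have the three X p with i ∉ p as common neighbours.
    missing-unique : ∀ {z z′ i} → d o z ≡ 3 → d o z′ ≡ 3 → ¬ d (e i) z ≡ 2 → ¬ d (e i) z′ ≡ 2 → z ≡ z′
    missing-unique {z} {z′} {i} h h′ m m′ = decide (z F.≟ z′)
      where
      avoid : ∀ i → ∃[ p ] ∃[ q ] ∃[ r ] ((mem i p ≡ false × mem i q ≡ false × mem i r ≡ false) × (¬ p ≡ q × ¬ p ≡ r × ¬ q ≡ r))
      avoid zero = suc (suc (suc zero)) , suc (suc (suc (suc zero))) , suc (suc (suc (suc (suc zero)))) , (refl , refl , refl) , ((λ ()) , (λ ()) ,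
          (λ ()))
      avoid (suc zero) = suc zero , suc (suc zero) , suc (suc (suc (suc (suc zero)))) , (refl , refl , refl) , ((λ ()) , (λ ()) , (λ ()))
      avoid (suc (suc zero)) = zero , suc (suc zero) , suc (suc (suc (suc zero))) , (refl , refl , refl) , ((λ ()) , (λ ()) , (λ ()))
      avoid (suc (suc (suc zero))) = zero , suc zero , suc (suc (suc zero)) , (refl , refl , refl) , ((λ ()) , (λ ()) , (λ ()))
      common : ∀ {u u′} → d o u ≡ 3 → d o u′ ≡ 3 → ¬ d (e i) u ≡ 2 → ¬ d (e i) u′ ≡ 2 → 3 ≤ # (at? 1 u′ ∩? at? 1 u)
      common {u} {u′} g g′ n n′ = go (avoid i)
        where
        go : ∃[ p ] ∃[ q ] ∃[ r ] ((mem i p ≡ false × mem i q ≡ false × mem i r ≡ false) × (¬ p ≡ q × ¬ p ≡ r × ¬ q ≡ r)) →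
            3 ≤ # (at? 1 u′ ∩? at? 1 u)
        go (p , q , r , (mp , mq , mr) , (pq , pr , qr)) = #-three (at? 1 u′ ∩? at? 1 u)
            (sy (below {p = p} g′ n′ mp) , sy (below {p = p} g n mp)) (sy (below {p = q} g′ n′ mq) , sy (below {p = q} g n mq)) (sy (below {p = r}
                g′ n′ mr) , sy (below {p = r} g n mr))
            (X-apart pq) (X-apart pr) (X-apart qr)
      decide : Dec (z ≡ z′) → z ≡ z′
      decide (yes eq) = eq
      decide (no ne) = ⊥-elim (go (#-∃ (at? 1 z′ ∩? at? 1 z) (≤-trans (s≤s z≤n) (common h h′ m m′))))
        where
        go : ∃[ x ] (d z′ x ≡ 1 × d z x ≡ 1) → ⊥
        go (x , q , r) with nb (sy q) (r)
        ... | inj₁ t = ne (d-zero t)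
        ... | inj₂ (inj₁ t) = flat₃ h h′ t
        ... | inj₂ (inj₂ t) = contradiction (≤-trans (common h h′ m m′) (≤-reflexive (trans (codeg₂ t) c≡2))) λ { (s≤s (s≤s ())) }

    opaque

      -- By `missing-unique` the label is injective on the four vertices of Γ₃(o), hence takes every
      -- value.
      top-cover : ∀ i → ∃[ z ] (d o z ≡ 3 × ¬ d (e i) z ≡ 2)
      top-cover = go (enumerate (at? 3 o) 4 k₃≡4)
        where
        go : Enumeration (at 3 o) 4 → ∀ i → ∃[ z ] (d o z ≡ 3 × ¬ d (e i) z ≡ 2)
        go E₃ i = el (proj₁ (onto i)) , prop (proj₁ (onto i)) , subst (λ t → ¬ d (e t) (el (proj₁ (onto i))) ≡ 2) (proj₂ (onto i)) (proj₂ (missing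
            (el (proj₁ (onto i))) (prop (proj₁ (onto i)))))
          where
          open Enumeration E₃
          miss : Fin 4 → Fin 4
          miss i = proj₁ (missing (el i) (prop i))
          onto : ∀ i → ∃[ j ] miss j ≡ i
          onto = injective⇒surjective miss (λ {i} {j} q → inj (missing-unique {i = miss i} (prop i) (prop j)
            (proj₂ (missing (el i) (prop i))) (subst (λ t → ¬ d (e t) (el j) ≡ 2) (sym q) (proj₂ (missing (el j) (prop j))))))

    Z : Fin 4 → Fin n
    Z i = proj₁ (top-cover i)
    oZ : ∀ i → d o (Z i) ≡ 3
    oZ i = proj₁ (proj₂ (top-cover i))
    Z-miss : ∀ i → ¬ d (e i) (Z i) ≡ 2
    Z-miss i = proj₂ (proj₂ (top-cover i))

    Z-cover : ∀ z → d o z ≡ 3 → ∃[ i ] Z i ≡ z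
    Z-cover z h = proj₁ (missing z h) , missing-unique {i = proj₁ (missing z h)} (oZ (proj₁ (missing z h))) h (Z-miss (proj₁ (missing z h))) (proj₂
        (missing z h))

    B3≡1 : ∀ {z} → d o z ≡ 3 → # (at? 1 z ∩? at? 4 o) ≡ 1
    B3≡1 {z} h = +-cancelˡ-≡ 3 (# (at? 1 z ∩? at? 4 o)) 1 (trans (cong (_+ # (at? 1 z ∩? at? 4 o)) (sym (trans (C-spec 2 h) C3≡3)))
      (trans (sym (#-split (at? 1 z ∩? at? 2 o) (at? 1 z ∩? at? 4 o) (at? 1 z) cov (λ _ → proj₁) (λ _ → proj₁) (λ _ p q →
          clash (proj₂ p) (proj₂ q)))) (trans (val z) k-is-4)))
      where
      cov : ∀ u → d z u ≡ 1 → _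
      cov u p with nb p h
      ... | inj₁ q = inj₁ (p , q)
      ... | inj₂ (inj₁ q) = ⊥-elim (flat₃ h q p)
      ... | inj₂ (inj₂ q) = inj₂ (p , q)

    level₄ : 4 * 1 ≡ # (at? 4 o) * C 4
    level₄ = trans (cong (_* 1) (sym k₃≡4)) (double (at? 3 o) (at? 4 o) (λ z u → d z u ≟ 1) 1 (C 4)
      (λ z h → trans (#-cong _ (at? 1 z ∩? at? 4 o) (λ _ (p , q) → q , p) (λ _ (p , q) → q , p)) (B3≡1 h))
      (λ u h → trans (#-cong _ (at? 1 u ∩? at? 3 o) (λ _ (p , q) → sy q , p) (λ _ (p , q) → q , sy p)) (C-spec 3 h)))

    3≤C4 : 3 ≤ C 4
    3≤C4 = go (down 1 3 ot)
      where
      go : ∃[ z ] (d o z ≡ 1 × d z t ≡ 3) → 3 ≤ C 4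
      go (z , p , q) = subst₂ _≤_ (trans (C-spec 2 q) C3≡3) (C-spec 3 ot)
        (#-mono (at? 1 t ∩? at? 2 z) (at? 1 t ∩? at? 3 o) (λ u (r , w) → r , geodˡ p w (sy r) ot))

    -- k₄c₄ = 4 and c₄ ≥ c₃ = 3.
    C4≡4,k₄≡1 : C 4 ≡ 4 × # (at? 4 o) ≡ 1
    C4≡4,k₄≡1 = arith (# (at? 4 o)) (C 4) 3≤C4 level₄
      where
      arith : ∀ m x → 3 ≤ x → 4 ≡ m * x → x ≡ 4 × m ≡ 1
      arith 1 x _ q = trans (sym (+-identityʳ x)) (sym q) , refl
      arith 0 x _ ()
      arith (suc (suc m)) x p q = contradiction (≤-trans (+-mono-≤ p (≤-trans p (m≤m+n x (m * x)))) (≤-reflexive (sym q))) λ { (s≤s (s≤s (s≤s (s≤s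
          ())))) }

    top-unique : ∀ {u} → d o u ≡ 4 → u ≡ t
    top-unique h = #-unique (at? 4 o) (≤-reflexive (proj₂ C4≡4,k₄≡1)) h ot

    top-adj : ∀ {z} → d o z ≡ 3 → d z t ≡ 1
    top-adj {z} h = sy (proj₁ (#-full (at? 1 t ∩? at? 3 o) (at? 3 o) (λ _ → proj₂)
      (≤-reflexive (trans k₃≡4 (sym (trans (C-spec 3 ot) (proj₁ C4≡4,k₄≡1))))) z h))

    no-five : ∀ {u} → ¬ d o u ≡ 5
    no-five {u} h = go (d-pred h)
      where
      go : ∃[ z ] (d z u ≡ 1 × d o z ≡ 4) → ⊥
      go (z , p , q) = clash (proj₂ (#-full (at? 1 z ∩? at? 3 o) (at? 1 z) (λ _ → proj₁)
        (≤-reflexive (trans (trans (val z) k-is-4) (sym (trans (C-spec 3 q) (proj₁ C4≡4,k₄≡1))))) u p)) h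

    ψ : Code₄ → Fin n
    ψ c₀ = o
    ψ (c₁ i) = e i
    ψ (c₂ p) = X p
    ψ (c₃ i) = Z i
    ψ c₄ = t

    cover : ∀ v → ∃[ c ] ψ c ≡ v
    cover v = go (d o v) refl
      where
      go : ∀ i → d o v ≡ i → ∃[ c ] ψ c ≡ v
      go 0 h = c₀ , d-zero h
      go 1 h = c₁ (proj₁ (e-sur v h)) , proj₂ (e-sur v h)
      go 2 h = c₂ (proj₁ (X-cover v h)) , proj₂ (X-cover v h)
      go 3 h = c₃ (proj₁ (Z-cover v h)) , proj₂ (Z-cover v h)
      go 4 h = c₄ , sym (top-unique h)
      go (suc (suc (suc (suc (suc i))))) h with down 5 i h
      ... | u , p , _ = ⊥-elim (no-five p)

    flip : ∀ x y → (d x y ≡ᵇ 1) ≡ (d y x ≡ᵇ 1)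
    flip x y = cong (_≡ᵇ 1) (d-sym x y)

    gap : ∀ {i j x y} → d o x ≡ i → d o y ≡ j → {_ : B.T (suc i <ᵇ j)} → (d x y ≡ᵇ 1) ≡ false
    gap {i} {j} p q {t} = dist≡ᵇ1-false λ r → <⇒≱ (<ᵇ⇒< (suc i) j t) (≤-trans (tri′ p r q) (≤-reflexive (+-comm i 1)))

    rule : ∀ c c′ → (d (ψ c) (ψ c′) ≡ᵇ 1) ≡ rule₄ c c′
    rule c₀ c₀ = cong (_≡ᵇ 1) (d-refl o)
    rule c₀ (c₁ i) = sym (dist≡ᵇ1-true (oe i))
    rule c₀ (c₂ p) = gap (d-refl o) (oX p)
    rule c₀ (c₃ i) = gap (d-refl o) (oZ i)
    rule c₀ c₄ = gap (d-refl o) ot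
    rule (c₁ i) (c₁ j) = dist≡ᵇ1-false (flat₁ (oe i) (oe j))
    rule (c₁ i) (c₂ p) with mem i p in m
    ... | true  = sym (dist≡ᵇ1-true (eX {i} {p} m))
    ... | false = dist≡ᵇ1-false (e≁X {i} {p} m)
    rule (c₁ i) (c₃ j) = gap (oe i) (oZ j)
    rule (c₁ i) c₄ = gap (oe i) ot
    rule (c₂ p) (c₂ q) = dist≡ᵇ1-false (flat₂ (oX p) (oX q))
    rule (c₂ p) (c₃ i) with mem i p in m
    ... | true  = dist≡ᵇ1-false (not-below {i = i} {p} (oZ i) (Z-miss i) m)
    ... | false = sym (dist≡ᵇ1-true (below {i = i} {p} (oZ i) (Z-miss i) m))
    rule (c₂ p) c₄ = gap (oX p) ot
    rule (c₃ i) (c₃ j) = dist≡ᵇ1-false (flat₃ (oZ i) (oZ j))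
    rule (c₃ i) c₄ = sym (dist≡ᵇ1-true (top-adj (oZ i)))
    rule c₄ c₄ = cong (_≡ᵇ 1) (d-refl t)
    rule (c₁ i) c₀ = trans (flip (e i) o) (rule c₀ (c₁ i))
    rule (c₂ p) c₀ = trans (flip (X p) o) (rule c₀ (c₂ p))
    rule (c₃ i) c₀ = trans (flip (Z i) o) (rule c₀ (c₃ i))
    rule c₄ c₀ = trans (flip t o) (rule c₀ c₄)
    rule (c₂ p) (c₁ i) = trans (flip (X p) (e i)) (rule (c₁ i) (c₂ p))
    rule (c₃ j) (c₁ i) = trans (flip (Z j) (e i)) (rule (c₁ i) (c₃ j))
    rule c₄ (c₁ i) = trans (flip t (e i)) (rule (c₁ i) c₄)
    rule (c₃ i) (c₂ p) = trans (flip (Z i) (X p)) (rule (c₂ p) (c₃ i))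
    rule c₄ (c₂ p) = trans (flip t (X p)) (rule (c₂ p) c₄)
    rule c₄ (c₃ i) = trans (flip t (Z i)) (rule (c₃ i) c₄)

    iso : IsoD S (Vec Bool 4) Cube4-adj
    iso = iso-from-codes S Cube4-adj φ₄ φ₄⁻ φ₄φ₄⁻ φ₄⁻φ₄ ψ cover (λ c c′ → trans (rule c c′) (rule₄-adj c c′)) twins₄

  cube : IsoD S (Vec Bool 4) Cube4-adj
  cube = At.iso (proj₁ top) (proj₁ (proj₂ top)) (proj₂ (proj₂ top)) (enumerate (at? 1 (proj₁ top)) 4 (trans (val (proj₁ top)) k-is-4))
    where
    top = at-dist 4 4≤D

-- The Johnson graph J(7,3)

module JohnsonLocal {n : ℕ} (T : Setting n) (1≤a : 1 ≤ Setting.a T) (c<b : Local.c (Setting.S T) (Setting.a T) (Setting.hk T) < Local.b (Setting.S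
    T) (Setting.a T) (Setting.hk T))
  (J : DenseArray.JohnsonArray T 1≤a c<b) where

  open Small T
  open Dense T 1≤a c<b
  open DenseArray.JohnsonArray J

  k≡12 : k ≡ 12
  k≡12 = trans hk (cong₂ (λ s t → suc (s + t)) a≡5 b≡6)

  s-sym : ∀ {y m m′} → s y m m′ ≡ s y m′ m
  s-sym {y} {m} {m′} = #-cong (at? 1 y ∩? at? 2 m ∩? at? 2 m′) (at? 1 y ∩? at? 2 m′ ∩? at? 2 m) (λ _ (p , q , r) → p , r , q) (λ _ (p , q , r) →
      p , r , q)

  -- Adjacent pairs of a local graph have 3 or 4 common non-neighbours; in J(7,3) these are the columns and rows of the 3 × 4 grid.
  L R : Fin n → Fin n → Fin n → Set
  L y m m′ = d m m′ ≡ 1 × s y m m′ ≡ 3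
  R y m m′ = d m m′ ≡ 1 × s y m m′ ≡ 4

  L? : ∀ y m → Pred? (L y m)
  L? y m m′ = at? 1 m m′ ×-dec (s y m m′ ≟ 3)
  R? : ∀ y m → Pred? (R y m)
  R? y m m′ = at? 1 m m′ ×-dec (s y m m′ ≟ 4)

  L-sym : ∀ {y m m′} → L y m m′ → L y m′ m
  L-sym (p , q) = sy p , trans s-sym q
  R-sym : ∀ {y m m′} → R y m m′ → R y m′ m
  R-sym (p , q) = sy p , trans s-sym q

  L≠R : ∀ {y m m′} → L y m m′ → R y m m′ → ⊥
  L≠R (_ , p) (_ , q) = contradiction (trans (sym p) q) λ ()

  -- s + ν = 6 with ν ≤ s gives s ≥ 3, and 2s + 4 ≤ 12 gives s ≤ 4.
  adj-type : ∀ {y m m′} → d y m ≡ 1 → d y m′ ≡ 1 → d m m′ ≡ 1 → L y m m′ ⊎ R y m m′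
  adj-type {y} {m} {m′} h h′ e = [ (λ q → inj₁ (e , q)) , (λ q → inj₂ (e , q)) ]′
      (arith (s y m m′) (ν y m m′) b c b≡6 c≡4 (half-adj h h′ e) (sν-adj h h′ e) (ν≤s h h′))
    where
    arith : ∀ s v b c → b ≡ 6 → c ≡ 4 → 2 * s + c ≤ 2 * b → s + v ≡ b → v ≤ s → s ≡ 3 ⊎ s ≡ 4
    arith s v _ _ refl refl p q r = three-four s (*-cancelˡ-≤ {s} {4} 2 (lin {A = 2 * s + 4} {B = 12} 0 p (solve (s ∷ []))))
         (*-cancelˡ-≤ {3} {s} 2 (lin {A = v + 6} {B = s + (s + v)} 0 (+-mono-≤ r (≤-reflexive (sym q))) (solve (s ∷ v ∷ []))))
      where
      three-four : ∀ s → s ≤ 4 → 3 ≤ s → s ≡ 3 ⊎ s ≡ 4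
      three-four 3 _ _ = inj₁ refl
      three-four 4 _ _ = inj₂ refl
      three-four 0 _ ()
      three-four 1 _ (s≤s ())
      three-four 2 _ (s≤s (s≤s ()))
      three-four (suc (suc (suc (suc (suc _))))) (s≤s (s≤s (s≤s (s≤s ())))) _

  -- s + ν = 3, where `s-bound` reads s ≤ 2ν; together with ν ≤ s only (2, 1) is left.
  nonadj-sν : ∀ {y m m′} → d y m ≡ 1 → d y m′ ≡ 1 → d m m′ ≡ 2 → s y m m′ ≡ 2 × ν y m m′ ≡ 1
  nonadj-sν {y} {m} {m′} h h′ e = arith (s y m m′) (ν y m m′) a b c a≡5 b≡6 c≡4 (sν-nonadj h h′ e) (ν≤s h h′) (s-bound h h′)
    where
    arith : ∀ s v a b c → a ≡ 5 → b ≡ 6 → c ≡ 4 → s + v + (a + 2) ≡ b + c → v ≤ s → s * (2 * c) ≤ v * c + s * b → s ≡ 2 × v ≡ 1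
    arith s v _ _ _ refl refl refl p q r = go s v (+-cancelʳ-≡ 7 (s + v) 3 p) q r
      where
      go : ∀ s v → s + v ≡ 3 → v ≤ s → s * 8 ≤ v * 4 + s * 6 → s ≡ 2 × v ≡ 1
      go 2 1 _ _ _ = refl , refl
      go 0 3 _ () _
      go 1 2 _ (s≤s ()) _
      go 3 0 _ _ r = contradiction r (<⇒≱ (m≤m+n 19 5))

  α-L : ∀ {y m m′} → d y m ≡ 1 → d y m′ ≡ 1 → L y m m′ → α y m m′ ≡ 1
  α-L h h′ (e , q) = arith _ _ _ _ a≡5 b≡6 q (s-adj h h′ e)
    where
    arith : ∀ s a b al → a ≡ 5 → b ≡ 6 → s ≡ 3 → s + a ≡ suc (b + al) → al ≡ 1
    arith _ _ _ al refl refl refl p = sym (+-cancelˡ-≡ 7 1 al p)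

  α-R : ∀ {y m m′} → d y m ≡ 1 → d y m′ ≡ 1 → R y m m′ → α y m m′ ≡ 2
  α-R h h′ (e , q) = arith _ _ _ _ a≡5 b≡6 q (s-adj h h′ e)
    where
    arith : ∀ s a b al → a ≡ 5 → b ≡ 6 → s ≡ 4 → s + a ≡ suc (b + al) → al ≡ 2
    arith _ _ _ al refl refl refl p = sym (+-cancelˡ-≡ 7 2 al p)

  α-nonadj : ∀ {y m m′} → d y m ≡ 1 → d y m′ ≡ 1 → d m m′ ≡ 2 → α y m m′ ≡ 2
  α-nonadj h h′ e = arith _ _ _ _ a≡5 b≡6 (proj₁ (nonadj-sν h h′ e)) (s-nonadj h h′ e)
    where
    arith : ∀ s a b al → a ≡ 5 → b ≡ 6 → s ≡ 2 → suc (s + a) ≡ b + al → al ≡ 2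
    arith _ _ _ al refl refl refl p = sym (+-cancelˡ-≡ 6 2 al p)

  ν-R : ∀ {y m m′} → d y m ≡ 1 → d y m′ ≡ 1 → R y m m′ → ν y m m′ ≡ 2
  ν-R {y} {m} {m′} h h′ (e , q) = +-cancelˡ-≡ 4 (ν y m m′) 2 (trans (cong (_+ ν y m m′) (sym q)) (trans (sν-adj h h′ e) b≡6))

  ν-L : ∀ {y m m′} → d y m ≡ 1 → d y m′ ≡ 1 → L y m m′ → ν y m m′ ≡ 3
  ν-L {y} {m} {m′} h h′ (e , q) = +-cancelˡ-≡ 3 (ν y m m′) 3 (trans (cong (_+ ν y m m′) (sym q)) (trans (sν-adj h h′ e) b≡6))

  ξ≡3 : ξ ≡ 3
  ξ≡3 = *-cancelʳ-≡ ξ 3 4 (trans (cong (ξ *_) (sym c≡4)) (trans hξ (cong₂ _*_ b≡6 b₂≡2)))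

  κ-1 : ∀ {y f f′ w} → d y w ≡ 1 → d y f ≡ 1 → d y f′ ≡ 1 → d f w ≡ 2 → d f′ w ≡ 2 → 1 ≤ κ y f f′ w
  κ-1 {y} {f} {f′} {w} p q r t u = arith ξ b₂ (κ y f f′ w) ξ≡3 b₂≡2 (κ-≥ p q r t u)
    where
    arith : ∀ x b₂ k → x ≡ 3 → b₂ ≡ 2 → 2 * b₂ ≤ x + k → 1 ≤ k
    arith _ _ k refl refl p = +-cancelˡ-≤ 3 1 k p

  -- The sum of all κ is 2ν and every κ is at least 1, so a value κ ≥ 2 forces s < 2ν.
  κ-excess : ∀ {y f f′ w} → d y w ≡ 1 → d y f ≡ 1 → d y f′ ≡ 1 → d f w ≡ 2 → d f′ w ≡ 2 → 2 ≤ κ y f f′ w → suc (s y f f′) ≤ ν y f f′ * 2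
  κ-excess {y} {f} {f′} {w} hw h h′ e e′ two = ≤-trans (≤-reflexive size) (≤-trans (+-mono-≤
      (≤-trans (≤-reflexive (cong (_* 2) (sym (#-sing w)))) (pairs-≥ w? Q? R₃? 2 (λ { _ refl → two })))
      (≤-trans (≤-reflexive (sym (*-identityʳ (# rest?)))) (pairs-≥ rest? Q? R₃? 1 (λ z ((p , q , r) , _) → κ-1 p h h′ q r))))
    (≤-trans (pairs-pack P? w? rest? Q? R₃? (λ { _ refl → hw , e , e′ }) (λ _ → proj₁) (λ _ p q → proj₂ q p))
    (≤-trans (≤-reflexive (pairs-swap P? Q? R₃?))
    (pairs-≤ Q? P? (λ x w → R₃? w x) 2 (λ x p → ≤-reflexive (trans (κ-sum-row h h′ x p) b₂≡2))))))
    where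
    P? = at? 1 y ∩? at? 2 f ∩? at? 2 f′
    Q? = at? 2 y ∩? at? 1 f ∩? at? 1 f′
    R₃? : ∀ w x → Dec (d w x ≡ 3)
    R₃? w x = d w x ≟ 3
    w? = λ z → z F.≟ w
    rest? = λ z → P? z ×-dec ¬? (z F.≟ w)
    size : suc (s y f f′) ≡ 2 + # rest?
    size = cong suc (#-remove P? w (hw , e , e′))

  -- s < 2ν holds for (s, ν) = (3, 3), but not for (4, 2) nor for the non-adjacent type (2, 1).
  κ-2⇒L : ∀ {y f f′ w} → d y w ≡ 1 → d y f ≡ 1 → d y f′ ≡ 1 → ¬ f ≡ f′ → d f w ≡ 2 → d f′ w ≡ 2 → 2 ≤ κ y f f′ w → L y f f′
  κ-2⇒L {y} {f} {f′} hw h h′ ne e e′ two = [ (λ q → [ (λ l → l) , (λ r → ⊥-elim (not-R r)) ]′ (adj-type h h′ q)) , (λ q →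
      ⊥-elim (not-far q)) ]′ (local h h′ ne)
    where
    excess′ : suc (s y f f′) ≤ ν y f f′ * 2
    excess′ = κ-excess hw h h′ e e′ two
    not-far : d f f′ ≡ 2 → ⊥
    not-far q = contradiction (subst₂ (λ s v → suc s ≤ v * 2) (proj₁ (nonadj-sν h h′ q)) (proj₂ (nonadj-sν h h′ q)) excess′) λ { (s≤s (s≤s ())) }
    not-R : R y f f′ → ⊥
    not-R r = contradiction (subst₂ (λ s v → suc s ≤ v * 2) (proj₂ r) (ν-R h h′ r) excess′) λ { (s≤s (s≤s (s≤s (s≤s ())))) }

  module _ {y : Fin n} where

    Γ : Fin n → Set
    Γ z = d y z ≡ 1

    -- Of the ξ = 3 vertices of Γ₂(y) beyond z, w is adjacent to b₂ = 2; let x be the third. At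
    -- least 6 - 4 = 2 non-neighbours of z miss x, namely w and some f. Both are adjacent to the
    -- other two vertices, so κ ≥ 2.
    block : ∀ {z w} → Γ z → Γ w → d z w ≡ 2 → ∃[ f ] (Γ f × d z f ≡ 2 × L y w f)
    block {z} {w} hz hw e = go (#-∃ (λ x → X? x ×-dec ¬? (at? 1 w x)) (arith (# (λ x → X? x ×-dec ¬? (at? 1 w x))) (subst₂ (λ s t →
        s ≤ t + # (λ x → X? x ×-dec ¬? (at? 1 w x)))
          (trans (X-card hz) ξ≡3) (trans (far (sy (sy e))) b₂≡2) (#-cover (at? 1 w ∩? at? 3 z) (λ x → X? x ×-dec ¬? (at? 1 w x)) X? cov))))
      where
      X? = at? 2 y ∩? at? 3 z
      arith : ∀ g → 3 ≤ 2 + g → 0 < g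
      arith g p = +-cancelˡ-≤ 2 1 g p
      cov : ∀ x → d y x ≡ 2 × d z x ≡ 3 → _
      cov x (p , q) with at? 1 w x
      ... | yes r = inj₁ (r , q)
      ... | no r  = inj₂ ((p , q) , r)
      go : ∃[ x ] ((d y x ≡ 2 × d z x ≡ 3) × ¬ d w x ≡ 1) → ∃[ f ] (Γ f × d z f ≡ 2 × L y w f)
      go (x , (p , q) , nw) = finish (#-two G? two w ((hw , e) , λ t → nw (sy t)))
        where
        G? = λ f → (at? 1 y ∩? at? 2 z) f ×-dec ¬? (at? 1 x f)
        cov′ : ∀ f → Γ f × d z f ≡ 2 → _
        cov′ f (r , t) with at? 1 x f
        ... | yes u = inj₁ (r , u)
        ... | no u  = inj₂ ((r , t) , u)
        two : 1 < # G?
        two = +-cancelˡ-≤ 4 2 (# G?) (subst₂ (λ s t → s ≤ t + # G?) (trans (nonnbr hz) b≡6) (trans (codeg₂ (sy p)) c≡4)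
                (#-cover (at? 1 y ∩? at? 1 x) G? (at? 1 y ∩? at? 2 z) cov′))
        X′? = λ u → X? u ×-dec ¬? (u F.≟ x)
        X′2 : # X′? ≡ 2
        X′2 = suc-injective (trans (sym (#-remove X? x (p , q))) (trans (X-card hz) ξ≡3))
        all-adj : ∀ {f} → Γ f → d z f ≡ 2 → ¬ d x f ≡ 1 → ∀ u → (d y u ≡ 2 × d z u ≡ 3) × ¬ u ≡ x → d f u ≡ 1
        all-adj {f} hf t nx u m = proj₁ (#-full (at? 1 f ∩? at? 3 z) X′?
          (λ v (r , w) → (geod (sy hz) hf r w , w) , λ { refl → nx (sy r) }) (≤-reflexive (trans X′2 (sym (trans (far t) b₂≡2)))) u m)
        finish : ∃[ f ] (((Γ f × d z f ≡ 2) × ¬ d x f ≡ 1) × ¬ f ≡ w) → ∃[ f ] (Γ f × d z f ≡ 2 × L y w f)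
        finish (f , ((hf , t) , nf) , ne) = f , hf , t , κ-2⇒L hz hw hf (λ q → ne (sym q)) (sy e) (sy t)
          (subst (_≤ κ y w f z) X′2 (#-mono X′? _ (λ u m → (proj₁ (proj₁ m) , all-adj hw e (λ r →
              nw (sy r)) u m , all-adj hf t nf u m) , proj₂ (proj₁ m))))

    module _ {w : Fin n} (hw : Γ w) where

      A? = at? 1 y ∩? at? 1 w
      LA? = λ z → at? 1 y z ×-dec L? y w z
      RA? = λ z → at? 1 y z ×-dec R? y w z
      F? = at? 1 y ∩? at? 2 w

      -- Of the b non-neighbours of w, s are also non-neighbours of p; by `sν-adj` the other b - s
      -- are ν in number.
      out : ∀ {p} → Γ p → d w p ≡ 1 → # (λ z → F? z ×-dec at? 1 p z) ≡ ν y w p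
      out {p} hp e = +-cancelˡ-≡ (s y w p) (# (λ z → F? z ×-dec at? 1 p z)) (ν y w p) (trans (sym (#-split (at? 1 y ∩? at? 2 w ∩? at? 2 p) (λ z →
          F? z ×-dec at? 1 p z) F? cov
           (λ _ (q , r , _) → q , r) (λ _ → proj₁) (λ _ (_ , _ , q) (_ , r) → clash r q))) (trans (nonnbr hw) (sym (sν-adj hw hp e))))
        where
        cov : ∀ z → Γ z × d w z ≡ 2 → _
        cov z (q , r) with local hp q (λ { refl → clash e r })
        ... | inj₁ t = inj₂ ((q , r) , t)
        ... | inj₂ t = inj₁ (q , r , t)

      -- The edges between the neighbours and the 6 non-neighbours of w in Γ(y) number 12, as α = 2
      -- for non-adjacent pairs. L-neighbours carry 3 of them and R-neighbours 2: l + r = 5 and 3l +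
      -- 2r = 12.
      degrees : # LA? ≡ 2 × # RA? ≡ 3
      degrees = arith (# LA?) (# RA?) five (≤-antisym upper lower)
        where
        adj? : ∀ p z → Dec (d p z ≡ 1)
        adj? p z = at? 1 p z
        cov : ∀ z → Γ z × d w z ≡ 1 → (Γ z × L y w z) ⊎ (Γ z × R y w z)
        cov z (p , q) = [ (λ l → inj₁ (p , l)) , (λ r → inj₂ (p , r)) ]′ (adj-type hw p q)
        five : # LA? + # RA? ≡ 5
        five = trans (sym (#-split LA? RA? A? cov (λ _ (p , q) → p , proj₁ q) (λ _ (p , q) → p , proj₁ q) (λ _ p q →
            L≠R (proj₂ p) (proj₂ q)))) (trans (codeg₁ (sy hw)) a≡5)
        total : pairs A? F? adj? ≡ 12
        total = ≤-antisym (≤-trans (≤-reflexive (pairs-swap A? F? adj?)) (≤-trans (pairs-≤ F? A? (λ z p → adj? p z) 2 (λ f m →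
            ≤-reflexive (col f m))) (≤-reflexive size)))
                  (≤-trans (≤-reflexive (sym size)) (≤-trans (pairs-≥ F? A? (λ z p → adj? p z) 2 (λ f m →
                      ≤-reflexive (sym (col f m)))) (≤-reflexive (sym (pairs-swap A? F? adj?)))))
          where
          size : # F? * 2 ≡ 12
          size = cong (_* 2) (trans (nonnbr hw) b≡6)
          col : ∀ f → Γ f × d w f ≡ 2 → # (λ p → A? p ×-dec at? 1 p f) ≡ 2
          col f (p , q) = trans (#-cong _ (at? 1 y ∩? at? 1 w ∩? at? 1 f) (λ _ ((r , t) , u) → r , t , sy u) (λ _ (r , t , u) →
              (r , t) , sy u)) (α-nonadj hw p q)
        lower : 12 ≤ # LA? * 3 + # RA? * 2
        lower = ≤-trans (≤-reflexive (sym total)) (≤-trans (pairs-cover A? LA? RA? F? adj? cov) (+-mono-≤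
          (pairs-≤ LA? F? adj? 3 (λ p (q , l) → ≤-reflexive (trans (out q (proj₁ l)) (ν-L hw q l))))
          (pairs-≤ RA? F? adj? 2 (λ p (q , r) → ≤-reflexive (trans (out q (proj₁ r)) (ν-R hw q r))))))
        upper : # LA? * 3 + # RA? * 2 ≤ 12
        upper = ≤-trans (+-mono-≤
          (pairs-≥ LA? F? adj? 3 (λ p (q , l) → ≤-reflexive (sym (trans (out q (proj₁ l)) (ν-L hw q l)))))
          (pairs-≥ RA? F? adj? 2 (λ p (q , r) → ≤-reflexive (sym (trans (out q (proj₁ r)) (ν-R hw q r))))))
          (≤-trans (pairs-pack A? LA? RA? F? adj? (λ _ (p , q) → p , proj₁ q) (λ _ (p , q) → p , proj₁ q) (λ _ p q →
              L≠R (proj₂ p) (proj₂ q))) (≤-reflexive total))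
        arith : ∀ l r → l + r ≡ 5 → l * 3 + r * 2 ≡ 12 → l ≡ 2 × r ≡ 3
        arith l r p q = l≡2 , +-cancelˡ-≡ l r 3 (trans p (cong (_+ 3) (sym l≡2)))
          where
          eq : ∀ l r → l * 3 + r * 2 ≡ l + (l + r) * 2
          eq l r = solve (l ∷ r ∷ [])
          l≡2 : l ≡ 2
          l≡2 = +-cancelʳ-≡ 10 l 2 (trans (cong (λ t → l + t * 2) (sym p)) (trans (sym (eq l r)) q))

      L-two : ∀ {v v′ u} → Γ v → Γ v′ → Γ u → L y w v → L y w v′ → ¬ v ≡ v′ → L y w u → u ≡ v ⊎ u ≡ v′
      L-two {v} {v′} {u} hv hv′ hu l l′ ne m with u F.≟ v
      ... | yes e = inj₁ e
      ... | no ne′ = inj₂ (#-unique (λ z → LA? z ×-dec ¬? (z F.≟ v)) (≤-reflexive (suc-injective (trans (sym (#-remove LA? v (hv , l))) (proj₁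
          degrees))))
                        ((hu , m) , ne′) ((hv′ , l′) , λ t → ne (sym t)))

      -- v and v′ are the only L-neighbours of w, and `block` makes one of them a non-neighbour of
      -- z.
      never-both : ∀ {v v′ z} → Γ v → Γ v′ → Γ z → L y w v → L y w v′ → ¬ v ≡ v′ → d w z ≡ 2 → d v z ≡ 1 → d v′ z ≡ 1 → ⊥
      never-both {v} {v′} {z} hv hv′ hz l l′ ne e q q′ = go (block hz hw (sy e))
        where
        go : ∃[ f ] (Γ f × d z f ≡ 2 × L y w f) → ⊥
        go (f , hf , t , m) with L-two hv hv′ hf l l′ ne m
        ... | inj₁ refl = clash (sy q) t
        ... | inj₂ refl = clash (sy q′) t

      -- Otherwise v and v′ have a second common neighbour q. It is adjacent to w by `never-both`,
      -- so it is an R-neighbour, and v, v′ are all the common neighbours of w and q. For another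
      -- R-neighbour u of w, the two common neighbours with w would then have to lie among the
      -- R-neighbours of w other than q and u, but only one is left.
      triangle : ∀ {v v′} → Γ v → Γ v′ → L y w v → L y w v′ → ¬ v ≡ v′ → d v v′ ≡ 1
      triangle {v} {v′} hv hv′ l l′ ne with local hv hv′ ne
      ... | inj₁ e = e
      ... | inj₂ e = ⊥-elim (with-q (#-two C? (subst (1 <_) (sym (α-nonadj hv hv′ e)) ≤-refl) w (hw , sy (proj₁ l) , sy (proj₁ l′))))
        where
        C? = at? 1 y ∩? at? 1 v ∩? at? 1 v′
        with-q : ∃[ q ] ((Γ q × d v q ≡ 1 × d v′ q ≡ 1) × ¬ q ≡ w) → ⊥
        with-q (q , (hq , vq , v′q) , nq) = [ near , (λ t → never-both hv hv′ hq l l′ ne t vq v′q) ]′ (local hw hq (λ t → nq (sym t)))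
          where
          with-u : d w q ≡ 1 → R y w q → ∃[ u ] ((Γ u × R y w u) × ¬ u ≡ q) → ⊥
          with-u wq rq (u , (hu , ru) , nu) = contradiction (≤-trans (≤-reflexive (sym (α-R hw hu ru))) (≤-trans (#-mono (at? 1 y ∩? at? 1 w ∩? at?
              1 u) rest? sub) (≤-reflexive one))) λ { (s≤s ()) }
            where
            rest? = λ z → (RA? z ×-dec ¬? (z F.≟ q)) ×-dec ¬? (z F.≟ u)
            one : # rest? ≡ 1
            one = suc-injective (suc-injective (trans (cong suc (sym (#-remove (λ z →
                RA? z ×-dec ¬? (z F.≟ q)) u ((hu , ru) , nu)))) (trans (sym (#-remove RA? q (hq , rq))) (proj₂ degrees))))
            only-q : ∀ {v} → Γ v → L y w v → d v q ≡ 1 → ∀ {z} → Γ z → d w z ≡ 1 → d v z ≡ 1 → z ≡ q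
            only-q {v} hv l vq {z} hz wz vz = #-unique (at? 1 y ∩? at? 1 w ∩? at? 1 v) (≤-reflexive (α-L hw hv l)) (hz , wz , vz) (hq , wq , vq)
            sub : ∀ z → Γ z × d w z ≡ 1 × d u z ≡ 1 → ((Γ z × R y w z) × ¬ z ≡ q) × ¬ z ≡ u
            sub z (hz , wz , uz) = ((hz , rz) , zq) , λ { refl → d≢ uz refl }
              where
              not-L : ∀ {v} → Γ v → L y w v → d v q ≡ 1 → ¬ z ≡ v
              not-L hv l vq refl = nu (only-q hv l vq hu (proj₁ ru) (sy uz))
              rz : R y w z
              rz = [ (λ m → ⊥-elim ([ not-L hv l vq , not-L hv′ l′ v′q ]′ (L-two hv hv′ hz l l′ ne m))) , (λ r → r) ]′ (adj-type hw hz wz)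
              -- The two common neighbours of w and q are v and v′.
              zq : ¬ z ≡ q
              zq refl = contradiction (≤-trans (#-three (at? 1 y ∩? at? 1 w ∩? at? 1 q) {v} {v′} {u} (hv , proj₁ l , sy vq) (hv′ , proj₁ l′ , sy
                  v′q) (hu , proj₁ ru , sy uz)
                  ne (λ { refl → L≠R l ru }) (λ { refl → L≠R l′ ru })) (≤-reflexive (α-R hw hq rq))) λ { (s≤s (s≤s ())) }
          near : d w q ≡ 1 → ⊥
          near wq = [ (λ lq → [ (λ { refl → d≢ vq refl }) , (λ { refl → d≢ v′q refl }) ]′ (L-two hv hv′ hq l l′ ne lq))
                    , (λ rq → with-u wq rq (#-two (RA?) (subst (1 <_) (sym (proj₂ degrees)) (s≤s (s≤s z≤n))) q (hq , rq))) ]′ (adj-type hw hq wq)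

    other-L : ∀ {w v} → Γ w → Γ v → L y w v → ∃[ u ] ((Γ u × L y w u) × ¬ u ≡ v)
    other-L {w} {v} hw hv l = #-two (LA? hw) (subst (1 <_) (sym (proj₁ (degrees hw))) ≤-refl) v (hv , l)

    -- The second L-neighbour of v and v′ are both common neighbours of v and w, and α = 1 on
    -- L-pairs.
    L-trans : ∀ {v w v′} → Γ v → Γ w → Γ v′ → L y v w → L y w v′ → ¬ v ≡ v′ → L y v v′
    L-trans {v} {w} {v′} hv hw hv′ l l′ ne = go (other-L hv hw l)
      where
      go : ∃[ u ] ((Γ u × L y v u) × ¬ u ≡ w) → L y v v′
      go (u , (hu , m) , nu) = subst (L y v) (#-unique (at? 1 y ∩? at? 1 w ∩? at? 1 v) (≤-reflexive (α-L hw hv (L-sym l)))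
         (hu , triangle hv hw hu l m (λ t → nu (sym t)) , proj₁ m) (hv′ , proj₁ l′ , triangle hw hv hv′ (L-sym l) l′ ne)) m

    -- A common neighbour of t and w cannot be an L-neighbour of w: the third vertex of that
    -- L-triangle would have to be t. So the α = 2 common neighbours are exactly the two other
    -- R-neighbours of w, and t′ is adjacent to t. An L-pair t, t′ would make w an L-neighbour of t
    -- in the same way.
    R-trans : ∀ {t w t′} → Γ t → Γ w → Γ t′ → R y t w → R y w t′ → ¬ t ≡ t′ → R y t t′
    R-trans {t} {w} {t′} ht hw ht′ r r′ ne = [ (λ l → ⊥-elim (not-L l)) , (λ m → m) ]′ (adj-type ht ht′ tt′)
      where
      rest? = λ z → RA? hw z ×-dec ¬? (z F.≟ t)
      two : # rest? ≡ 2
      two = suc-injective (trans (sym (#-remove (RA? hw) t (ht , R-sym r))) (proj₂ (degrees hw)))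
      sub : ∀ z → Γ z × d w z ≡ 1 × d t z ≡ 1 → (Γ z × R y w z) × ¬ z ≡ t
      sub z (hz , wz , tz) = (hz , rz) , λ { refl → d≢ tz refl }
        where
        rz : R y w z
        rz = [ (λ l → ⊥-elim (go l (other-L hw hz l))) , (λ m → m) ]′ (adj-type hw hz wz)
          where
          go : L y w z → ∃[ u ] ((Γ u × L y w u) × ¬ u ≡ z) → ⊥
          go l (u , (hu , m) , nu) = L≠R m (subst (R y w) (#-unique (at? 1 y ∩? at? 1 w ∩? at? 1 z) (≤-reflexive (α-L hw hz l))
             (ht , sy (proj₁ r) , sy tz) (hu , proj₁ m , triangle hw hz hu l m (λ q → nu (sym q)))) (R-sym r))
      tt′ : d t t′ ≡ 1
      tt′ = proj₂ (proj₂ (#-full (at? 1 y ∩? at? 1 w ∩? at? 1 t) rest? sub (≤-reflexive (trans two (sym (α-R hw ht (R-sym r))))) t′ ((ht′ , r′) , λ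
          q → ne (sym q))))
      not-L : L y t t′ → ⊥
      not-L l = go (other-L ht ht′ l)
        where
        go : ∃[ u ] ((Γ u × L y t u) × ¬ u ≡ t′) → ⊥
        go (u , (hu , m) , nu) = L≠R m (subst (R y t) (#-unique (at? 1 y ∩? at? 1 t ∩? at? 1 t′) (≤-reflexive (α-L ht ht′ l))
          (hw , proj₁ r , sy (proj₁ r′)) (hu , proj₁ m , triangle ht ht′ hu l m (λ q → nu (sym q)))) r)

-- The 3 × 4 grid on each local graph

module JohnsonGrid {n : ℕ} (T : Setting n) (1≤a : 1 ≤ Setting.a T) (c<b : Local.c (Setting.S T) (Setting.a T) (Setting.hk T) < Local.b (Setting.S
    T) (Setting.a T) (Setting.hk T))
  (J : DenseArray.JohnsonArray T 1≤a c<b) where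

  open Small T
  open Dense T 1≤a c<b
  open DenseArray.JohnsonArray J
  open JohnsonLocal T 1≤a c<b J

  record Grid (y : Fin n) : Set where
    field
      g     : Fin 3 → Fin 4 → Fin n
      g∈    : ∀ i j → d y (g i j) ≡ 1
      g-sur : ∀ v → d y v ≡ 1 → ∃[ i ] ∃[ j ] g i j ≡ v
      g-inj : ∀ {i j i′ j′} → g i j ≡ g i′ j′ → i ≡ i′ × j ≡ j′
      row   : ∀ {i j j′} → ¬ j ≡ j′ → R y (g i j) (g i j′)
      col   : ∀ {i i′ j} → ¬ i ≡ i′ → L y (g i j) (g i′ j)
      off   : ∀ {i j i′ j′} → ¬ i ≡ i′ → ¬ j ≡ j′ → d (g i j) (g i′ j′) ≡ 2

  module _ {y w : Fin n} (hw : d y w ≡ 1) where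

    private
      R* L* : Fin n → Fin n → Set
      R* m m′ = m ≡ m′ ⊎ R y m m′
      L* m m′ = m ≡ m′ ⊎ L y m m′
      R*? : ∀ m m′ → Dec (R* m m′)
      R*? m m′ = (m F.≟ m′) ⊎-dec R? y m m′
      L*? : ∀ m m′ → Dec (L* m m′)
      L*? m m′ = (m F.≟ m′) ⊎-dec L? y m m′

      R*-sym : ∀ {m m′} → R* m m′ → R* m′ m
      R*-sym = [ (λ e → inj₁ (sym e)) , (λ r → inj₂ (R-sym r)) ]′
      L*-sym : ∀ {m m′} → L* m m′ → L* m′ m
      L*-sym = [ (λ e → inj₁ (sym e)) , (λ r → inj₂ (L-sym r)) ]′

      R*-trans : ∀ {t u v} → d y t ≡ 1 → d y u ≡ 1 → d y v ≡ 1 → R* t u → R* u v → R* t v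
      R*-trans ht hu hv (inj₁ refl) q = q
      R*-trans ht hu hv (inj₂ r) (inj₁ refl) = inj₂ r
      R*-trans {t} {u} {v} ht hu hv (inj₂ r) (inj₂ r′) = [ inj₁ , (λ ne → inj₂ (R-trans ht hu hv r r′ ne)) ]′ (toSum (t F.≟ v))
      L*-trans : ∀ {t u v} → d y t ≡ 1 → d y u ≡ 1 → d y v ≡ 1 → L* t u → L* u v → L* t v
      L*-trans ht hu hv (inj₁ refl) q = q
      L*-trans ht hu hv (inj₂ r) (inj₁ refl) = inj₂ r
      L*-trans {t} {u} {v} ht hu hv (inj₂ r) (inj₂ r′) = [ inj₁ , (λ ne → inj₂ (L-trans ht hu hv r r′ ne)) ]′ (toSum (t F.≟ v))

      meet : ∀ {u v} → R* u v → L* u v → u ≡ v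
      meet (inj₁ e) _ = e
      meet (inj₂ _) (inj₁ e) = e
      meet (inj₂ r) (inj₂ l) = ⊥-elim (L≠R l r)

      Rc? : ∀ u → Pred? (λ z → d y z ≡ 1 × R* u z)
      Rc? u z = at? 1 y z ×-dec R*? u z
      Lc? : ∀ u → Pred? (λ z → d y z ≡ 1 × L* u z)
      Lc? u z = at? 1 y z ×-dec L*? u z

      R-class : ∀ {u} → d y u ≡ 1 → # (Rc? u) ≡ 4
      R-class {u} hu = trans (#-split (λ z → z F.≟ u) (RA? hu) (Rc? u)
          (λ { _ (_ , inj₁ refl) → inj₁ refl ; _ (p , inj₂ r) → inj₂ (p , r) }) (λ { _ refl → hu , inj₁ refl }) (λ _ (p , r) →
              p , inj₂ r) (λ { _ refl (_ , r) → d≢ (proj₁ r) refl }))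
        (cong₂ _+_ (#-sing u) (proj₂ (degrees hu)))
      L-class : ∀ {u} → d y u ≡ 1 → # (Lc? u) ≡ 3
      L-class {u} hu = trans (#-split (λ z → z F.≟ u) (LA? hu) (Lc? u)
          (λ { _ (_ , inj₁ refl) → inj₁ refl ; _ (p , inj₂ r) → inj₂ (p , r) }) (λ { _ refl → hu , inj₁ refl }) (λ _ (p , r) →
              p , inj₂ r) (λ { _ refl (_ , r) → d≢ (proj₁ r) refl }))
        (cong₂ _+_ (#-sing u) (proj₁ (degrees hu)))

      twelve : # (at? 1 y) ≡ 12
      twelve = trans (val y) k≡12

      -- The classes of the representatives are disjoint and have 12 elements in all; if v were
      -- missed, they would have to fit into the other 11 vertices of Γ(y).
      covers : ∀ {P : Fin n → Set} {Q : Fin n → Fin n → Set} (P? : Pred? P) (Q? : ∀ u z → Dec (Q u z)) r → # P? * r ≡ 12 →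
        (∀ u → P u → # (λ z → at? 1 y z ×-dec Q? u z) ≡ r) → (∀ {u u′ z} → P u → P u′ → d y z ≡ 1 → Q u z → Q u′ z → u ≡ u′) →
        ∀ v → d y v ≡ 1 → ∃[ u ] (P u × Q u v)
      covers {P} {Q} P? Q? r e h uniq v hv = [ (λ q → q) , (λ none → ⊥-elim (impossible none)) ]′ (toSum (FP.any? (λ u → P? u ×-dec Q? u v)))
        where
        rest? = λ z → at? 1 y z ×-dec ¬? (z F.≟ v)
        eleven : # rest? ≡ 11
        eleven = suc-injective (trans (sym (#-remove (at? 1 y) v hv)) twelve)
        impossible : ¬ (∃[ u ] (P u × Q u v)) → ⊥
        impossible none = contradiction (subst₂ _≤_ e (trans (*-identityʳ (# rest?)) eleven)
          (double-≤ P? rest? Q? r 1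
            (λ u p → ≤-trans (≤-reflexive (sym (h u p))) (#-mono (λ z → at? 1 y z ×-dec Q? u z) (λ z → rest? z ×-dec Q? u z) (λ z (hz , q) →
                (hz , λ { refl → none (u , p , q) }) , q)))
            (λ z (hz , _) → #-≤1 (λ u → P? u ×-dec Q? u z) (λ u u′ (p , q) (p′ , q′) → uniq p p′ hz q q′)))) (<⇒≱ (n<1+n 11))

      -- The three vertices of the column of w represent the rows, the four vertices of its row
      -- represent the columns.
      module Coordinates (LC : Enumeration (λ z → d y z ≡ 1 × L* w z) 3) (RC : Enumeration (λ z → d y z ≡ 1 × R* w z) 4) (E : Enumeration (λ z →
          d y z ≡ 1) 12) where

        module LC = Enumeration LC
        module RC = Enumeration RC
        module E = Enumeration E

        reps-row : ∀ {u u′} → d y u ≡ 1 × R* w u → d y u′ ≡ 1 × R* w u′ → R* u u′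
        reps-row (p , q) (p′ , q′) = R*-trans p hw p′ (R*-sym q) q′
        reps-col : ∀ {u u′} → d y u ≡ 1 × L* w u → d y u′ ≡ 1 × L* w u′ → L* u u′
        reps-col (p , q) (p′ , q′) = L*-trans p hw p′ (L*-sym q) q′

        opaque

          row-of : ∀ v → d y v ≡ 1 → ∃[ i ] R* (LC.el i) v
          row-of v hv = go (covers (Lc? w) R*? 4 (cong (_* 4) (L-class hw)) (λ u (p , _) → R-class p)
              (λ p p′ hz q q′ → meet (R*-trans (proj₁ p) hz (proj₁ p′) q (R*-sym q′)) (reps-col p p′)) v hv)
            where
            go : ∃[ u ] ((d y u ≡ 1 × L* w u) × R* u v) → ∃[ i ] R* (LC.el i) v
            go (u , p , q) = proj₁ (LC.sur u p) , subst (λ t → R* t v) (sym (proj₂ (LC.sur u p))) q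

          col-of : ∀ v → d y v ≡ 1 → ∃[ j ] L* (RC.el j) v
          col-of v hv = go (covers (Rc? w) L*? 3 (cong (_* 3) (R-class hw)) (λ u (p , _) → L-class p)
              (λ p p′ hz q q′ → meet (reps-row p p′) (L*-trans (proj₁ p) hz (proj₁ p′) q (L*-sym q′))) v hv)
            where
            go : ∃[ u ] ((d y u ≡ 1 × R* w u) × L* u v) → ∃[ j ] L* (RC.el j) v
            go (u , p , q) = proj₁ (RC.sur u p) , subst (λ t → L* t v) (sym (proj₂ (RC.sur u p))) q

        -- Packing row and column into one index makes injectivity enough for every grid position to
        -- be occupied.
        code : Fin 12 → Fin 12
        code x = F.combine (proj₁ (row-of (E.el x) (E.prop x))) (proj₁ (col-of (E.el x) (E.prop x)))

        code-inj : ∀ {x x′} → code x ≡ code x′ → x ≡ x′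
        code-inj {x} {x′} e = E.inj (meet
            (R*-trans (E.prop x) (proj₁ (LC.prop (proj₁ r))) (E.prop x′) (R*-sym (proj₂ r)) (subst (λ t →
                R* (LC.el t) (E.el x′)) (sym (proj₁ eqs)) (proj₂ r′)))
            (L*-trans (E.prop x) (proj₁ (RC.prop (proj₁ c′))) (E.prop x′) (L*-sym (proj₂ c′)) (subst (λ t →
                L* (RC.el t) (E.el x′)) (sym (proj₂ eqs)) (proj₂ c″))))
          where
          r = row-of (E.el x) (E.prop x)
          r′ = row-of (E.el x′) (E.prop x′)
          c′ = col-of (E.el x) (E.prop x)
          c″ = col-of (E.el x′) (E.prop x′)
          eqs = FP.combine-injective (proj₁ r) (proj₁ c′) (proj₁ r′) (proj₁ c″) e

        opaque

          decode : ∀ i j → ∃[ x ] (proj₁ (row-of (E.el x) (E.prop x)) ≡ i × proj₁ (col-of (E.el x) (E.prop x)) ≡ j)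
          decode i j = go (injective⇒surjective code code-inj (F.combine i j))
            where
            go : ∃[ x ] code x ≡ F.combine i j → ∃[ x ] (proj₁ (row-of (E.el x) (E.prop x)) ≡ i × proj₁ (col-of (E.el x) (E.prop x)) ≡ j)
            go (x , e) = x , FP.combine-injective _ _ i j e

        g : Fin 3 → Fin 4 → Fin n
        g i j = E.el (proj₁ (decode i j))
        g∈ : ∀ i j → d y (g i j) ≡ 1
        g∈ i j = E.prop (proj₁ (decode i j))
        g-row : ∀ i j → R* (LC.el i) (g i j)
        g-row i j = subst (λ t → R* (LC.el t) (g i j)) (proj₁ (proj₂ (decode i j))) (proj₂ (row-of (g i j) (g∈ i j)))
        g-col : ∀ i j → L* (RC.el j) (g i j)
        g-col i j = subst (λ t → L* (RC.el t) (g i j)) (proj₂ (proj₂ (decode i j))) (proj₂ (col-of (g i j) (g∈ i j)))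

        same-row : ∀ {i i′ u} → d y u ≡ 1 → R* (LC.el i) u → R* (LC.el i′) u → i ≡ i′
        same-row {i} {i′} hu q q′ = LC.inj (meet (R*-trans (proj₁ (LC.prop i)) hu (proj₁ (LC.prop i′)) q (R*-sym q′)) (reps-col (LC.prop i)
            (LC.prop i′)))
        same-col : ∀ {j j′ u} → d y u ≡ 1 → L* (RC.el j) u → L* (RC.el j′) u → j ≡ j′
        same-col {j} {j′} hu q q′ = RC.inj (meet (reps-row (RC.prop j) (RC.prop j′)) (L*-trans (proj₁ (RC.prop j)) hu (proj₁ (RC.prop j′)) q
            (L*-sym q′)))

        g-inj : ∀ {i j i′ j′} → g i j ≡ g i′ j′ → i ≡ i′ × j ≡ j′
        g-inj {i} {j} {i′} {j′} e = same-row (g∈ i j) (g-row i j) (subst (R* (LC.el i′)) (sym e) (g-row i′ j′))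
                                  , same-col (g∈ i j) (g-col i j) (subst (L* (RC.el j′)) (sym e) (g-col i′ j′))

        g-sur : ∀ v → d y v ≡ 1 → ∃[ i ] ∃[ j ] g i j ≡ v
        g-sur v hv = go (row-of v hv) (col-of v hv)
          where
          go : ∃[ i ] R* (LC.el i) v → ∃[ j ] L* (RC.el j) v → ∃[ i ] ∃[ j ] g i j ≡ v
          go (i , p) (j , q) = i , j , meet (R*-trans (g∈ i j) (proj₁ (LC.prop i)) hv (R*-sym (g-row i j)) p) (L*-trans (g∈ i j) (proj₁ (RC.prop
              j)) hv (L*-sym (g-col i j)) q)

        row : ∀ {i j j′} → ¬ j ≡ j′ → R y (g i j) (g i j′)
        row {i} {j} {j′} ne = [ (λ e → ⊥-elim (ne (proj₂ (g-inj e)))) , (λ r → r) ]′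
          (R*-trans (g∈ i j) (proj₁ (LC.prop i)) (g∈ i j′) (R*-sym (g-row i j)) (g-row i j′))
        col : ∀ {i i′ j} → ¬ i ≡ i′ → L y (g i j) (g i′ j)
        col {i} {i′} {j} ne = [ (λ e → ⊥-elim (ne (proj₁ (g-inj e)))) , (λ r → r) ]′
          (L*-trans (g∈ i j) (proj₁ (RC.prop j)) (g∈ i′ j) (L*-sym (g-col i j)) (g-col i′ j))
        off : ∀ {i j i′ j′} → ¬ i ≡ i′ → ¬ j ≡ j′ → d (g i j) (g i′ j′) ≡ 2
        off {i} {j} {i′} {j′} ne ne′ = [ (λ e → ⊥-elim ([ not-L , not-R ]′ (adj-type (g∈ i j) (g∈ i′ j′) e))) , (λ e → e) ]′
            (Small.local T (g∈ i j) (g∈ i′ j′) (λ e → ne (proj₁ (g-inj e))))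
          where
          not-L : L y (g i j) (g i′ j′) → ⊥
          not-L l = ne′ (same-col (g∈ i′ j′) (L*-trans (proj₁ (RC.prop j)) (g∈ i j) (g∈ i′ j′) (g-col i j) (inj₂ l)) (g-col i′ j′))
          not-R : R y (g i j) (g i′ j′) → ⊥
          not-R r = ne (same-row (g∈ i′ j′) (R*-trans (proj₁ (LC.prop i)) (g∈ i j) (g∈ i′ j′) (g-row i j) (inj₂ r)) (g-row i′ j′))

    opaque

      grid-at : Grid y
      grid-at = record { g = g ; g∈ = g∈ ; g-sur = g-sur ; g-inj = g-inj ; row = row ; col = col ; off = off }
        where
        open Coordinates (enumerate (Lc? w) 3 (L-class hw)) (enumerate (Rc? w) 4 (R-class hw)) (enumerate (at? 1 y) 12 twelve)

  opaque

    grid : ∀ y → Grid y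
    grid y = go (#-∃ (at? 1 y) (subst (0 <_) (sym (trans (val y) k≡12)) (s≤s z≤n)))
      where
      go : ∃[ w ] d y w ≡ 1 → Grid y
      go (w , hw) = grid-at hw

-- Labels for the 3-subsets of a 7-set

data Code₇ : Set where
  k₀ : Code₇
  k₁ : Fin 3 → Fin 4 → Code₇
  k₂ : Fin 3 → Fin 6 → Code₇
  k₃ : Fin 4 → Code₇

module _ where

  open import Data.Vec using ([]; _∷_)

  -- Rows are the points 0, 1, 2 of the base triple, columns the other four points.
  subset₇ : (Fin 3 → Bool) → (Fin 4 → Bool) → Subset 7
  subset₇ p q = p zero ∷ p (suc zero) ∷ p (suc (suc zero)) ∷ bits q

  -- `k₁ i j` exchanges the base point i for the outer point j, `k₂ i p` keeps only the base point
  -- i, and `k₃ j` omits j from the outer points. The constructors are sorted by the distance from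
  -- the base triple.
  bits₇ : Code₇ → Subset 7
  bits₇ k₀ = subset₇ (λ _ → true) (λ _ → false)
  bits₇ (k₁ i j) = subset₇ (λ r → not (finEq r i)) (finEq j)
  bits₇ (k₂ i p) = subset₇ (λ r → finEq r i) (λ j → mem j p)
  bits₇ (k₃ j) = subset₇ (λ _ → false) (λ l → not (finEq l j))

allC₇ : (Code₇ → Bool) → Bool
allC₇ p = p k₀ ∧ (allF (λ i → allF (λ j → p (k₁ i j))) ∧ (allF (λ i → allF (λ q → p (k₂ i q))) ∧ allF (λ j → p (k₃ j))))

eqC₇ : Code₇ → Code₇ → Bool
eqC₇ k₀ k₀ = true
eqC₇ (k₁ i j) (k₁ i′ j′) = finEq i i′ ∧ finEq j j′
eqC₇ (k₂ i p) (k₂ i′ p′) = finEq i i′ ∧ finEq p p′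
eqC₇ (k₃ j) (k₃ j′) = finEq j j′
eqC₇ _ _ = false

finite₇ : Finite Code₇
finite₇ = record { all = allC₇ ; sound = snd ; complete = complete ; eq = eqC₇ ; eq-sound = eq-snd }
  where
  snd : ∀ p → allC₇ p ≡ true → ∀ c → p c ≡ true
  snd p h c with ∧-true {p k₀} h
  ... | h₀ , t₁ with ∧-true {allF (λ i → allF (λ j → p (k₁ i j)))} t₁
  ... | h₁ , t₂ with ∧-true {allF (λ i → allF (λ q → p (k₂ i q)))} t₂
  ... | h₂ , h₃ with c
  ... | k₀ = h₀
  ... | k₁ i j = allF-sound (λ j → p (k₁ i j)) (allF-sound (λ i → allF (λ j → p (k₁ i j))) h₁ i) j
  ... | k₂ i q = allF-sound (λ q → p (k₂ i q)) (allF-sound (λ i → allF (λ q → p (k₂ i q))) h₂ i) q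
  ... | k₃ j = allF-sound (λ j → p (k₃ j)) h₃ j
  complete : ∀ p → (∀ c → p c ≡ true) → allC₇ p ≡ true
  complete p h = cong₂ _∧_ (h k₀) (cong₂ _∧_ (allF-complete (λ i → allF (λ j → p (k₁ i j))) (λ i → allF-complete (λ j → p (k₁ i j)) (λ j →
      h (k₁ i j))))
    (cong₂ _∧_ (allF-complete (λ i → allF (λ q → p (k₂ i q))) (λ i → allF-complete (λ q → p (k₂ i q)) (λ q → h (k₂ i q)))) (allF-complete (λ j →
        p (k₃ j)) (λ j → h (k₃ j)))))
  eq-snd : ∀ {c c′} → eqC₇ c c′ ≡ true → c ≡ c′
  eq-snd {k₀} {k₀} _ = refl
  eq-snd {k₁ i j} {k₁ i′ j′} h = cong₂ k₁ (finEq-sound (proj₁ (∧-true {finEq i i′} h))) (finEq-sound (proj₂ (∧-true {finEq i i′} h)))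
  eq-snd {k₂ i j} {k₂ i′ j′} h = cong₂ k₂ (finEq-sound (proj₁ (∧-true {finEq i i′} h))) (finEq-sound (proj₂ (∧-true {finEq i i′} h)))
  eq-snd {k₃ j} {k₃ j′} h = cong k₃ (finEq-sound h)

card₇ : ∀ c → ∣ bits₇ c ∣ ≡ 3
card₇ c = ≡ᵇ-true (Finite.sound finite₇ (λ c → ∣ bits₇ c ∣ ≡ᵇ 3) refl c)

φ₇ : Code₇ → J73-V
φ₇ c = bits₇ c , card₇ c

module _ where

  open import Data.Vec using ([]; _∷_)

  -- Decoders made total: their last clauses also accept vectors of the wrong weight, which do not
  -- come from 3-subsets.
  first-true first-false : Vec Bool 4 → Fin 4
  first-true (true ∷ _) = zero
  first-true (_ ∷ true ∷ _) = suc zero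
  first-true (_ ∷ _ ∷ true ∷ _) = suc (suc zero)
  first-true _ = suc (suc (suc zero))
  first-false (false ∷ _) = zero
  first-false (_ ∷ false ∷ _) = suc zero
  first-false (_ ∷ _ ∷ false ∷ _) = suc (suc zero)
  first-false _ = suc (suc (suc zero))

  pair-of : Vec Bool 4 → Fin 6
  pair-of (true ∷ true ∷ _) = zero
  pair-of (true ∷ _ ∷ true ∷ _) = suc zero
  pair-of (true ∷ _) = suc (suc zero)
  pair-of (_ ∷ true ∷ true ∷ _) = suc (suc (suc zero))
  pair-of (_ ∷ true ∷ _) = suc (suc (suc (suc zero)))
  pair-of _ = suc (suc (suc (suc (suc zero))))

  code₇ : Subset 7 → Code₇
  code₇ (true ∷ true ∷ true ∷ v) = k₀
  code₇ (false ∷ true ∷ true ∷ v) = k₁ zero (first-true v)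
  code₇ (true ∷ false ∷ true ∷ v) = k₁ (suc zero) (first-true v)
  code₇ (true ∷ true ∷ false ∷ v) = k₁ (suc (suc zero)) (first-true v)
  code₇ (true ∷ false ∷ false ∷ v) = k₂ zero (pair-of v)
  code₇ (false ∷ true ∷ false ∷ v) = k₂ (suc zero) (pair-of v)
  code₇ (false ∷ false ∷ true ∷ v) = k₂ (suc (suc zero)) (pair-of v)
  code₇ (false ∷ false ∷ false ∷ v) = k₃ (first-false v)

  φ₇⁻ : J73-V → Code₇
  φ₇⁻ (s , _) = code₇ s

-- The search runs over all subsets, with the size condition as a Boolean implication; the size
-- proofs agree because equality of numbers is proof-irrelevant.
φ₇φ₇⁻ : ∀ v → φ₇ (φ₇⁻ v) ≡ v
φ₇φ₇⁻ (s , h) = glue (eqV-sound (trans (sym (cong (λ t → not t ∨ eqV (bits₇ (code₇ s)) s) (true-≡ᵇ h)))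
    (allV-sound (λ s → not (∣ s ∣ ≡ᵇ 3) ∨ eqV (bits₇ (code₇ s)) s) refl s)))
  where
  glue : ∀ {s s′ : Subset 7} {h : ∣ s ∣ ≡ 3} {h′ : ∣ s′ ∣ ≡ 3} → s ≡ s′ → _≡_ {A = J73-V} (s , h) (s′ , h′)
  glue {h = h} {h′} refl = cong (_ ,_) (≡-irrelevant h h′)

φ₇⁻φ₇ : ∀ c → φ₇⁻ (φ₇ c) ≡ c
φ₇⁻φ₇ c = Finite.eq-sound finite₇ (Finite.sound finite₇ (λ c → eqC₇ (code₇ (bits₇ c)) c) refl c)

share : Fin 6 → Fin 6 → Bool
share p q = mem (fst₄ p) q ∨ mem (snd₄ p) q

rule₇ : Code₇ → Code₇ → Bool
rule₇ k₀ (k₁ _ _) = true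
rule₇ (k₁ _ _) k₀ = true
rule₇ (k₁ i j) (k₁ i′ j′) = if finEq i i′ then not (finEq j j′) else finEq j j′
rule₇ (k₁ r j) (k₂ i p) = not (finEq r i) ∧ mem j p
rule₇ (k₂ i p) (k₁ r j) = not (finEq r i) ∧ mem j p
rule₇ (k₂ i p) (k₂ i′ p′) = if finEq i i′ then (not (finEq p p′) ∧ share p p′) else finEq p p′
rule₇ (k₂ i p) (k₃ j) = not (mem j p)
rule₇ (k₃ j) (k₂ i p) = not (mem j p)
rule₇ (k₃ j) (k₃ j′) = not (finEq j j′)
rule₇ _ _ = false

rule₇-adj : ∀ c c′ → rule₇ c c′ ≡ J73-adj (φ₇ c) (φ₇ c′)
rule₇-adj c c′ = eqB-sound (Finite.sound₂ finite₇ (λ c c′ → eqB (rule₇ c c′) (∣ bits₇ c ∩ bits₇ c′ ∣ ≡ᵇ 2)) refl c c′)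

twins₇ : ∀ c c′ → (∀ c″ → J73-adj (φ₇ c) (φ₇ c″) ≡ J73-adj (φ₇ c′) (φ₇ c″)) → c ≡ c′
twins₇ c c′ h = Finite.no-twins finite₇ rule₇ refl c c′ (λ c″ → trans (rule₇-adj c c″) (trans (h c″) (sym (rule₇-adj c′ c″))))

two-others : ∀ (i : Fin 3) → ∃[ r ] ∃[ r′ ] (¬ r ≡ i × ¬ r′ ≡ i × ¬ r ≡ r′)
two-others zero = suc zero , suc (suc zero) , (λ ()) , (λ ()) , (λ ())
two-others (suc zero) = zero , suc (suc zero) , (λ ()) , (λ ()) , (λ ())
two-others (suc (suc zero)) = zero , suc zero , (λ ()) , (λ ()) , (λ ())

finEq-false : ∀ {m} {i j : Fin m} → ¬ i ≡ j → finEq i j ≡ false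
finEq-false {i = i} {j} ne with finEq i j in e
... | true  = ⊥-elim (ne (finEq-sound e))
... | false = refl

finEq-true : ∀ {m} {i j : Fin m} → i ≡ j → finEq i j ≡ true
finEq-true {i = i} refl = finEq-refl i

allF₄ : ∀ {k l m o} (p : Fin k → Fin l → Fin m → Fin o → Bool) → allF (λ x → allF (λ y → allF (λ z → allF (p x y z)))) ≡ true → ∀ x y z w →
    p x y z w ≡ true
allF₄ p h x y z = allF-sound (p x y z) (allF-sound (λ z → allF (p x y z)) (allF-sound (λ y → allF (λ z → allF (p x y z)))
  (allF-sound (λ x → allF (λ y → allF (λ z → allF (p x y z)))) h x) y) z)

third : ∀ {i i′ r r′ : Fin 3} → ¬ r ≡ r′ → ¬ r ≡ i → ¬ r′ ≡ i → ¬ r ≡ i′ → ¬ r′ ≡ i′ → i ≡ i′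
third {i} {i′} {r} {r′} n₁ n₂ n₃ n₄ n₅ = finEq-sound (conclude (finEq r r′) (finEq r i) (finEq r′ i) (finEq r i′) (finEq r′ i′) (finEq i i′)
    (finEq-false n₁) (finEq-false n₂) (finEq-false n₃) (finEq-false n₄) (finEq-false n₅)
    (allF₄ claim refl r r′ i i′))
  where
  claim : Fin 3 → Fin 3 → Fin 3 → Fin 3 → Bool
  claim r r′ i i′ = finEq r r′ ∨ (finEq r i ∨ (finEq r′ i ∨ (finEq r i′ ∨ (finEq r′ i′ ∨ finEq i i′))))
  conclude : ∀ a b c d e f → a ≡ false → b ≡ false → c ≡ false → d ≡ false → e ≡ false → a ∨ (b ∨ (c ∨ (d ∨ (e ∨ f)))) ≡ true → f ≡ true
  conclude _ _ _ _ _ f refl refl refl refl refl h = h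

another : ∀ (i i′ : Fin 3) → ∃[ r ] (¬ r ≡ i × ¬ r ≡ i′)
another i i′ with proj₁ (two-others i) F.≟ i′
... | no ne = proj₁ (two-others i) , proj₁ (proj₂ (proj₂ (two-others i))) , ne
... | yes e = proj₁ (proj₂ (two-others i)) , proj₁ (proj₂ (proj₂ (proj₂ (two-others i)))) , λ e′ →
    proj₂ (proj₂ (proj₂ (proj₂ (two-others i)))) (trans e (sym e′))

same-pair : ∀ {p q : Fin 6} {j j′} → ¬ j ≡ j′ → mem j p ≡ true → mem j′ p ≡ true → mem j q ≡ true → mem j′ q ≡ true → p ≡ q
same-pair {p} {q} {j} {j′} ne a b c d = finEq-sound (conclude (finEq j j′) (mem j p) (mem j′ p) (mem j q) (mem j′ q) (finEq p q) (finEq-false ne) a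
    b c d
    (allF₄ claim refl p q j j′))
  where
  claim : Fin 6 → Fin 6 → Fin 4 → Fin 4 → Bool
  claim p q j j′ = finEq j j′ ∨ (not (mem j p) ∨ (not (mem j′ p) ∨ (not (mem j q) ∨ (not (mem j′ q) ∨ finEq p q))))
  conclude : ∀ a b c d e f → a ≡ false → b ≡ true → c ≡ true → d ≡ true → e ≡ true → a ∨ (not b ∨ (not c ∨ (not d ∨ (not e ∨ f)))) ≡ true → f ≡ true
  conclude _ _ _ _ _ f refl refl refl refl refl h = h

complement : (p : Fin 6) → ∃[ q ] (∀ j → mem j q ≡ not (mem j p))
-- In lexicographic order, complementary pairs have opposite positions.
complement p = F.opposite p , λ j → eqB-sound (allF-sound (λ j → eqB (mem j (F.opposite p)) (not (mem j p))) (allF-sound (λ p → allF (λ j →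
    eqB (mem j (F.opposite p)) (not (mem j p)))) refl p) j)

share-mem : ∀ {p q j} → mem j p ≡ true → mem j q ≡ true → share p q ≡ true
share-mem {p} {q} {j} h h′ with mem-true {j} {p} h
... | inj₁ refl = cong (_∨ mem (snd₄ p) q) h′
... | inj₂ refl with mem (fst₄ p) q
... | true  = refl
... | false = h′

mem-share : ∀ {p q} → share p q ≡ true → ∃[ j ] (mem j p ≡ true × mem j q ≡ true)
mem-share {p} {q} h with mem (fst₄ p) q in e
... | true  = fst₄ p , cong (_∨ finEq (fst₄ p) (snd₄ p)) (finEq-refl (fst₄ p)) , e
... | false = snd₄ p , snd-mem₄ p , h
  where
  snd-mem₄ : ∀ p → mem (snd₄ p) p ≡ true
  snd-mem₄ p = allF-sound (λ p → mem (snd₄ p) p) refl p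

-- From the local grids to J(7,3)

module JohnsonIso {n : ℕ} (T : Setting n) (1≤a : 1 ≤ Setting.a T) (c<b : Local.c (Setting.S T) (Setting.a T) (Setting.hk T) < Local.b (Setting.S T)
    (Setting.a T) (Setting.hk T))
  (J : DenseArray.JohnsonArray T 1≤a c<b) where

  open Small T
  open Dense T 1≤a c<b
  open DenseArray.JohnsonArray J
  open JohnsonLocal T 1≤a c<b J
  open JohnsonGrid T 1≤a c<b J

  2b≡3c : 2 * b ≡ 3 * c
  2b≡3c = trans (cong (2 *_) b≡6) (sym (cong (3 *_) c≡4))

  c≤a+1 : c ≤ a + 1
  c≤a+1 = subst₂ (λ s t → s ≤ t + 1) (sym c≡4) (sym a≡5) (m≤m+n 4 2)

  -- x is at distance 3 from two vertices of row i, and adjacent to the 2 × 2 subgrid avoiding their row and columns; p is the pair of the remaining columns.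
  record XCode {y} (G : Grid y) (i : Fin 3) (p : Fin 6) (x : Fin n) : Set where
    open Grid G
    field
      near  : ∀ r j → ¬ r ≡ i → mem j p ≡ true → d x (g r j) ≡ 1
      near⁻ : ∀ r j → d x (g r j) ≡ 1 → ¬ r ≡ i × mem j p ≡ true
      away  : ∀ j → mem j p ≡ false → d x (g i j) ≡ 3

  -- The b₂ = 2 vertices of Γ(y) at distance 3 from x are adjacent with s = c = 4, hence lie in one
  -- row. The common neighbours of x and y are precisely their common non-neighbours: the 2 × 2
  -- subgrid off that row and off their columns.
  x-code : ∀ {y} (G : Grid y) {x} → d y x ≡ 2 → ∃[ i ] ∃[ p ] XCode G i p x
  x-code {y} G {x} yx = go (W-pair yx)
    where
    open Grid G
    Wx = W yx
    build : ∀ i j₀ j₁ → Wx (g i j₀) → Wx (g i j₁) → ¬ j₀ ≡ j₁ → d (g i j₀) (g i j₁) ≡ 1 →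
        ∃[ q ] ((fst₄ q ≡ j₀ × snd₄ q ≡ j₁) ⊎ (fst₄ q ≡ j₁ × snd₄ q ≡ j₀)) → ∃[ i ] ∃[ p ] XCode G i p x
    build i j₀ j₁ h h′ ne e (q , fs) = i , p , record { near = near ; near⁻ = near⁻ ; away = away }
      where
      p = proj₁ (complement q)
      mem-p : ∀ j → mem j p ≡ not (mem j q)
      mem-p = proj₂ (complement q)
      q-mem : ∀ {j} → mem j p ≡ false → j ≡ j₀ ⊎ j ≡ j₁
      q-mem {j} m = [ (λ s → [ (λ (t , u) → inj₁ (trans s t)) , (λ (t , u) → inj₂ (trans s t)) ]′ fs)
                    , (λ s → [ (λ (t , u) → inj₂ (trans s u)) , (λ (t , u) → inj₁ (trans s u)) ]′ fs) ]′ (mem-true {j} {q} (flip-not (trans (sym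
                        (mem-p j)) m)))
        where
        flip-not : ∀ {a} → not a ≡ false → a ≡ true
        flip-not {true} _ = refl
      mem-q : mem j₀ q ≡ true × mem j₁ q ≡ true
      mem-q = [ (λ { (refl , refl) → fst-in q , snd-in q }) , (λ { (refl , refl) → snd-in q , fst-in q }) ]′ fs
        where
        fst-in : ∀ q → mem (fst₄ q) q ≡ true
        fst-in q = allF-sound (λ q → mem (fst₄ q) q) refl q
        snd-in : ∀ q → mem (snd₄ q) q ≡ true
        snd-in q = allF-sound (λ q → mem (snd₄ q) q) refl q
      not-in : ∀ {j j′} → mem j p ≡ true → mem j′ q ≡ true → ¬ j ≡ j′
      not-in {j} m m′ refl = contradiction (trans (sym m) (trans (mem-p j) (cong not m′))) λ ()
      near : ∀ r j → ¬ r ≡ i → mem j p ≡ true → d x (g r j) ≡ 1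
      near r j nr m = common⊂M yx h h′ e (g r j) (g∈ r j) (off (λ t → nr (sym t)) (λ t → not-in m (proj₁ mem-q) (sym t))) (off (λ t →
          nr (sym t)) (λ t → not-in m (proj₂ mem-q) (sym t)))
      near⁻ : ∀ r j → d x (g r j) ≡ 1 → ¬ r ≡ i × mem j p ≡ true
      near⁻ r j xg = row≢ , [ (λ t → t) , (λ m → ⊥-elim (col-bad (q-mem m))) ]′ (bool (mem j p))
        where
        bool : ∀ t → t ≡ true ⊎ t ≡ false
        bool true = inj₁ refl
        bool false = inj₂ refl
        far₀ : d (g i j₀) (g r j) ≡ 2
        far₀ = M⊂F′ yx h (g r j) (g∈ r j , xg)
        far₁ : d (g i j₁) (g r j) ≡ 2
        far₁ = M⊂F′ yx h′ (g r j) (g∈ r j , xg)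
        row≢ : ¬ r ≡ i
        row≢ refl = [ (λ { refl → clash (d-refl (g i j₀)) far₀ }) , (λ n → clash (proj₁ (row n)) far₀) ]′ (toSum (j₀ F.≟ j))
        col-bad : j ≡ j₀ ⊎ j ≡ j₁ → ⊥
        col-bad (inj₁ refl) = clash (proj₁ (col (λ t → row≢ (sym t)))) far₀
        col-bad (inj₂ refl) = clash (proj₁ (col (λ t → row≢ (sym t)))) far₁
      away : ∀ j → mem j p ≡ false → d x (g i j) ≡ 3
      away j m = pick (q-mem m)
        where
        pick : j ≡ j₀ ⊎ j ≡ j₁ → d x (g i j) ≡ 3
        pick (inj₁ refl) = proj₂ h
        pick (inj₂ refl) = proj₂ h′
    same-row : ∀ {i i′ j j′} → d (g i j) (g i′ j′) ≡ 1 → s y (g i j) (g i′ j′) ≡ 4 → i ≡ i′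
    same-row {i} {i′} {j} {j′} e four = decidable-stable (i F.≟ i′) λ ne →
      [ (λ { refl → L≠R (col ne) (e , four) }) , (λ ne′ → clash e (off ne ne′)) ]′ (toSum (j F.≟ j′))
    place : ∀ {w w′} → Wx w → Wx w′ → ¬ w ≡ w′ → ∃[ i ] ∃[ j ] g i j ≡ w → ∃[ i ] ∃[ j ] g i j ≡ w′ → ∃[ i ] ∃[ p ] XCode G i p x
    place h h′ ne (i , j , refl) (i′ , j′ , refl) = go′ (same-row e (trans (proj₂ (adj⇒half yx h h′ e)) c≡4))
      where
      e = W-clique yx 2b≡3c c≤a+1 h h′ ne
      go′ : i ≡ i′ → ∃[ i ] ∃[ p ] XCode G i p x
      go′ refl = build i j j′ h h′ (λ { refl → ne refl }) e (find-pair j j′ (λ { refl → ne refl }))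
    go : ∃[ w ] ∃[ w′ ] (Wx w × Wx w′ × ¬ w′ ≡ w) → ∃[ i ] ∃[ p ] XCode G i p x
    go (w , w′ , h , h′ , ne) = place h h′ (λ t → ne (sym t)) (g-sur w (proj₁ h)) (g-sur w′ (proj₁ h′))

  -- In the grid of Γ(m) each neighbour of q shares its row or its column. Neither x nor x′ is on
  -- the line of q and y, so both are on the other line through q.
  claw : ∀ {m q y x x′} → d m q ≡ 1 → d m y ≡ 1 → d m x ≡ 1 → d m x′ ≡ 1 → d q y ≡ 1 → d q x ≡ 1 → d q x′ ≡ 1 →
         d y x ≡ 2 → d y x′ ≡ 2 → ¬ x ≡ x′ → d x x′ ≡ 1
  claw {m} {q} {y} {x} {x′} hq hy hx hx′ qy qx qx′ yx yx′ ne =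
    [ (λ l → [ (λ l′ → ⊥-elim (clash (proj₁ (L-trans hy hq hx (L-sym l) l′ (d≢ yx))) yx))
             , (λ r′ → [ (λ l″ → ⊥-elim (clash (proj₁ (L-trans hy hq hx′ (L-sym l) l″ (d≢ yx′))) yx′)) , (λ r″ →
                 proj₁ (R-trans hx hq hx′ (R-sym r′) r″ ne)) ]′ (adj-type hq hx′ qx′)) ]′ (adj-type hq hx qx))
    , (λ r → [ (λ l′ → [ (λ l″ → proj₁ (L-trans hx hq hx′ (L-sym l′) l″ ne)) , (λ r″ →
        ⊥-elim (clash (proj₁ (R-trans hy hq hx′ (R-sym r) r″ (d≢ yx′))) yx′)) ]′ (adj-type hq hx′ qx′))
             , (λ r′ → ⊥-elim (clash (proj₁ (R-trans hy hq hx (R-sym r) r′ (d≢ yx))) yx)) ]′ (adj-type hq hx qx)) ]′ (adj-type hq hy qy)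

  -- Read off in the grid of x, where y has a code (i, p) and x′ is an entry at distance 2 from y:
  -- either in row i and a column of p, or outside both. The subgrid of neighbours of y then
  -- contains two entries of the column, respectively of the row, of x′.
  common-edge : ∀ {y x x′} → d y x ≡ 2 → d y x′ ≡ 2 → d x x′ ≡ 1 →
                ∃[ m ] ∃[ m′ ] (d m m′ ≡ 1 × (d y m ≡ 1 × d x m ≡ 1 × d x′ m ≡ 1) × (d y m′ ≡ 1 × d x m′ ≡ 1 × d x′ m′ ≡ 1))
  common-edge {y} {x} {x′} yx yx′ xx′ = go (x-code Gx (sy yx)) (g-sur x′ xx′)
    where
    Gx = grid x
    open Grid Gx
    Goal = ∃[ m ] ∃[ m′ ] (d m m′ ≡ 1 × (d y m ≡ 1 × d x m ≡ 1 × d x′ m ≡ 1) × (d y m′ ≡ 1 × d x m′ ≡ 1 × d x′ m′ ≡ 1))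
    go : ∃[ i ] ∃[ p ] XCode Gx i p y → ∃[ r ] ∃[ j ] g r j ≡ x′ → Goal
    go (i , p , X) (r , j , refl) = [ in-row , (λ ne → off-row ne) ]′ (toSum (r F.≟ i))
      where
      open XCode X
      bool : ∀ t → t ≡ true ⊎ t ≡ false
      bool true = inj₁ refl
      bool false = inj₂ refl
      in-row : r ≡ i → Goal
      in-row refl = [ (λ m → cols m (two-others i)) , (λ m → ⊥-elim (clash yx′ (away j m))) ]′ (bool (mem j p))
        where
        cols : mem j p ≡ true → ∃[ r ] ∃[ r′ ] (¬ r ≡ i × ¬ r′ ≡ i × ¬ r ≡ r′) → Goal
        cols m (r₁ , r₂ , n₁ , n₂ , n₃) = g r₁ j , g r₂ j , proj₁ (col n₃) ,
          (near r₁ j n₁ m , g∈ r₁ j , proj₁ (col (λ t → n₁ (sym t)))) , (near r₂ j n₂ m , g∈ r₂ j , proj₁ (col (λ t → n₂ (sym t))))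
      off-row : ¬ r ≡ i → Goal
      off-row ne = [ (λ m → ⊥-elim (clash (near r j ne m) yx′)) , rows ]′ (bool (mem j p))
        where
        fst-in : mem (fst₄ p) p ≡ true
        fst-in = allF-sound (λ p → mem (fst₄ p) p) refl p
        snd-in : mem (snd₄ p) p ≡ true
        snd-in = allF-sound (λ p → mem (snd₄ p) p) refl p
        rows : mem j p ≡ false → Goal
        rows m = g r (fst₄ p) , g r (snd₄ p) , proj₁ (row (fst≢snd p)) ,
          (near r (fst₄ p) ne fst-in , g∈ r (fst₄ p) , proj₁ (row (proj₁ (mem-false {j} {p} m)))) ,
          (near r (snd₄ p) ne snd-in , g∈ r (snd₄ p) , proj₁ (row (proj₂ (mem-false {j} {p} m))))

  module Base (o : Fin n) (G : Grid o) where

    open Grid G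

    fst-in : ∀ p → mem (fst₄ p) p ≡ true
    fst-in p = allF-sound (λ p → mem (fst₄ p) p) refl p
    snd-in : ∀ p → mem (snd₄ p) p ≡ true
    snd-in p = allF-sound (λ p → mem (snd₄ p) p) refl p

    -- A diagonal of the 2 × 2 subgrid is a non-adjacent pair, and ν = 1.
    code-unique : ∀ {i p x x′} → d o x ≡ 2 → d o x′ ≡ 2 → XCode G i p x → XCode G i p x′ → x ≡ x′
    code-unique {i} {p} {x} {x′} h h′ X X′ = go (two-others i)
      where
      go : ∃[ r ] ∃[ r′ ] (¬ r ≡ i × ¬ r′ ≡ i × ¬ r ≡ r′) → x ≡ x′
      go (r , r′ , n₁ , n₂ , n₃) = #-unique (at? 2 o ∩? at? 1 (g r (fst₄ p)) ∩? at? 1 (g r′ (snd₄ p)))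
        (≤-reflexive (proj₂ (nonadj-sν (g∈ r (fst₄ p)) (g∈ r′ (snd₄ p)) (off n₃ (fst≢snd p)))))
        (h , sy (XCode.near X r (fst₄ p) n₁ (fst-in p)) , sy (XCode.near X r′ (snd₄ p) n₂ (snd-in p)))
        (h′ , sy (XCode.near X′ r (fst₄ p) n₁ (fst-in p)) , sy (XCode.near X′ r′ (snd₄ p) n₂ (snd-in p)))

    opaque

      -- Take the vertex of Γ₂(o) adjacent to both ends of a diagonal of the wanted subgrid; two
      -- rows and two columns determine its code.
      code-exists : ∀ i p → ∃[ x ] (d o x ≡ 2 × XCode G i p x)
      code-exists i p = go (two-others i)
        where
        go : ∃[ r ] ∃[ r′ ] (¬ r ≡ i × ¬ r′ ≡ i × ¬ r ≡ r′) → ∃[ x ] (d o x ≡ 2 × XCode G i p x)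
        go (r , r′ , n₁ , n₂ , n₃) = found (#-∃ (at? 2 o ∩? at? 1 (g r (fst₄ p)) ∩? at? 1 (g r′ (snd₄ p)))
            (subst (0 <_) (sym (proj₂ (nonadj-sν (g∈ r (fst₄ p)) (g∈ r′ (snd₄ p)) (off n₃ (fst≢snd p))))) (s≤s z≤n)))
          where
          found : ∃[ x ] (d o x ≡ 2 × d (g r (fst₄ p)) x ≡ 1 × d (g r′ (snd₄ p)) x ≡ 1) → ∃[ x ] (d o x ≡ 2 × XCode G i p x)
          found (x , h , e , e′) = match (x-code G h)
            where
            match : ∃[ i′ ] ∃[ p′ ] XCode G i′ p′ x → ∃[ x ] (d o x ≡ 2 × XCode G i p x)
            match (i′ , p′ , X) = x , h , subst₂ (λ s t → XCode G s t x)
              (third n₃ (proj₁ (XCode.near⁻ X r (fst₄ p) (sy e))) (proj₁ (XCode.near⁻ X r′ (snd₄ p) (sy e′))) n₁ n₂)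
              (same-pair (fst≢snd p) (proj₂ (XCode.near⁻ X r (fst₄ p) (sy e))) (proj₂ (XCode.near⁻ X r′ (snd₄ p) (sy e′))) (fst-in p) (snd-in p)) X

    X : Fin 3 → Fin 6 → Fin n
    X i p = proj₁ (code-exists i p)
    oX : ∀ i p → d o (X i p) ≡ 2
    oX i p = proj₁ (proj₂ (code-exists i p))
    X-code : ∀ i p → XCode G i p (X i p)
    X-code i p = proj₂ (proj₂ (code-exists i p))

    X-cover : ∀ x → d o x ≡ 2 → ∃[ i ] ∃[ p ] X i p ≡ x
    X-cover x h = go (x-code G h)
      where
      go : ∃[ i ] ∃[ p ] XCode G i p x → ∃[ i ] ∃[ p ] X i p ≡ x
      go (i , p , Y) = i , p , code-unique (oX i p) h (X-code i p) Y

    X-inj : ∀ {i p i′ p′} → X i p ≡ X i′ p′ → i ≡ i′ × p ≡ p′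
    X-inj {i} {p} {i′} {p′} e = go (two-others i)
      where
      go : ∃[ r ] ∃[ r′ ] (¬ r ≡ i × ¬ r′ ≡ i × ¬ r ≡ r′) → i ≡ i′ × p ≡ p′
      go (r , r′ , n₁ , n₂ , n₃) = third n₃ n₁ n₂ (proj₁ a₁) (proj₁ a₂) , same-pair (fst≢snd p) (fst-in p) (snd-in p) (proj₂ a₁) (proj₂ a₂)
        where
        a₁ = XCode.near⁻ (X-code i′ p′) r (fst₄ p) (subst (λ t → d t (g r (fst₄ p)) ≡ 1) e (XCode.near (X-code i p) r (fst₄ p) n₁ (fst-in p)))
        a₂ = XCode.near⁻ (X-code i′ p′) r′ (snd₄ p) (subst (λ t → d t (g r′ (snd₄ p)) ≡ 1) e (XCode.near (X-code i p) r′ (snd₄ p) n₂ (snd-in p)))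

    shared-edge⇒adj : ∀ {i p i′ p′ r j r′ j′} → d (g r j) (g r′ j′) ≡ 1 → d (X i p) (g r j) ≡ 1 → d (X i′ p′) (g r j) ≡ 1 →
                      d (X i p) (g r′ j′) ≡ 1 → d (X i′ p′) (g r′ j′) ≡ 1 → ¬ X i p ≡ X i′ p′ → d (X i p) (X i′ p′) ≡ 1
    shared-edge⇒adj {i} {p} {i′} {p′} {r} {j} {r′} {j′} e a₁ a₂ a₃ a₄ ne =
      claw e (sy (g∈ r j)) (sy a₁) (sy a₂) (sy (g∈ r′ j′)) (sy a₃) (sy a₄) (oX i p) (oX i′ p′) ne

    adj-row : ∀ {i p p′ j} → ¬ p ≡ p′ → mem j p ≡ true → mem j p′ ≡ true → d (X i p) (X i p′) ≡ 1
    adj-row {i} {p} {p′} {j} ne m m′ = go (two-others i)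
      where
      go : ∃[ r ] ∃[ r′ ] (¬ r ≡ i × ¬ r′ ≡ i × ¬ r ≡ r′) → d (X i p) (X i p′) ≡ 1
      go (r , r′ , n₁ , n₂ , n₃) = shared-edge⇒adj (proj₁ (col {j = j} n₃)) (XCode.near (X-code i p) r j n₁ m) (XCode.near (X-code i p′) r j n₁ m′)
        (XCode.near (X-code i p) r′ j n₂ m) (XCode.near (X-code i p′) r′ j n₂ m′) (λ e → ne (proj₂ (X-inj e)))

    adj-col : ∀ {i i′ p} → ¬ i ≡ i′ → d (X i p) (X i′ p) ≡ 1
    adj-col {i} {i′} {p} ne = go (another i i′)
      where
      go : ∃[ r ] (¬ r ≡ i × ¬ r ≡ i′) → d (X i p) (X i′ p) ≡ 1
      go (r , n₁ , n₂) = shared-edge⇒adj (proj₁ (row {i = r} (fst≢snd p))) (XCode.near (X-code i p) r (fst₄ p) n₁ (fst-in p)) (XCode.near (X-code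
          i′ p) r (fst₄ p) n₂ (fst-in p))
        (XCode.near (X-code i p) r (snd₄ p) n₁ (snd-in p)) (XCode.near (X-code i′ p) r (snd₄ p) n₂ (snd-in p)) (λ e → ne (proj₁ (X-inj e)))

    -- By `common-edge` both vertices are adjacent to an edge of the grid. An edge in a row shows
    -- two common columns, so p = p′; an edge in a column shows two rows avoided by both, so i = i′.
    adj⇒rule : ∀ {i p i′ p′} → d (X i p) (X i′ p′) ≡ 1 → (i ≡ i′ × ¬ p ≡ p′ × share p p′ ≡ true) ⊎ (¬ i ≡ i′ × p ≡ p′)
    adj⇒rule {i} {p} {i′} {p′} e = go (common-edge (oX i p) (oX i′ p′) e)
      where
      Goal = (i ≡ i′ × ¬ p ≡ p′ × share p p′ ≡ true) ⊎ (¬ i ≡ i′ × p ≡ p′)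
      both : ∀ {m m′} → d m m′ ≡ 1 → d (X i p) m ≡ 1 → d (X i′ p′) m ≡ 1 → d (X i p) m′ ≡ 1 → d (X i′ p′) m′ ≡ 1 →
             ∃[ r ] ∃[ j ] g r j ≡ m → ∃[ r ] ∃[ j ] g r j ≡ m′ → Goal
      both mm′ a₁ a₂ a₃ a₄ (r , j , refl) (r′ , j′ , refl) = decide (r F.≟ r′) (j F.≟ j′)
        where
        q₁ = XCode.near⁻ (X-code i p) r j a₁
        q₂ = XCode.near⁻ (X-code i′ p′) r j a₂
        q₃ = XCode.near⁻ (X-code i p) r′ j′ a₃
        q₄ = XCode.near⁻ (X-code i′ p′) r′ j′ a₄
        decide : Dec (r ≡ r′) → Dec (j ≡ j′) → Goal
        decide (yes refl) (yes refl) = ⊥-elim (d≢ mm′ refl)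
        decide (yes refl) (no ne) = inj₂ ((λ { refl → d≢ e (cong (X i) pp) }) , pp)
          where
          pp : p ≡ p′
          pp = same-pair ne (proj₂ q₁) (proj₂ q₃) (proj₂ q₂) (proj₂ q₄)
        decide (no ne) (yes refl) = inj₁ (ii , (λ pp → d≢ e (cong₂ X ii pp)) , share-mem {p} {p′} {j} (proj₂ q₁) (proj₂ q₂))
          where
          ii : i ≡ i′
          ii = third ne (proj₁ q₁) (proj₁ q₃) (proj₁ q₂) (proj₁ q₄)
        decide (no ne) (no ne′) = ⊥-elim (clash mm′ (off ne ne′))
      go : ∃[ m ] ∃[ m′ ] (d m m′ ≡ 1 × (d o m ≡ 1 × d (X i p) m ≡ 1 × d (X i′ p′) m ≡ 1) × (d o m′ ≡ 1 × d (X i p) m′ ≡ 1 × d (X i′ p′) m′ ≡ 1)) →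
          Goal
      go (m , m′ , mm′ , (om , a₁ , a₂) , (om′ , a₃ , a₄)) = both mm′ a₁ a₂ a₃ a₄ (g-sur m om) (g-sur m′ om′)

    k₂≡18 : # (at? 2 o) ≡ 18
    k₂≡18 = *-cancelʳ-≡ (# (at? 2 o)) 18 4 (trans (cong (# (at? 2 o) *_) (sym c≡4)) (trans (sym (level₂ o)) (cong₂ _*_ k≡12 b≡6)))

    k₃≡4 : # (at? 3 o) ≡ 4
    k₃≡4 = *-cancelʳ-≡ (# (at? 3 o)) 4 9 (trans (cong (# (at? 3 o) *_) (sym C3≡9)) (trans (sym (level₃ o)) (cong₂ _*_ k₂≡18 b₂≡2)))

    at-most-3 : ∀ {x y} → ¬ d x y ≡ 4
    at-most-3 {x} {y} h = <⇒≱ ≤-refl (≤-trans (≤-reflexive (sym h)) (≤-trans (diam-≤ x y) (≤-reflexive diam)))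

    a₃ : ∀ {x z} → d x z ≡ 3 → # (at? 1 z ∩? at? 3 x) ≡ 3
    a₃ {x} {z} h = +-cancelˡ-≡ 9 (# (at? 1 z ∩? at? 3 x)) 3 (trans (cong (_+ # (at? 1 z ∩? at? 3 x)) (sym (trans (C-spec 2 h) C3≡9)))
        (trans (sym (#-split (at? 1 z ∩? at? 2 x) (at? 1 z ∩? at? 3 x) (at? 1 z) cov (λ _ → proj₁) (λ _ → proj₁) (λ _ p q →
            clash (proj₂ p) (proj₂ q)))) (trans (val z) k≡12)))
      where
      cov : ∀ u → d z u ≡ 1 → _
      cov u p = [ (λ q → inj₁ (p , q)) , [ (λ q → inj₂ (p , q)) , (λ q → ⊥-elim (at-most-3 q)) ]′ ]′ (nb p h)

    avoid? : ∀ w w′ → Pred? (λ x → d o x ≡ 2 × (¬ d w x ≡ 1 × ¬ d w′ x ≡ 1))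
    avoid? w w′ x = at? 2 o x ×-dec (¬? (at? 1 w x) ×-dec ¬? (at? 1 w′ x))

    -- 18 − 6 − 6 + ν vertices of Γ₂(o) avoid w and w′.
    avoiding : ∀ {w w′} → d o w ≡ 1 → d o w′ ≡ 1 → # (avoid? w w′) ≤ 6 + ν o w w′
    avoiding {w} {w′} h h′ = arith (# (avoid? w w′)) (# U?) (ν o w w′) total union
      where
      U? : Pred? _
      U? x = (at? 2 o ∩? at? 1 w) x ⊎-dec (at? 2 o ∩? at? 1 w′) x
      six : ∀ {w} → d o w ≡ 1 → # (at? 2 o ∩? at? 1 w) ≡ 6
      six {w} h = trans (#-cong (at? 2 o ∩? at? 1 w) (at? 1 w ∩? at? 2 o) (λ _ (p , q) → q , p) (λ _ (p , q) → q , p)) (trans (B-spec 1 h) b≡6)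
      total : # (avoid? w w′) + # U? ≤ 18
      total = subst (# (avoid? w w′) + # U? ≤_) k₂≡18 (#-pack (avoid? w w′) U? (at? 2 o) (λ _ → proj₁) (λ _ → [ proj₁ , proj₁ ]′)
        (λ { _ (_ , n , _) (inj₁ (_ , q)) → n q ; _ (_ , _ , n) (inj₂ (_ , q)) → n q }))
      union : 12 ≤ # U? + ν o w w′
      union = subst₂ _≤_ (cong₂ _+_ (six h) (six h′)) (cong (# U? +_) (#-cong _ (at? 2 o ∩? at? 1 w ∩? at? 1 w′) (λ _ ((p , q) , (_ , r)) →
          p , q , r) (λ _ (p , q , r) → (p , q) , (p , r))))
        (#-incl-excl (at? 2 o ∩? at? 1 w) (at? 2 o ∩? at? 1 w′) U? (λ _ → inj₁) (λ _ → inj₂))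
      arith : ∀ A U v → A + U ≤ 18 → 12 ≤ U + v → A ≤ 6 + v
      arith A U v p q = lin {A = A + U + 12} {B = 18 + (U + v)} 0 (+-mono-≤ {A + U} {18} {12} {U + v} p q) (solve (A ∷ U ∷ v ∷ []))

    below⊂avoid : ∀ {z w w′} → d w z ≡ 3 → d w′ z ≡ 3 → ∀ x → d z x ≡ 1 × d o x ≡ 2 → d o x ≡ 2 × (¬ d w x ≡ 1 × ¬ d w′ x ≡ 1)
    below⊂avoid h h′ x (p , q) = q , (λ r → no-tri r (sy p) h) , (λ r → no-tri r (sy p) h′)

    nine : ∀ {z} → d o z ≡ 3 → # (at? 1 z ∩? at? 2 o) ≡ 9
    nine h = trans (C-spec 2 h) C3≡9

    -- The c₃ = 9 neighbours of z in Γ₂(o) avoid w and w′, so 9 ≤ 6 + ν, and ν = 3 occurs for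
    -- L-pairs only.
    far-L : ∀ {z w w′} → d o z ≡ 3 → d o w ≡ 1 → d w z ≡ 3 → d o w′ ≡ 1 → d w′ z ≡ 3 → ¬ w ≡ w′ → L o w w′
    far-L {z} {w} {w′} h hw wz hw′ w′z ne = [ (λ e → [ (λ l → l) , (λ r → ⊥-elim (small (ν-R hw hw′ r) (s≤s (s≤s (s≤s z≤n))))) ]′ (adj-type hw hw′ e))
                                              , (λ e → ⊥-elim (small (proj₂ (nonadj-sν hw hw′ e)) (s≤s (s≤s z≤n)))) ]′ (local hw hw′ ne)
      where
      three : 9 ≤ 6 + ν o w w′
      three = subst (_≤ 6 + ν o w w′) (nine h) (≤-trans (#-mono (at? 1 z ∩? at? 2 o) (avoid? w w′) (below⊂avoid wz w′z)) (avoiding hw hw′))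
      small : ∀ {m} → ν o w w′ ≡ m → m < 3 → ⊥
      small e lt = <⇒≱ lt (+-cancelˡ-≤ 6 3 _ (subst (λ t → 9 ≤ 6 + t) e three))

    -- The a₃ = 3 vertices of Γ(o) at distance 3 from z are pairwise L-related by `far-L`, and an
    -- L-class has just 3 elements.
    column-of : ∀ z → d o z ≡ 3 → ∃[ j ] (∀ i → d (g i j) z ≡ 3)
    column-of z h = go (#-∃ V? (subst (0 <_) (sym V3) (s≤s z≤n)))
      where
      V? = at? 1 o ∩? at? 3 z
      V3 : # V? ≡ 3
      V3 = a₃ (sy h)
      go : ∃[ w ] (d o w ≡ 1 × d z w ≡ 3) → ∃[ j ] (∀ i → d (g i j) z ≡ 3)
      go (w , hw , zw) = named (g-sur w hw)
        where
        cls? = λ u → (u F.≟ w) ⊎-dec LA? hw u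
        cls3 : # cls? ≡ 3
        cls3 = trans (#-split (λ u → u F.≟ w) (LA? hw) cls? (λ _ q → q) (λ _ → inj₁) (λ _ → inj₂) (λ { _ refl (_ , l) →
            d≢ (proj₁ l) refl })) (cong₂ _+_ (#-sing w) (proj₁ (degrees hw)))
        V⊂cls : ∀ u → d o u ≡ 1 × d z u ≡ 3 → u ≡ w ⊎ (d o u ≡ 1 × L o w u)
        V⊂cls u (p , q) = [ inj₁ , (λ ne → inj₂ (p , far-L h hw (sy zw) p (sy q) (λ t → ne (sym t)))) ]′ (toSum (u F.≟ w))
        cls⊂V = #-full V? cls? V⊂cls (≤-reflexive (trans cls3 (sym V3)))
        named : ∃[ r ] ∃[ j ] g r j ≡ w → ∃[ j ] (∀ i → d (g i j) z ≡ 3)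
        named (r , j , refl) = j , λ i → sy (proj₂ (cls⊂V (g i j) ([ (λ { refl → inj₁ refl }) , (λ ne →
            inj₂ (g∈ i j , col ne)) ]′ (toSum (r F.≟ i)))))

    -- At most 6 + 3 vertices of Γ₂(o) avoid two entries of column j, and the 9 neighbours of z
    -- there already do.
    below : ∀ {z j i p} → d o z ≡ 3 → (∀ r → d (g r j) z ≡ 3) → mem j p ≡ false → d (X i p) z ≡ 1
    below {z} {j} {i} {p} h column m = sy (proj₁ (#-full (at? 1 z ∩? at? 2 o) (avoid? w w′) (below⊂avoid (column zero) (column (suc zero)))
        (≤-trans (avoiding (g∈ zero j) (g∈ (suc zero) j)) (≤-reflexive (trans (cong (6 +_) (ν-L (g∈ zero j) (g∈ (suc zero) j) (col λ ()))) (sym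
            (nine h)))))
        (X i p) (oX i p , not-near , not-near)))
      where
      w = g zero j
      w′ = g (suc zero) j
      not-near : ∀ {r} → ¬ d (g r j) (X i p) ≡ 1
      not-near {r} e = contradiction (trans (sym m) (proj₂ (XCode.near⁻ (X-code i p) r j (sy e)))) λ ()

    not-below : ∀ {z j i p} → (∀ r → d (g r j) z ≡ 3) → mem j p ≡ true → ¬ d (X i p) z ≡ 1
    not-below {z} {j} {i} {p} column m e = go (two-others i)
      where
      go : ∃[ r ] ∃[ r′ ] (¬ r ≡ i × ¬ r′ ≡ i × ¬ r ≡ r′) → ⊥
      go (r , _ , n₁ , _) = no-tri (sy (XCode.near (X-code i p) r j n₁ m)) e (column r)

    -- The column determines the 9 neighbours in Γ₂(o), and distinct vertices have at most max(a, c)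
    -- = 5 common neighbours.
    column-unique : ∀ {z z′ j} → d o z ≡ 3 → d o z′ ≡ 3 → (∀ r → d (g r j) z ≡ 3) → (∀ r → d (g r j) z′ ≡ 3) → z ≡ z′
    column-unique {z} {z′} {j} h h′ col₁ col₂ = decidable-stable (z F.≟ z′) λ ne → [ (λ e → ne (d-zero e)) ,
        [ (λ e → many (≤-trans (≤-reflexive (codeg₁ e)) (≤-trans (≤-reflexive a≡5) (m≤m+n 5 3)))) , (λ e →
            many (≤-trans (≤-reflexive (codeg₂ e)) (≤-trans (≤-reflexive c≡4) (m≤m+n 4 4)))) ]′ ]′ (nb-of common)
      where
      sub : ∀ x → d z x ≡ 1 × d o x ≡ 2 → d z′ x ≡ 1 × d z x ≡ 1
      sub x (p , q) = go (X-cover x q)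
        where
        go : ∃[ i ] ∃[ q ] X i q ≡ x → d z′ x ≡ 1 × d z x ≡ 1
        go (i , q′ , refl) = [ (λ m → ⊥-elim (not-below col₁ m (sy p))) , (λ m → sy (below h′ col₂ m) , p) ]′ (bool (mem j q′))
          where
          bool : ∀ t → t ≡ true ⊎ t ≡ false
          bool true = inj₁ refl
          bool false = inj₂ refl
      nine≤ : 9 ≤ # (at? 1 z′ ∩? at? 1 z)
      nine≤ = subst (_≤ # (at? 1 z′ ∩? at? 1 z)) (nine h) (#-mono (at? 1 z ∩? at? 2 o) (at? 1 z′ ∩? at? 1 z) sub)
      many : # (at? 1 z′ ∩? at? 1 z) ≤ 8 → ⊥
      many p = <⇒≱ nine≤ p
      common : ∃[ x ] (d z′ x ≡ 1 × d z x ≡ 1)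
      common = #-∃ (at? 1 z′ ∩? at? 1 z) (≤-trans (s≤s z≤n) nine≤)
      nb-of : ∃[ x ] (d z′ x ≡ 1 × d z x ≡ 1) → d z z′ ≡ 0 ⊎ d z z′ ≡ 1 ⊎ d z z′ ≡ 2
      nb-of (x , p , q) = nb (sy p) q

    opaque

      column-exists : ∀ j → ∃[ z ] (d o z ≡ 3 × (∀ r → d (g r j) z ≡ 3))
      column-exists = go (enumerate (at? 3 o) 4 k₃≡4)
        where
        go : Enumeration (at 3 o) 4 → ∀ j → ∃[ z ] (d o z ≡ 3 × (∀ r → d (g r j) z ≡ 3))
        go E j = el (proj₁ (onto j)) , prop (proj₁ (onto j)) , subst (λ t → ∀ r →
            d (g r t) (el (proj₁ (onto j))) ≡ 3) (proj₂ (onto j)) (proj₂ (cl (proj₁ (onto j))))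
          where
          open Enumeration E
          cl : ∀ i → ∃[ j ] (∀ r → d (g r j) (el i) ≡ 3)
          cl i = column-of (el i) (prop i)
          onto : ∀ j → ∃[ i ] proj₁ (cl i) ≡ j
          onto = injective⇒surjective (λ i → proj₁ (cl i)) (λ {i} {i′} e → inj (column-unique (prop i) (prop i′) (proj₂ (cl i))
                   (subst (λ t → ∀ r → d (g r t) (el i′) ≡ 3) (sym e) (proj₂ (cl i′)))))

    Z : Fin 4 → Fin n
    Z j = proj₁ (column-exists j)
    oZ : ∀ j → d o (Z j) ≡ 3
    oZ j = proj₁ (proj₂ (column-exists j))
    Z-col : ∀ j r → d (g r j) (Z j) ≡ 3
    Z-col j = proj₂ (proj₂ (column-exists j))

    Z-cover : ∀ z → d o z ≡ 3 → ∃[ j ] Z j ≡ z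
    Z-cover z h = go (column-of z h)
      where
      go : ∃[ j ] (∀ i → d (g i j) z ≡ 3) → ∃[ j ] Z j ≡ z
      go (j , q) = j , column-unique (oZ j) h (Z-col j) q

    Z-inj : ∀ {j j′} → Z j ≡ Z j′ → j ≡ j′
    Z-inj {j} {j′} e = decidable-stable (j F.≟ j′) go
      where
      go : ¬ ¬ j ≡ j′
      go ne = 5≤3 (≤-trans (#-pack (λ u → u F.≟ g zero j) (at? 1 o ∩? at? 3 (Z j′)) V? (λ { _ refl → g∈ zero j , subst (λ t →
          d t (g zero j) ≡ 3) e (sy (Z-col j zero)) }) (λ _ q → q) (λ { _ refl q → never (proj₂ q) }))
                   (≤-reflexive (a₃ (sy (oZ j′)))))
        where
        V? = at? 1 o ∩? at? 3 (Z j′)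
        5≤3 : # (λ u → u F.≟ g zero j) + # (at? 1 o ∩? at? 3 (Z j′)) ≤ 3 → ⊥
        5≤3 q = <⇒≱ {3} {4} ≤-refl (subst₂ (λ s t → s + t ≤ 3) (#-sing (g zero j)) (a₃ (sy (oZ j′))) q)
        never : ¬ d (Z j′) (g zero j) ≡ 3
        never q = ⊥-elim (L≠off (far-L (oZ j′) (g∈ zero j) (sy q) (g∈ (suc zero) j′) (Z-col j′ (suc zero)) (λ t → ne (proj₂ (g-inj t)))))
          where
          L≠off : L o (g zero j) (g (suc zero) j′) → ⊥
          L≠off l = clash (proj₁ l) (off (λ ()) ne)

    -- Each of the four vertices of Γ₃(o) has a₃ = 3 neighbours there, that is all the others.
    Z-adj : ∀ {j j′} → ¬ j ≡ j′ → d (Z j) (Z j′) ≡ 1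
    Z-adj {j} {j′} ne = proj₁ (#-full (at? 1 (Z j) ∩? at? 3 o) rest? (λ u (p , q) → q , λ { refl → d≢ p refl })
        (≤-reflexive (trans (suc-injective (trans (sym (#-remove (at? 3 o) (Z j) (oZ j))) k₃≡4)) (sym (a₃ (oZ j))))) (Z j′) (oZ j′ , λ e →
            ne (sym (Z-inj e))))
      where
      rest? = λ z → at? 3 o z ×-dec ¬? (z F.≟ Z j)

    ψ : Code₇ → Fin n
    ψ k₀ = o
    ψ (k₁ i j) = g i j
    ψ (k₂ i p) = X i p
    ψ (k₃ j) = Z j

    cover : ∀ v → ∃[ c ] ψ c ≡ v
    cover v = go (d o v) refl
      where
      go : ∀ i → d o v ≡ i → ∃[ c ] ψ c ≡ v
      go 0 h = k₀ , d-zero h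
      go 1 h = k₁ (proj₁ (g-sur v h)) (proj₁ (proj₂ (g-sur v h))) , proj₂ (proj₂ (g-sur v h))
      go 2 h = k₂ (proj₁ (X-cover v h)) (proj₁ (proj₂ (X-cover v h))) , proj₂ (proj₂ (X-cover v h))
      go 3 h = k₃ (proj₁ (Z-cover v h)) , proj₂ (Z-cover v h)
      go (suc (suc (suc (suc i)))) h = ⊥-elim ((λ (u , p , _) → at-most-3 p) (down 4 i h))

    flip : ∀ x y → (d x y ≡ᵇ 1) ≡ (d y x ≡ᵇ 1)
    flip x y = cong (_≡ᵇ 1) (d-sym x y)

    gap : ∀ {i j x y} → d o x ≡ i → d o y ≡ j → {_ : B.T (suc i <ᵇ j)} → (d x y ≡ᵇ 1) ≡ false
    gap {i} {j} p q {t} = dist≡ᵇ1-false λ r → <⇒≱ (<ᵇ⇒< (suc i) j t) (≤-trans (tri′ p r q) (≤-reflexive (+-comm i 1)))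

    rule₁₁ : ∀ i j i′ j′ → (d (g i j) (g i′ j′) ≡ᵇ 1) ≡ (if finEq i i′ then not (finEq j j′) else finEq j j′)
    rule₁₁ i j i′ j′ = go (i F.≟ i′) (j F.≟ j′)
      where
      go : Dec (i ≡ i′) → Dec (j ≡ j′) → (d (g i j) (g i′ j′) ≡ᵇ 1) ≡ (if finEq i i′ then not (finEq j j′) else finEq j j′)
      go (yes refl) (yes refl) = trans (cong (_≡ᵇ 1) (d-refl (g i j))) (sym (cong₂ (λ s t → if s then not t else t) (finEq-refl i) (finEq-refl j)))
      go (yes refl) (no ne) = trans (sym (dist≡ᵇ1-true (proj₁ (row ne)))) (sym (cong₂ (λ s t →
          if s then not t else t) (finEq-refl i) (finEq-false ne)))
      go (no ne) (yes refl) = trans (sym (dist≡ᵇ1-true (proj₁ (col ne)))) (sym (cong₂ (λ s t →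
          if s then not t else t) (finEq-false ne) (finEq-refl j)))
      go (no ne) (no ne′) = trans (dist≡ᵇ1-false (λ e → clash e (off ne ne′))) (sym (cong₂ (λ s t →
          if s then not t else t) (finEq-false ne) (finEq-false ne′)))

    rule₁₂ : ∀ r j i p → (d (g r j) (X i p) ≡ᵇ 1) ≡ not (finEq r i) ∧ mem j p
    rule₁₂ r j i p = go (r F.≟ i) (mem j p) refl
      where
      go : Dec (r ≡ i) → ∀ t → mem j p ≡ t → (d (g r j) (X i p) ≡ᵇ 1) ≡ not (finEq r i) ∧ t
      go (yes e) t _ = trans (dist≡ᵇ1-false (λ h → proj₁ (XCode.near⁻ (X-code i p) r j (sy h)) e)) (sym (cong (λ s → not s ∧ t) (finEq-true e)))
      go (no ne) true m = trans (sym (dist≡ᵇ1-true (sy (XCode.near (X-code i p) r j ne m)))) (sym (cong (λ s → not s ∧ true) (finEq-false ne)))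
      go (no ne) false m = trans (dist≡ᵇ1-false (λ h → contradiction (trans (sym m) (proj₂ (XCode.near⁻ (X-code i p) r j (sy h)))) λ ())) (sym
          (cong (λ s → not s ∧ false) (finEq-false ne)))

    rule₂₂ : ∀ i p i′ p′ → (d (X i p) (X i′ p′) ≡ᵇ 1) ≡ (if finEq i i′ then (not (finEq p p′) ∧ share p p′) else finEq p p′)
    rule₂₂ i p i′ p′ = go (i F.≟ i′) (p F.≟ p′) (share p p′) refl
      where
      f : Bool → Bool → Bool → Bool
      f s t u = if s then (not t ∧ u) else t
      row-adj : ∀ {p p′} → ¬ p ≡ p′ → ∃[ j ] (mem j p ≡ true × mem j p′ ≡ true) → d (X i p) (X i p′) ≡ 1
      row-adj {p} {p′} ne (j , m , m′) = adj-row {i} {p} {p′} {j} ne m m′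
      go : Dec (i ≡ i′) → Dec (p ≡ p′) → ∀ u → share p p′ ≡ u → (d (X i p) (X i′ p′) ≡ᵇ 1) ≡ (if finEq i i′ then (not (finEq p p′) ∧ u) else finEq
          p p′)
      go (yes refl) (yes refl) u _ = trans (cong (_≡ᵇ 1) (d-refl (X i p))) (sym (cong₂ (λ s t → f s t u) (finEq-refl i) (finEq-refl p)))
      go (yes refl) (no ne) true m = trans (sym (dist≡ᵇ1-true (row-adj ne (mem-share {p} {p′} m)))) (sym (cong₂ (λ s t →
          f s t true) (finEq-refl i) (finEq-false ne)))
      go (yes refl) (no ne) false m = trans (dist≡ᵇ1-false (λ h → [ (λ (_ , _ , q) → contradiction (trans (sym m) q) λ ()) , (λ (q , _) →
          q refl) ]′ (adj⇒rule h))) (sym (cong₂ (λ s t → f s t false) (finEq-refl i) (finEq-false ne)))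
      go (no ne) (yes refl) u _ = trans (sym (dist≡ᵇ1-true (adj-col ne))) (sym (cong₂ (λ s t → f s t u) (finEq-false ne) (finEq-refl p)))
      go (no ne) (no ne′) u _ = trans (dist≡ᵇ1-false (λ h → [ (λ (q , _) → ne q) , (λ (_ , q) → ne′ q) ]′ (adj⇒rule h))) (sym (cong₂ (λ s t →
          f s t u) (finEq-false ne) (finEq-false ne′)))

    rule₂₃ : ∀ i p j → (d (X i p) (Z j) ≡ᵇ 1) ≡ not (mem j p)
    rule₂₃ i p j = go (mem j p) refl
      where
      go : ∀ t → mem j p ≡ t → (d (X i p) (Z j) ≡ᵇ 1) ≡ not t
      go true m = dist≡ᵇ1-false (not-below (Z-col j) m)
      go false m = sym (dist≡ᵇ1-true (below (oZ j) (Z-col j) m))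

    rule₃₃ : ∀ j j′ → (d (Z j) (Z j′) ≡ᵇ 1) ≡ not (finEq j j′)
    rule₃₃ j j′ = go (j F.≟ j′)
      where
      go : Dec (j ≡ j′) → (d (Z j) (Z j′) ≡ᵇ 1) ≡ not (finEq j j′)
      go (yes refl) = trans (cong (_≡ᵇ 1) (d-refl (Z j))) (sym (cong not (finEq-refl j)))
      go (no ne) = trans (sym (dist≡ᵇ1-true (Z-adj ne))) (sym (cong not (finEq-false ne)))

    rule : ∀ c c′ → (d (ψ c) (ψ c′) ≡ᵇ 1) ≡ rule₇ c c′
    rule k₀ k₀ = cong (_≡ᵇ 1) (d-refl o)
    rule k₀ (k₁ i j) = sym (dist≡ᵇ1-true (g∈ i j))
    rule k₀ (k₂ i p) = gap (d-refl o) (oX i p)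
    rule k₀ (k₃ j) = gap (d-refl o) (oZ j)
    rule (k₁ i j) (k₁ i′ j′) = rule₁₁ i j i′ j′
    rule (k₁ r j) (k₂ i p) = rule₁₂ r j i p
    rule (k₁ i j) (k₃ j′) = gap (g∈ i j) (oZ j′)
    rule (k₂ i p) (k₂ i′ p′) = rule₂₂ i p i′ p′
    rule (k₂ i p) (k₃ j) = rule₂₃ i p j
    rule (k₃ j) (k₃ j′) = rule₃₃ j j′
    rule (k₁ i j) k₀ = trans (flip (g i j) o) (sym (dist≡ᵇ1-true (g∈ i j)))
    rule (k₂ i p) k₀ = trans (flip (X i p) o) (gap (d-refl o) (oX i p))
    rule (k₃ j) k₀ = trans (flip (Z j) o) (gap (d-refl o) (oZ j))
    rule (k₂ i p) (k₁ r j) = trans (flip (X i p) (g r j)) (rule₁₂ r j i p)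
    rule (k₃ j′) (k₁ i j) = trans (flip (Z j′) (g i j)) (gap (g∈ i j) (oZ j′))
    rule (k₃ j) (k₂ i p) = trans (flip (Z j) (X i p)) (rule₂₃ i p j)

    iso-at : IsoD S J73-V J73-adj
    iso-at = iso-from-codes S J73-adj φ₇ φ₇⁻ φ₇φ₇⁻ φ₇⁻φ₇ ψ cover (λ c c′ → trans (rule c c′) (rule₇-adj c c′)) twins₇

  iso : IsoD S J73-V J73-adj
  iso = Base.iso-at w₀ (grid w₀)

-- The classification

count-cong : ∀ {n} {p q : Fin n → Bool} → (∀ z → p z ≡ q z) → count p ≡ count q
count-cong {zero}  h = refl
count-cong {suc n} h = cong₂ (λ x y → ind x + y) (h zero) (count-cong (λ i → h (suc i)))

module Regular {n : ℕ} (G : Graph n) (D : ℕ) (dr : IsDistanceRegular G D) (3≤D : 3 ≤ D)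
  (small : ∀ (x : Fin n) → 2 * kAt G x 2 ≤ 3 * IsDistanceRegular.valency dr) where

  open IsDistanceRegular dr renaming (b to b′; c to c′)
  open Distance G connected

  adj-≡ᵇ : ∀ x y → (dist G x y ≡ᵇ 1) ≡ adj G x y
  adj-≡ᵇ x y = bool-ext (λ h → adj-dist (≡ᵇ-true h)) (λ h → true-≡ᵇ (dist-adj h))

  nbrs-# : ∀ x y i → # (λ z → (dist G y z ≟ 1) ×-dec (dist G x z ≟ i)) ≡ nbrsAt G x y i
  nbrs-# x y i = trans (#-count (λ z → (dist G y z ≟ 1) ×-dec (dist G x z ≟ i))) (count-cong (λ z → cong (_∧ (dist G x z ≡ᵇ i)) (adj-≡ᵇ y z)))

  scheme : Scheme n
  scheme = record
    { d = dist G ; d-refl = dist-refl ; d-zero = dist-zero ; d-sym = dist-sym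
    ; d-step = λ h → dist-step (adj-dist h)
    ; d-pred = λ h → proj₁ (dist-pred h) , dist-adj (proj₁ (proj₂ (dist-pred h))) , proj₂ (proj₂ (dist-pred h))
    ; B = b′ ; C = c′
    ; B-spec = λ { {x} {y} i refl → trans (nbrs-# x y (suc i)) (b-spec x y) }
    ; C-spec = λ { {x} {y} i h → trans (nbrs-# x y i) (subst (λ t → nbrsAt G x y (pred t) ≡ c′ t) h (c-spec x y)) }
    }

  open Scheme scheme using (d; at?; sy; d≢; clash; nb)

  edge : ∃[ x ] ∃[ y ] dist G x y ≡ 1
  edge = go D 3≤D (proj₁ diam-att) (proj₁ (proj₂ diam-att)) (proj₂ (proj₂ diam-att))
    where
    go : ∀ D → 3 ≤ D → ∀ x y → dist G x y ≡ D → ∃[ x ] ∃[ y ] dist G x y ≡ 1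
    go (suc D) _ x y h = proj₁ (dist-pred h) , y , dist-adj (proj₁ (proj₂ (dist-pred h)))

  a′ : ℕ
  a′ = b′ 0 ∸ suc (b′ 1)

  k-split : b′ 0 ≡ suc (a′ + b′ 1)
  k-split = trans (sym (m∸n+n≡m enough)) (+-suc a′ (b′ 1))
    where
    x = proj₁ edge
    y = proj₁ (proj₂ edge)
    xy = proj₂ (proj₂ edge)
    enough : suc (b′ 1) ≤ b′ 0
    enough = subst₂ _≤_ (cong₂ _+_ (#-sing x) (Scheme.B-spec scheme 1 xy))
      (trans (#-cong (at? 1 y) (at? 1 y ∩? at? 1 y) (λ _ p → p , p) (λ _ → proj₁)) (Scheme.B-spec scheme 0 (dist-refl y)))
      (#-pack (λ z → z F.≟ x) (at? 1 y ∩? at? 2 x) (at? 1 y) (λ { _ refl → sy xy }) (λ _ → proj₁) (λ { _ refl (_ , q) → d≢ q refl }))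

  setting : Setting n
  setting = record { S = scheme ; a = a′ ; hk = k-split ; D = D ; diam-≤ = diam-le ; diam-att = diam-att ; 3≤D = 3≤D
                   ; k₂-small = λ x → subst (λ t → 2 * t ≤ 3 * b′ 0) (sym (#-count (at? 2 x))) (small x) }

  open Small setting using (b; c; b₂; k; C; 0<c; c≤b; taylor; b₂≡1; C1≡1; a≡0-if-c≡1)

  to-iso : ∀ {V adjV} → IsoD scheme V adjV → Iso G V adjV
  to-iso (isoD e h) = e , λ x y → trans (sym (adj-≡ᵇ x y)) (h x y)

  even : ℕ → Bool
  even zero = true
  even (suc m) = not (even m)

  even-suc : ∀ m → ¬ even m ≡ even (suc m)
  even-suc m e with even m
  even-suc m () | true
  even-suc m () | false

  bipartite : (∀ {o x y} → d o x ≡ d o y → d x y ≡ 1 → ⊥) → Bipartite G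
  bipartite level = (λ z → even (d o z)) , colour
    where
    o = proj₁ edge
    colour : ∀ x y → adj G x y ≡ true → ¬ even (d o x) ≡ even (d o y)
    colour x y h e = go (d o x) refl
      where
      xy = dist-adj h
      go : ∀ i → d o x ≡ i → ⊥
      go zero p = even-suc 0 (trans (sym (cong even p)) (trans e (cong even (subst (λ t → d t y ≡ 1) (sym (dist-zero p)) xy))))
      go (suc i) p = [ (λ q → even-suc i (sym (trans (sym (cong even p)) (trans e (cong even q)))))
                     , [ (λ q → level (trans p (sym q)) xy) , (λ q → even-suc (suc i) (trans (sym (cong even p)) (trans e (cong even q)))) ]′ ]′
                         (nb xy p)

  Conclusion : Set
  Conclusion = (b′ 0 ≡ 2 × Polygon G)
    ⊎ (D ≡ 3 × Bipartite G)
    ⊎ (D ≡ 3 × ∃[ μ ] (b′ 1 ≡ μ × b′ 2 ≡ 1 × c′ 1 ≡ 1 × c′ 2 ≡ μ × c′ 3 ≡ b′ 0))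
    ⊎ Iso G J73-V J73-adj
    ⊎ Iso G Cube4-V Cube4-adj

  polygon-case : c ≡ 1 → Conclusion
  polygon-case e = inj₁ (k≡2 , proj₁ poly , proj₁ (proj₂ poly) , to-iso (proj₂ (proj₂ poly)))
    where
    k≡2 : b′ 0 ≡ 2
    k≡2 = trans k-split (cong₂ (λ s t → suc (s + t)) (proj₂ (a≡0-if-c≡1 e)) (proj₁ (a≡0-if-c≡1 e)))
    poly = Cycle.polygon scheme k≡2 (proj₁ edge) (proj₁ (proj₂ edge)) (proj₂ (proj₂ edge))

  taylor-case : 2 ≤ c → b ≡ c → Conclusion
  taylor-case 2≤c e = inj₂ (inj₂ (inj₁ (proj₁ (taylor e 2≤c) , c , e , b₂≡1 e , C1≡1 , refl , proj₂ (taylor e 2≤c))))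

  other-case : c < b → Conclusion
  other-case c<b = split (a′ ≟ 0)
    where
    split : Dec (a′ ≡ 0) → Conclusion
    split (yes a≡0) = [ (λ (D≡3 , level) → inj₂ (inj₁ (D≡3 , bipartite (λ {o} {x} {y} → level {o} {x} {y}))))
                      , (λ A → inj₂ (inj₂ (inj₂ (inj₂ (to-iso (Cube.cube setting a≡0 c<b A)))))) ]′ (TriangleFree.triangle-free setting a≡0 c<b)
    split (no a≢0) = inj₂ (inj₂ (inj₂ (inj₁ (to-iso (JohnsonIso.iso setting 1≤a c<b (DenseArray.dense setting 1≤a c<b))))))
      where
      1≤a : 1 ≤ a′
      1≤a = n≢0⇒n>0 a≢0

  conclusion : Conclusion
  conclusion with c ≟ 1 | b ≟ c
  ... | yes e | _     = polygon-case e
  ... | no ne | yes e = taylor-case (≤∧≢⇒< 0<c (λ t → ne (sym t))) e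
  ... | no _  | no ne = other-case (≤∧≢⇒< c≤b (λ t → ne (sym t)))

theorem13 : ∀ {n : ℕ} (Γ : Graph n) (D : ℕ) (dr : IsDistanceRegular Γ D) →
    3 ≤ D →
    (∀ (x : Fin n) → 2 * kAt Γ x 2 ≤ 3 * IsDistanceRegular.valency dr) →
    (IsDistanceRegular.valency dr ≡ 2 × Polygon Γ)
    ⊎ (D ≡ 3 × Bipartite Γ)
    ⊎ (D ≡ 3 × ∃[ μ ] (IsDistanceRegular.b dr 1 ≡ μ × IsDistanceRegular.b dr 2 ≡ 1
    × IsDistanceRegular.c dr 1 ≡ 1 × IsDistanceRegular.c dr 2 ≡ μ
    × IsDistanceRegular.c dr 3 ≡ IsDistanceRegular.valency dr))
    ⊎ Iso Γ J73-V J73-adj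
    ⊎ Iso Γ Cube4-V Cube4-adj
theorem13 Γ D dr 3≤D small = Regular.conclusion Γ D dr 3≤D small
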